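{- Let $d,K\in\mathbb{N}_{+}$, $s\in\mathbb{N}$, let $p$ be a prime, and let $\delta>0$. Let $M\colon\mathbb{F}_{p}^{d}\to\mathbb{F}_{p}$ be a non-degenerate quadratic form and let $\Omega\subseteq(\mathbb{F}_{p}^{d})^{K}$ be a nice and consistent $M$-set. If $d\geq\max\{2r_{M}(\Omega)+1,4K-1\}$ and $p\gg_{d,s}\delta^{ -O_{d,s}(1)}$, then: (i) $\Omega$ is $\delta$-irreducible up to degree $s$; (ii) $\tau(\Omega)$ is weakly $(\delta,p)$-irreducible up to degree $s$; (iii) $\tau(\Omega)$ is strongly $(\delta,p)$-irreducible up to degree $s$.
   Context: A quadratic form $M(n)=(nA)\cdot n+n\cdot u+v$ on $\mathbb{F}_p^d$ ($A$ symmetric) is non-degenerate if $\det A\ne0$. Identify $(\mathbb{F}_p^d)^K$ with $\mathbb{F}_p^{dK}$ and write elements as $(n_1,\dots,n_K)$, $n_i\in\mathbb{F}_p^d$. A linear map $L\colon(\mathbb{F}_p^d)^K\to(\mathbb{F}_p^d)^K$ is $d$-integral if $L(n_1,\dots,n_K)=(\sum_ia_{i,1}n_i,\dots,\sum_ia_{i,K}n_i)$ with $a_{i,j}\in\mathbb{F}_p$. An $(M,K)$-integral quadratic function is $F(n_1,\dots,n_K)=\sum_{1\le i\le j\le K}b_{i,j}(n_iA)\cdot n_j+\sum_iv_i\cdot n_i+u$ ($b_{i,j},u\in\mathbb{F}_p$, $v_i\in\mathbb{F}_p^d$); let $v'_M(F)$ be the vector of all $b_{i,j}$ and $v_i$ and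 $v_M(F)=(v'_M(F),u)$. A finite family $\{F_1,\dots,F_r\}$ of such functions is consistent if no linear combination of the $F_i$ is a nonzero constant function (equivalently $(0,\dots,0,1)\notin\mathrm{span}\{v_M(F_i)\}$), and independent if $v'_M(F_1),\dots,v'_M(F_r)$ are linearly independent. $F$ is nice if $F(n)=\sum_{1\le i\le k'}b_i(n_{k'}A)\cdot n_i+u$ for some $0\le k'\le K$, $b_i,u\in\mathbb{F}_p$; a family is nice if there exist a bijective $d$-integral linear $L$ and $w\in(\mathbb{F}_p^d)^K$ with every $F_i(L(\cdot)+w)$ nice. An $M$-set is $\Omega=\bigcap_iV(F_i)$ ($V$ = zero set) for such a family (the empty family allowed, giving $(\mathbb{F}_p^d)^K$); $\Omega$ is nice/consistent if the family can be chosen nice/consistent. For consistent $\Omega$, $r_M(\Omega)$ (total co-dimension) is the minimum size of an independent family with common zero set $\Omega$. $\tau\colon\mathbb{F}_p\to\{0,\dots,p-1\}$ is the natural bijection applied coordinatewise; $[p]=\{0,\dots,p-1\}$. For $P\in\mathrm{poly}(\mathbb{Z}^k\to\mathbb{R})$, $V_p(P)=\{n\in\mathbb{Z}^k\colon P(n+pm)\in\mathbb{Z}\ \forall m\in\mathbb{Z}^k\}$. A set $\Omega\subseteq\mathbb{F}_p^k$ is $\delta$-irreducible up to degree $s$ if for every polynomial $P\colon\mathbb{F}_p^k\to\mathbb{F}_p$ of degree $\le s$ either $|V(P)\cap\Omega|\le\delta|\Omega|$ or $\Omega\subseteq V(P)$. For $\Omega\subseteq\mathbb{Z}^k$ let $\Omega'=(\Omega+p\mathbb{Z}^k)\cap[p]^k$;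 $\Omega$ is weakly (resp. strongly) $(\delta,p)$-irreducible up to degree $s$ if for every polynomial $P\colon\mathbb{Z}^k\to\mathbb{R}$ of degree $\le s$ taking values in $\frac1p\mathbb{Z}$ (resp. in $\frac1{p^s}\mathbb{Z}$), either $|V_p(P)\cap\Omega'|\le\delta|\Omega'|$ or $\Omega'\subseteq V_p(P)$. "$p\gg_{d,s}\delta^{ -O_{d,s}(1)}$" means $p\ge C\delta^{ -C}$ for a sufficiently large $C$ depending on $d,s$. -}

module Defs where

open import Data.Nat as ℕ using (ℕ; zero; suc; NonZero; _≤ᵇ_)
open import Data.Nat.DivMod using (_mod_)
open import Data.Integer as ℤ using (ℤ; +_)
open import Data.Rational as ℚ using (ℚ; _/_)
open import Data.Fin as Fin using (Fin; toℕ; punchIn)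
open import Data.Fin.Properties using () renaming (_≟_ to _≟F_)
open import Data.Bool using (Bool; true; false; _∧_; if_then_else_)
open import Data.Product using (Σ; _×_; _,_; proj₁; proj₂)
open import Data.Sum using (_⊎_; inj₁; inj₂)
open import Data.List as List using (List; []; _∷_; length; foldr; filterᵇ; allFin)
open import Data.List.Relation.Unary.All using (All)
open import Data.List.Relation.Unary.Unique.Propositional using (Unique)
open import Data.List.Membership.Propositional using (_∈_)
open import Data.Vec as Vec using (Vec)
open import Function using (_∘_; _⇔_)
open import Relation.Nullary using (¬_; does)
open import Relation.Binary.PropositionalEquality using (_≡_; _≢_)

_^Q_ : ℚ → ℕ → ℚ
q ^Q zero  = ℚ.1ℚ
q ^Q suc n = q ℚ.* (q ^Q n)

fromℕQ : ℕ → ℚ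
fromℕQ n = (+ n) / 1

fromℤQ : ℤ → ℚ
fromℤQ z = z / 1

allFuns : {A : Set} → List A → (n : ℕ) → List (Fin n → A)
allFuns xs zero    = (λ ()) ∷ []
allFuns xs (suc n) =
  List.concatMap (λ x → List.map (λ f → λ { Fin.zero → x ; (Fin.suc i) → f i }) (allFuns xs n)) xs

module _ (p : ℕ) .{{_ : NonZero p}} where

  Fp : Set
  Fp = Fin p

  _+F_ : Fp → Fp → Fp
  a +F b = (toℕ a ℕ.+ toℕ b) mod p

  _*F_ : Fp → Fp → Fp
  a *F b = (toℕ a ℕ.* toℕ b) mod p

  0F 1F : Fp
  0F = 0 mod p
  1F = 1 mod p

  negF : Fp → Fp
  negF a = (p ℕ.∸ toℕ a) mod p

  _≡ᵇF_ : Fp → Fp → Bool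
  a ≡ᵇF b = does (a ≟F b)

  ΣF : (n : ℕ) → (Fin n → Fp) → Fp
  ΣF zero    f = 0F
  ΣF (suc n) f = f Fin.zero +F ΣF n (f ∘ Fin.suc)

  Vecp : ℕ → Set
  Vecp d = Fin d → Fp

  Mat : ℕ → Set
  Mat d = Fin d → Fin d → Fp

  dot : ∀ {d} → Vecp d → Vecp d → Fp
  dot {d} x y = ΣF d (λ a → x a *F y a)

  vecMat : ∀ {d} → Vecp d → Mat d → Vecp d
  vecMat {d} x A b = ΣF d (λ a → x a *F A a b)

  bil : ∀ {d} → Mat d → Vecp d → Vecp d → Fp
  bil A x y = dot (vecMat x A) y

  det : (d : ℕ) → Mat d → Fp
  det zero    A = 1F
  det (suc d) A =
    ΣF (suc d) (λ j → sgn j *F (A Fin.zero j *F det d (λ a b → A (Fin.suc a) (punchIn j b))))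
    where
    sgn : Fin (suc d) → Fp
    sgn j = if (toℕ j ℕ.% 2) ℕ.≡ᵇ 0 then 1F else negF 1F

  record QuadForm (d : ℕ) : Set where
    field
      A : Mat d
      u : Vecp d
      v : Fp

  evalM : ∀ {d} → QuadForm d → Vecp d → Fp
  evalM M n = (bil (QuadForm.A M) n n +F dot n (QuadForm.u M)) +F QuadForm.v M

  Symmetric : ∀ {d} → QuadForm d → Set
  Symmetric M = ∀ a b → QuadForm.A M a b ≡ QuadForm.A M b a

  NonDegenerate : ∀ {d} → QuadForm d → Set
  NonDegenerate {d} M = det d (QuadForm.A M) ≢ 0F

  Pt : ℕ → ℕ → Set
  Pt d K = Fin K → Vecp d

  addPt : ∀ {d K} → Pt d K → Pt d K → Pt d K
  addPt n m i a = n i a +F m i a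

  -- (M,K)-integral quadratic function
  --   F(n) = Σ_{i≤j} b_{i,j} (n_i A)·n_j + Σ_i v_i·n_i + u
  -- (the entries b i j with i > j are ignored)
  record IQF (d K : ℕ) : Set where
    field
      b  : Fin K → Fin K → Fp
      vs : Fin K → Vecp d
      u  : Fp

  _≤F_ : ∀ {K} → Fin K → Fin K → Bool
  i ≤F j = toℕ i ≤ᵇ toℕ j

  evalIQF : ∀ {d K} → QuadForm d → IQF d K → Pt d K → Fp
  evalIQF {d} {K} M F n =
    (ΣF K (λ i → ΣF K (λ j →
        if i ≤F j then IQF.b F i j *F bil (QuadForm.A M) (n i) (n j) else 0F))
     +F ΣF K (λ i → dot (IQF.vs F i) (n i)))
    +F IQF.u F

  CoefIdx : ℕ → ℕ → Set
  CoefIdx d K = (Fin K × Fin K) ⊎ (Fin K × Fin d)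

  coef' : ∀ {d K} → IQF d K → CoefIdx d K → Fp
  coef' F (inj₁ (i , j)) = if i ≤F j then IQF.b F i j else 0F
  coef' F (inj₂ (i , a)) = IQF.vs F i a

  Family : ℕ → ℕ → ℕ → Set
  Family d K r = Fin r → IQF d K

  Independent : ∀ {d K r} → Family d K r → Set
  Independent {d} {K} {r} fam =
    (c : Fin r → Fp) →
    (∀ (idx : CoefIdx d K) → ΣF r (λ k → c k *F coef' (fam k) idx) ≡ 0F) →
    ∀ k → c k ≡ 0F

  Consistent : ∀ {d K r} → QuadForm d → Family d K r → Set
  Consistent {d} {K} {r} M fam =
    (c : Fin r → Fp) (a : Fp) → a ≢ 0F →
    ¬ (∀ (n : Pt d K) → ΣF r (λ k → c k *F evalIQF M (fam k) n) ≡ a)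

  allB : (r : ℕ) → (Fin r → Bool) → Bool
  allB zero    f = true
  allB (suc r) f = f Fin.zero ∧ allB r (f ∘ Fin.suc)

  SubsetPt : ℕ → ℕ → Set
  SubsetPt d K = Pt d K → Bool

  zeroSet : ∀ {d K r} → QuadForm d → Family d K r → SubsetPt d K
  zeroSet {r = r} M fam n = allB r (λ k → evalIQF M (fam k) n ≡ᵇF 0F)

  IsZeroSetOf : ∀ {d K r} → QuadForm d → SubsetPt d K → Family d K r → Set
  IsZeroSetOf M Ω fam = ∀ n → Ω n ≡ zeroSet M fam n

  -- nice functions: F(n) = Σ_{1≤i≤k'} b_i (n_{k'}A)·n_i + u, 0 ≤ k' ≤ K
  -- (k' = 0: constant; k' = k+1 for k : Fin K, 0-based indices)
  NiceFn : ∀ {d K} → QuadForm d → (Pt d K → Fp) → Set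
  NiceFn {d} {K} M f =
    (Σ Fp λ u → ∀ n → f n ≡ u)
    ⊎ (Σ (Fin K) λ k → Σ (Fin K → Fp) λ b → Σ Fp λ u → ∀ n →
         f n ≡ ΣF K (λ i → if i ≤F k then b i *F bil (QuadForm.A M) (n k) (n i) else 0F) +F u)

  applyL : ∀ {d K} → (Fin K → Fin K → Fp) → Pt d K → Pt d K
  applyL {d} {K} a n j x = ΣF K (λ i → a i j *F n i x)

  Bijective : ∀ {d K} → (Pt d K → Pt d K) → Set
  Bijective {d} {K} L =
    (∀ (n m : Pt d K) → (∀ j x → L n j x ≡ L m j x) → ∀ i x → n i x ≡ m i x)
    × (∀ (m : Pt d K) → Σ (Pt d K) λ n → ∀ j x → L n j x ≡ m j x)

  NiceFamily : ∀ {d K r} → QuadForm d → Family d K r → Set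
  NiceFamily {d} {K} M fam =
    Σ (Fin K → Fin K → Fp) λ a → Bijective {d} {K} (applyL a) ×
    Σ (Pt d K) λ w → ∀ k → NiceFn M (λ n → evalIQF M (fam k) (addPt (applyL a n) w))

  NiceMSet : ∀ {d K} → QuadForm d → SubsetPt d K → Set
  NiceMSet {d} {K} M Ω = Σ ℕ λ r → Σ (Family d K r) λ fam → IsZeroSetOf M Ω fam × NiceFamily M fam

  ConsistentMSet : ∀ {d K} → QuadForm d → SubsetPt d K → Set
  ConsistentMSet {d} {K} M Ω = Σ ℕ λ r → Σ (Family d K r) λ fam → IsZeroSetOf M Ω fam × Consistent M fam

  IsTotalCodim : ∀ {d K} → QuadForm d → SubsetPt d K → ℕ → Set
  IsTotalCodim {d} {K} M Ω r =
    (Σ (Family d K r) λ fam → IsZeroSetOf M Ω fam × Independent fam)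
    × (∀ r' (fam : Family d K r') → IsZeroSetOf M Ω fam → Independent fam → r ℕ.≤ r')

  allPts : (d K : ℕ) → List (Pt d K)
  allPts d K = allFuns (allFuns (allFin p) d) K

  count : ∀ {d K} → SubsetPt d K → ℕ
  count {d} {K} S = length (filterᵇ S (allPts d K))

  -- polynomials F_p^{dK} → F_p, variables indexed by Fin K × Fin d
  -- (a list of terms: coefficient and monomial as a list of variables)
  PolyF : ℕ → ℕ → Set
  PolyF d K = List (Fp × List (Fin K × Fin d))

  evalPF : ∀ {d K} → PolyF d K → Pt d K → Fp
  evalPF P n = foldr (λ t acc → (proj₁ t *F monom (proj₂ t)) +F acc) 0F P
    where
    monom : _ → Fp
    monom m = foldr (λ v acc → n (proj₁ v) (proj₂ v) *F acc) 1F m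

  DegLeF : ∀ {d K} → ℕ → PolyF d K → Set
  DegLeF s P = All (λ t → length (proj₂ t) ℕ.≤ s) P

  IrreducibleF : ∀ {d K} → ℚ → ℕ → SubsetPt d K → Set
  IrreducibleF {d} {K} δ s Ω =
    ∀ (P : PolyF d K) → DegLeF s P →
      (fromℕQ (count (λ n → Ω n ∧ (evalPF P n ≡ᵇF 0F))) ℚ.≤ δ ℚ.* fromℕQ (count Ω))
      ⊎ (∀ n → Ω n ≡ true → evalPF P n ≡ 0F)

  τPt : ∀ {d K} → Pt d K → Vec ℤ (K ℕ.* d)
  τPt n = Vec.concat (Vec.tabulate (λ i → Vec.tabulate (λ a → + toℕ (n i a))))

  τSet : ∀ {d K} → SubsetPt d K → Vec ℤ (K ℕ.* d) → Set
  τSet {d} {K} Ω y = Σ (Pt d K) λ n → (Ω n ≡ true) × (τPt n ≡ y)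

-- polynomials ℤ^k → ℝ (rational coefficients), and (δ,p)-irreducibility

PolyQ : ℕ → Set
PolyQ k = List (ℚ × List (Fin k))

evalQ : ∀ {k} → PolyQ k → Vec ℤ k → ℚ
evalQ P x = foldr (λ t acc → (proj₁ t ℚ.* monom (proj₂ t)) ℚ.+ acc) ℚ.0ℚ P
  where
  monom : _ → ℚ
  monom m = foldr (λ v acc → fromℤQ (Vec.lookup x v) ℚ.* acc) ℚ.1ℚ m

DegLeQ : ∀ {k} → ℕ → PolyQ k → Set
DegLeQ s P = All (λ t → length (proj₂ t) ℕ.≤ s) P

IsIntQ : ℚ → Set
IsIntQ q = Σ ℤ λ z → q ≡ fromℤQ z

ValuesIn1/ : ∀ {k} → ℕ → PolyQ k → Set
ValuesIn1/ {k} q P = ∀ (x : Vec ℤ k) → IsIntQ (fromℕQ q ℚ.* evalQ P x)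

shiftP : ∀ {k} → ℕ → Vec ℤ k → Vec ℤ k → Vec ℤ k
shiftP p x m = Vec.zipWith ℤ._+_ x (Vec.map (λ z → (+ p) ℤ.* z) m)

Vp : ∀ {k} → ℕ → PolyQ k → Vec ℤ k → Set
Vp {k} p P x = ∀ (m : Vec ℤ k) → IsIntQ (evalQ P (shiftP p x m))

OmegaPrime : ∀ {k} → ℕ → (Vec ℤ k → Set) → Vec ℤ k → Set
OmegaPrime {k} p Ω x =
  (∀ i → (+ 0 ℤ.≤ Vec.lookup x i) × (Vec.lookup x i ℤ.< + p))
  × Σ (Vec ℤ k) λ y → Ω y × Σ (Vec ℤ k) λ m → x ≡ shiftP p y m

HasCard : ∀ {k} → (Vec ℤ k → Set) → ℕ → Set
HasCard {k} S N =
  Σ (List (Vec ℤ k)) λ L → Unique L × (∀ x → (x ∈ L) ⇔ S x) × (length L ≡ N)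

IrrZ : ∀ {k} → ℕ → ℚ → ℕ → ℕ → (Vec ℤ k → Set) → Set
IrrZ {k} q δ p s Ω =
  ∀ (P : PolyQ k) → DegLeQ s P → ValuesIn1/ q P →
    (∀ N M → HasCard (λ x → Vp p P x × OmegaPrime p Ω x) N →
             HasCard (OmegaPrime p Ω) M →
             fromℕQ N ℚ.≤ δ ℚ.* fromℕQ M)
    ⊎ (∀ x → OmegaPrime p Ω x → Vp p P x)

WeaklyIrreducible : ∀ {k} → ℚ → ℕ → ℕ → (Vec ℤ k → Set) → Set
WeaklyIrreducible δ p s Ω = IrrZ p δ p s Ω

StronglyIrreducible : ∀ {k} → ℚ → ℕ → ℕ → (Vec ℤ k → Set) → Set
StronglyIrreducible δ p s Ω = IrrZ (p ℕ.^ s) δ p s Ω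

-- After the affine change of variables Ω is the set of the n whose Gram matrix (⟨n_i , n_j⟩) lies in an affine set W
-- of matrices.  Let E_1 , … , E_K be mutually orthogonal isotropic vectors and write c(z) = (⟨z_k , E_l⟩).  Then
-- n = z + M c(z)⁻ᵀ E has Gram matrix Gram(z) + M + Mᵀ, so the part of Ω where c(n) is nonsingular is parametrised by the
-- pairs (z , M) with Gram(z) + M + Mᵀ ∈ W.  In these parameters any two points are joined by a curve along which z moves
-- linearly and the Gram matrix stays on a line; in Ω it becomes a rational curve of bounded degree.
--
-- All three assertions concern the p-integrality of a rational polynomial at the lifts of the points of Ω to ℤ₍ₚ₎.  A
-- polynomial function in one variable that is p-integral at more residues than its degree is p-integral throughout, so
-- one point at which integrality fails spoils all but boundedly many parameters on every curve through one of its lifts.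
-- Working with exact lifts, no congruences modulo powers of p have to be lifted, whatever the denominator pˢ.
--
-- A totally isotropic frame e_1 , … , e_h with dual isotropic frame f_1 , … , f_h, where h = 2K − 1, provides enough
-- charts to cover Ω up to a proportion O(1/p), and a bad point is carried from one chart to another along such a curve.
module Submission where

open import Algebra.Bundles using (CommutativeRing)
open import Algebra.Structures using (IsCommutativeRing)
import Algebra.Solver.Ring as RingSolver
import Algebra.Solver.Ring.AlmostCommutativeRing as ACR
open import Data.Bool using (Bool; true; false; not; if_then_else_; _∧_; _∨_)
open import Data.Empty using (⊥; ⊥-elim)
open import Data.Fin as Fin using (Fin; toℕ; punchIn; combine; remQuot)
open import Data.Fin.Properties using (all?; any?; combine-remQuot; remQuot-combine; suc-injective; toℕ-fromℕ<; toℕ-injective; toℕ<n) renaming (_≟_ to _≟Fin_)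
open import Data.Integer as ℤ using (ℤ; -[1+_]; +≤+; +<+) renaming (+_ to pos)
import Data.Integer.Divisibility.Signed as ℤD
import Data.Integer.Properties as ℤP
open import Data.List using (List; []; _∷_; _++_; allFin; concatMap; filterᵇ; foldr; length; map)
open import Data.List.Membership.Propositional using (_∈_)
open import Data.List.Membership.Propositional.Properties using (∈-allFin; ∈-length)
import Data.List.Membership.DecPropositional as DecMembership
open import Data.List.Properties using (length-++; length-map; length-tabulate)
open import Data.List.Relation.Unary.All as All using (All; []; _∷_)
import Data.List.Relation.Unary.All.Properties as AllP
open import Data.List.Relation.Unary.AllPairs as AllPairs using (AllPairs; []; _∷_)
import Data.List.Relation.Unary.AllPairs.Properties as APP
open import Data.List.Relation.Unary.Any as Any using (Any; here; there)
import Data.List.Relation.Unary.Any.Properties as AnyP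
open import Data.List.Relation.Unary.Unique.Propositional using (Unique)
open import Data.List.Relation.Unary.Unique.Propositional.Properties using (allFin⁺)
open import Data.Maybe using (Maybe; just; nothing)
open import Data.Nat as ℕ using (ℕ; zero; suc; NonZero; _≤_; _<_; z≤n; s≤s)
open import Data.Nat.Coprimality as Coprimality using (coprime-Bézout; coprime-divisor; prime⇒coprime)
import Data.Nat.Divisibility as ℕD
open import Data.Nat.DivMod using (_%_; _mod_; %-distribˡ-+; %-distribˡ-*; m%n<n; m*n%n≡0; m<n⇒m%n≡m; m≡m%n+[m/n]*n; n%n≡0)
open import Data.Nat.GCD using (module Bézout)
open import Data.Nat.Primality using (Prime; euclidsLemma; prime⇒irreducible)
import Data.Nat.Properties as ℕP
open import Data.Nat.Tactic.RingSolver using (solve-∀)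
open import Data.Product using (Σ; _×_; _,_; proj₁; proj₂; swap; uncurry)
open import Data.Rational as ℚ using (ℚ; mkℚ; 0ℚ; 1ℚ; ↥_; ↧_; toℚᵘ) renaming (_≤_ to _≤ℚ_; _<_ to _<ℚ_; _*_ to _*ℚ_)
import Data.Rational.Properties as ℚP
open import Data.Rational.Unnormalised using (mkℚᵘ; *≡*; *≤*) renaming (_≃_ to _≃ᵘ_)
import Data.Rational.Unnormalised.Properties as ℚᵘP
open import Data.Sum using (_⊎_; inj₁; inj₂; [_,_]′)
open import Data.Unit using (⊤; tt)
open import Data.Vec as Vec using (Vec; lookup; tabulate)
import Data.Vec.Properties as VecP
open import Function using (_∘_; Equivalence)
open import Level using (0ℓ)
open import Relation.Binary using (Decidable; IsEquivalence)
open import Relation.Binary.PropositionalEquality using (_≡_; _≢_; refl; sym; trans; cong; cong₂; subst; subst₂; module ≡-Reasoning) renaming (isEquivalence to ≡-isEquivalence)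
open import Relation.Nullary using (¬_; Dec; yes; no; does)
open import Relation.Nullary.Decidable using (¬?; decidable-stable; _×-dec_; _⊎-dec_)
open import Defs using (_^Q_; allFuns; fromℕQ; fromℤQ)

-- The value h = 2K - 1 is a balance. Adding to a row of n a combination of the f_m that is
-- orthogonal to all rows keeps the Gram matrix and changes the products with the e_m. If those
-- products satisfied a relation between rows, the relation serves to recover the move, so points
-- with a relation are rare as soon as there are at least as many moves as relations, namely q^K.
-- The moves of a row form the kernel of the K × h matrix of products with the f_m, of dimension at
-- least h - K + 1 = K when its rows are dependent, but only K - 1 when they are not. Hence rarity
-- is available only for points dependent with respect to both the e_m and the f_m. Charts on both
-- sides are required, and a bad point on one side has to force one on the other side. There the
-- missing power of q is regained by confining the relations to a hyperplane, which is possible when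
-- Σ_m ⟨n_k , e_m⟩⟨n_k , f_m⟩ is non-zero for one fixed row k. An anisotropic vector u orthogonal to
-- the frame is used to make this sum non-zero. Frame and u together take 2h + 1 = 4K - 1
-- dimensions.

-- Counting in finite sets with an equivalence.

record Finite (A : Set) : Set₁ where
  infix 4 _≈_
  field
    -- Points, matrices and index families are functions and can be compared pointwise only; hence
    -- the equivalence, and the `Respects` hypotheses wherever a predicate is evaluated at a listed
    -- representative.
    _≈_      : A → A → Set
    ≈-equiv  : IsEquivalence _≈_
    _≈?_     : Decidable _≈_
    enum     : List A
    complete : ∀ x → Any (x ≈_) enum
    unique   : AllPairs (λ x y → ¬ (x ≈ y)) enum
  open IsEquivalence ≈-equiv public renaming (refl to ≈-refl; sym to ≈-sym; trans to ≈-trans) hiding (reflexive; isPartialEquivalence)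

  Respects : (A → Bool) → Set
  Respects P = ∀ {x y} → x ≈ y → P x ≡ true → P y ≡ true

  # : (A → Bool) → ℕ
  # P = length (filterᵇ P enum)

  size : ℕ
  size = length enum

module _ {A : Set} where
  filterᵇ-all : (P : A → Bool) (xs : List A) → All (λ x → P x ≡ true) (filterᵇ P xs)
  filterᵇ-all P []       = []
  filterᵇ-all P (x ∷ xs) with P x in eq
  ... | true  = eq ∷ filterᵇ-all P xs
  ... | false = filterᵇ-all P xs

  filterᵇ-any : {Q : A → Set} (P : A → Bool) {xs : List A} → Any (λ x → Q x × P x ≡ true) xs → Any Q (filterᵇ P xs)
  filterᵇ-any P {x ∷ xs} (here (q , t)) rewrite t = here q
  filterᵇ-any P {x ∷ xs} (there i) with P x
  ... | true  = there (filterᵇ-any P i)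
  ... | false = filterᵇ-any P i

  filterᵇ-All : {Q : A → Set} (P : A → Bool) {xs : List A} → All Q xs → All Q (filterᵇ P xs)
  filterᵇ-All P [] = []
  filterᵇ-All P {x ∷ xs} (q ∷ qs) with P x
  ... | true  = q ∷ filterᵇ-All P qs
  ... | false = filterᵇ-All P qs

  filterᵇ-AllPairs : {R : A → A → Set} (P : A → Bool) {xs : List A} → AllPairs R xs → AllPairs R (filterᵇ P xs)
  filterᵇ-AllPairs P [] = []
  filterᵇ-AllPairs P {x ∷ xs} (q ∷ qs) with P x
  ... | true  = filterᵇ-All P q ∷ filterᵇ-AllPairs P qs
  ... | false = filterᵇ-AllPairs P qs

  filterᵇ-mono : (P Q : A → Bool) (xs : List A) → All (λ x → P x ≡ true → Q x ≡ true) xs →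
                 length (filterᵇ P xs) ≤ length (filterᵇ Q xs)
  filterᵇ-mono P Q [] [] = z≤n
  filterᵇ-mono P Q (x ∷ xs) (i ∷ is) with P x | Q x
  ... | true  | true  = s≤s (filterᵇ-mono P Q xs is)
  ... | true  | false with () ← i refl
  ... | false | true  = ℕP.m≤n⇒m≤1+n (filterᵇ-mono P Q xs is)
  ... | false | false = filterᵇ-mono P Q xs is

  filterᵇ-++ : (P : A → Bool) (xs ys : List A) → length (filterᵇ P (xs ++ ys)) ≡ length (filterᵇ P xs) ℕ.+ length (filterᵇ P ys)
  filterᵇ-++ P [] ys = refl
  filterᵇ-++ P (x ∷ xs) ys with P x
  ... | true  = cong suc (filterᵇ-++ P xs ys)
  ... | false = filterᵇ-++ P xs ys

  filterᵇ-map : {B : Set} (P : A → Bool) (f : B → A) (xs : List B) → length (filterᵇ P (map f xs)) ≡ length (filterᵇ (P ∘ f) xs)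
  filterᵇ-map P f [] = refl
  filterᵇ-map P f (x ∷ xs) with P (f x)
  ... | true  = cong suc (filterᵇ-map P f xs)
  ... | false = filterᵇ-map P f xs

  delete : {P : A → Set} (ys : List A) → Any P ys → List A
  delete (y ∷ ys) (here _)  = ys
  delete (y ∷ ys) (there i) = y ∷ delete ys i

  length-delete : {P : A → Set} {ys : List A} (i : Any P ys) → length ys ≡ suc (length (delete ys i))
  length-delete (here _)  = refl
  length-delete (there i) = cong suc (length-delete i)

  delete-other : {P Q : A → Set} {ys : List A} (i : Any P ys) → (∀ y → P y → ¬ Q y) → Any Q ys → Any Q (delete ys i)
  delete-other (here p)  n (here q)  = ⊥-elim (n _ p q)
  delete-other (here p)  n (there j) = j
  delete-other (there i) n (here q)  = here q
  delete-other (there i) n (there j) = there (delete-other i n j)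

-- Pigeonhole with a relation in place of a map: the partner of the head cannot be a partner of a
-- later entry, so it is deleted before the induction continues.
length-inject : {A B : Set} (R : A → B → Set) (xs : List A) (ys : List B) →
                All (λ x → Any (R x) ys) xs → AllPairs (λ x x′ → ∀ y → R x y → ¬ R x′ y) xs → length xs ≤ length ys
length-inject R [] ys _ _ = z≤n
length-inject R (x ∷ xs) ys (i ∷ is) (d ∷ ds) rewrite length-delete i =
  s≤s (length-inject R xs (delete ys i) (All.zipWith (λ { (n , j) → delete-other i n j }) (d , is)) ds)

module _ {A B : Set} (FA : Finite A) (FB : Finite B) where
  private
    module A = Finite FA
    module B = Finite FB

  list≤# : (xs : List A) (P : A → Set) (Q : B → Bool) (φ : A → B) → All P xs → AllPairs (λ x y → ¬ (A._≈_ x y)) xs →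
           B.Respects Q → (∀ x → P x → Q (φ x) ≡ true) →
           (∀ x y → P x → P y → B._≈_ (φ x) (φ y) → A._≈_ x y) → length xs ≤ B.# Q
  list≤# xs P Q φ all ap resp to inj =
    length-inject (λ x y → B._≈_ (φ x) y) xs _
      (All.map (λ {x} px → filterᵇ-any Q (Any.map (λ e → e , resp e (to x px)) (B.complete (φ x)))) all)
      (distinct all ap)
    where
    distinct : ∀ {xs} → All P xs → AllPairs (λ x y → ¬ (A._≈_ x y)) xs →
               AllPairs (λ x x′ → ∀ y → B._≈_ (φ x) y → ¬ B._≈_ (φ x′) y) xs
    distinct [] [] = []
    distinct (p ∷ ps) (d ∷ ds) =
      All.zipWith (λ { (p′ , n) y e e′ → n (inj _ _ p p′ (B.≈-trans e (B.≈-sym e′))) }) (ps , d) ∷ distinct ps ds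

  #-inject : (P : A → Bool) (Q : B → Bool) (φ : A → B) → B.Respects Q →
             (∀ x → P x ≡ true → Q (φ x) ≡ true) →
             (∀ x y → P x ≡ true → P y ≡ true → B._≈_ (φ x) (φ y) → A._≈_ x y) → A.# P ≤ B.# Q
  #-inject P Q φ = list≤# _ _ Q φ (filterᵇ-all P A.enum) (filterᵇ-AllPairs P A.unique)

module _ {A : Set} (FA : Finite A) where
  private module A = Finite FA

  #-mono : (P Q : A → Bool) → (∀ x → P x ≡ true → Q x ≡ true) → A.# P ≤ A.# Q
  #-mono P Q i = filterᵇ-mono P Q A.enum (All.universal i _)

  #≤size : (P : A → Bool) → A.# P ≤ A.size
  #≤size P = go A.enum
    where
    go : ∀ xs → length (filterᵇ P xs) ≤ length xs
    go [] = z≤n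
    go (x ∷ xs) with P x
    ... | true  = s≤s (go xs)
    ... | false = ℕP.m≤n⇒m≤1+n (go xs)

  #-true : (P : A → Bool) → (∀ x → P x ≡ true) → A.# P ≡ A.size
  #-true P t = go A.enum
    where
    go : ∀ xs → length (filterᵇ P xs) ≡ length xs
    go [] = refl
    go (x ∷ xs) rewrite t x = cong suc (go xs)

  #-∪ : (P Q R : A → Bool) → (∀ x → P x ≡ true → Q x ≡ true ⊎ R x ≡ true) → A.# P ≤ A.# Q ℕ.+ A.# R
  #-∪ P Q R f = go A.enum
    where
    go : ∀ xs → length (filterᵇ P xs) ≤ length (filterᵇ Q xs) ℕ.+ length (filterᵇ R xs)
    go [] = z≤n
    go (x ∷ xs) with P x | Q x | R x | f x
    ... | true  | true  | false | _ = s≤s (go xs)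
    ... | true  | true  | true  | _ = s≤s (ℕP.≤-trans (go xs) (ℕP.+-mono-≤ ℕP.≤-refl (ℕP.n≤1+n _)))
    ... | true  | false | true  | _ = ℕP.≤-trans (s≤s (go xs)) (ℕP.≤-reflexive (sym (ℕP.+-suc _ _)))
    ... | true  | false | false | g with g refl
    ...   | inj₁ ()
    ...   | inj₂ ()
    go (x ∷ xs) | false | true  | true  | _ = ℕP.m≤n⇒m≤1+n (ℕP.≤-trans (go xs) (ℕP.+-mono-≤ ℕP.≤-refl (ℕP.n≤1+n _)))
    go (x ∷ xs) | false | true  | false | _ = ℕP.m≤n⇒m≤1+n (go xs)
    go (x ∷ xs) | false | false | true  | _ = ℕP.≤-trans (go xs) (ℕP.+-mono-≤ ℕP.≤-refl (ℕP.n≤1+n _))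
    go (x ∷ xs) | false | false | false | _ = go xs

  search-list : (P : A → Bool) (xs : List A) → (Σ A λ x → P x ≡ true) ⊎ All (λ x → P x ≡ false) xs
  search-list P [] = inj₂ []
  search-list P (x ∷ xs) with P x in eq
  ... | true = inj₁ (x , eq)
  ... | false with search-list P xs
  ...   | inj₁ r = inj₁ r
  ...   | inj₂ a = inj₂ (eq ∷ a)

  search : (P : A → Bool) → A.Respects P → (Σ A λ x → P x ≡ true) ⊎ (∀ x → P x ≡ false)
  search P resp with search-list P A.enum
  ... | inj₁ r = inj₁ r
  ... | inj₂ a = inj₂ λ x → none x (All.lookupAny a (A.complete x))
    where
    none : ∀ x {y} → P y ≡ false × A._≈_ x y → P x ≡ false
    none x (f , e) with P x in eq
    ... | false = refl
    ... | true with () ← trans (sym (resp e eq)) f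

  #-escape : (P Q : A → Bool) → A.# P < A.# Q → Σ A λ x → Q x ≡ true × P x ≡ false
  #-escape P Q lt with search-list (λ x → Q x ∧ not (P x)) A.enum
  ... | inj₁ (x , e) = x , split (Q x) (P x) e
    where
    split : ∀ a b → a ∧ not b ≡ true → a ≡ true × b ≡ false
    split true false _ = refl , refl
  ... | inj₂ a = ⊥-elim (ℕP.<⇒≱ lt (filterᵇ-mono Q P A.enum (All.map (λ {x} → imp (Q x) (P x)) a)))
    where
    imp : ∀ a b → a ∧ not b ≡ false → a ≡ true → b ≡ true
    imp true true _ _ = refl

  #-complement : (P : A → Bool) → A.# P ℕ.+ A.# (not ∘ P) ≡ A.size
  #-complement P = go (A.enum)
    where
    go : ∀ xs → length (filterᵇ P xs) ℕ.+ length (filterᵇ (not ∘ P) xs) ≡ length xs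
    go [] = refl
    go (x ∷ xs) with P x
    ... | true  = cong suc (go xs)
    ... | false = trans (ℕP.+-suc _ _) (cong suc (go xs))

  #-positive : (P : A → Bool) → A.Respects P → ∀ x → P x ≡ true → 1 ≤ A.# P
  #-positive P resp x t = list≤# FA FA (x ∷ []) (λ y → P y ≡ true) P (λ y → y) (t ∷ []) ([] ∷ []) resp (λ _ r → r) (λ _ _ _ _ e → e)

module _ {A B : Set} (FA : Finite A) (FB : Finite B) where
  private
    module A = Finite FA
    module B = Finite FB

  pairs : List A → List B → List (A × B)
  pairs xs ys = concatMap (λ x → map (x ,_) ys) xs

  product : Finite (A × B)
  product = record
    { _≈_ = λ { (a , b) (a′ , b′) → a A.≈ a′ × b B.≈ b′ }
    ; ≈-equiv = record
        { refl = A.≈-refl , B.≈-refl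
        ; sym = λ { (e , f) → A.≈-sym e , B.≈-sym f }
        ; trans = λ { (e , f) (e′ , f′) → A.≈-trans e e′ , B.≈-trans f f′ } }
    ; _≈?_ = λ { (a , b) (a′ , b′) → (a A.≈? a′) ×-dec (b B.≈? b′) }
    ; enum = pairs A.enum B.enum
    ; complete = λ { (a , b) → AnyP.concat⁺ (AnyP.map⁺ (Any.map (λ e → AnyP.map⁺ (Any.map (e ,_) (B.complete b))) (A.complete a))) }
    ; unique = APP.concat⁺
        (AllP.map⁺ (All.universal (λ x → APP.map⁺ (AllPairs.map (λ n e → n (proj₂ e)) B.unique)) _))
        (APP.map⁺ (AllPairs.map (λ n → AllP.map⁺ (All.universal (λ _ → AllP.map⁺ (All.universal (λ _ e → n (proj₁ e)) _)) _)) A.unique))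
    }

  #-pairs-lower : (P : A → Bool) (r : A × B → Bool) (m : ℕ) → (∀ a → P a ≡ true → m ≤ B.# (λ b → r (a , b))) →
                  A.# P ℕ.* m ≤ Finite.# product r
  #-pairs-lower P r m h = go A.enum
    where
    go : ∀ xs → length (filterᵇ P xs) ℕ.* m ≤ length (filterᵇ r (pairs xs B.enum))
    go [] = z≤n
    go (x ∷ xs) rewrite filterᵇ-++ r (map (x ,_) B.enum) (pairs xs B.enum) | filterᵇ-map r (x ,_) B.enum with P x in eq
    ... | true  = ℕP.+-mono-≤ (h x eq) (go xs)
    ... | false = ℕP.≤-trans (go xs) (ℕP.m≤n+m _ _)

  #-pairs-upper : (P : A → Bool) (r : A × B → Bool) (m : ℕ) → (∀ a → P a ≡ true → B.# (λ b → r (a , b)) ≤ m) →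
                  (∀ a b → r (a , b) ≡ true → P a ≡ true) → Finite.# product r ≤ A.# P ℕ.* m
  #-pairs-upper P r m h s = go A.enum
    where
    empty : ∀ x → P x ≡ false → ∀ ys → length (filterᵇ (λ b → r (x , b)) ys) ≡ 0
    empty x f [] = refl
    empty x f (y ∷ ys) with r (x , y) in eq
    ... | false = empty x f ys
    ... | true with () ← trans (sym (s x y eq)) f
    go : ∀ xs → length (filterᵇ r (pairs xs B.enum)) ≤ length (filterᵇ P xs) ℕ.* m
    go [] = z≤n
    go (x ∷ xs) rewrite filterᵇ-++ r (map (x ,_) B.enum) (pairs xs B.enum) | filterᵇ-map r (x ,_) B.enum with P x in eq
    ... | true  = ℕP.+-mono-≤ (h x eq) (go xs)
    ... | false rewrite empty x eq B.enum = go xs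

module _ {A B : Set} (FA : Finite A) (FB : Finite B) where
  private
    module A = Finite FA
    module B = Finite FB

  #-pairs-swap : (r : A × B → Bool) → Finite.Respects (product FB FA) (λ z → r (swap z)) →
                 Finite.# (product FA FB) r ≤ Finite.# (product FB FA) (λ z → r (swap z))
  #-pairs-swap r resp = #-inject (product FA FB) (product FB FA) r _ swap resp (λ _ t → t) (λ { _ _ _ _ (e , f) → f , e })

  #-double : (P : A → Bool) (Q : B → Bool) (r : A × B → Bool) (m n : ℕ) → Finite.Respects (product FB FA) (λ z → r (swap z)) →
             (∀ a → P a ≡ true → m ≤ B.# (λ b → r (a , b))) →
             (∀ b → Q b ≡ true → A.# (λ a → r (a , b)) ≤ n) →
             (∀ a b → r (a , b) ≡ true → Q b ≡ true) → A.# P ℕ.* m ≤ B.# Q ℕ.* n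
  #-double P Q r m n resp lo up s =
    ℕP.≤-trans (#-pairs-lower FA FB P r m lo)
      (ℕP.≤-trans (#-pairs-swap r resp) (#-pairs-upper FB FA Q (λ z → r (swap z)) n up (λ b a → s a b)))

module _ {A : Set} (FA : Finite A) where
  private module A = Finite FA

  -- The enumeration is `allFuns`, which makes `count` definitionally the cardinality of a set of
  -- points.
  functions : ∀ n → Finite (Fin n → A)
  functions n = record
    { _≈_ = λ f g → ∀ i → f i A.≈ g i
    ; ≈-equiv = record { refl = λ _ → A.≈-refl ; sym = λ e i → A.≈-sym (e i) ; trans = λ e e′ i → A.≈-trans (e i) (e′ i) }
    ; _≈?_ = λ f g → all? (λ i → f i A.≈? g i)
    ; enum = allFuns A.enum n
    ; complete = comp n
    ; unique = uniq n
    }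
    where
    comp : ∀ n (f : Fin n → A) → Any (λ g → ∀ i → f i A.≈ g i) (allFuns A.enum n)
    comp zero f = here λ ()
    comp (suc n) f = AnyP.concat⁺ (AnyP.map⁺ (Any.map (λ {x} e → AnyP.map⁺ (Any.map (λ {g} e′ → λ { Fin.zero → e ; (Fin.suc i) → e′ i }) (comp n (f ∘ Fin.suc)))) (A.complete (f Fin.zero))))
    uniq : ∀ n → AllPairs (λ f g → ¬ (∀ i → f i A.≈ g i)) (allFuns A.enum n)
    uniq zero = [] ∷ []
    uniq (suc n) = APP.concat⁺
      (AllP.map⁺ (All.universal (λ x → APP.map⁺ (AllPairs.map (λ ne e → ne (λ i → e (Fin.suc i))) (uniq n))) _))
      (APP.map⁺ (AllPairs.map (λ ne → AllP.map⁺ (All.universal (λ _ → AllP.map⁺ (All.universal (λ _ e → ne (e Fin.zero)) _)) _)) A.unique))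

  size-functions : ∀ n → Finite.size (functions n) ≡ A.size ℕ.^ n
  size-functions zero = refl
  size-functions (suc n) = go _ A.enum
    where
    go : (φ : A → (Fin n → A) → Fin (suc n) → A) (xs : List A) →
         length (concatMap (λ x → map (φ x) (allFuns A.enum n)) xs) ≡ length xs ℕ.* A.size ℕ.^ n
    go φ [] = refl
    go φ (x ∷ xs) = trans (length-++ (map (φ x) (allFuns A.enum n)))
      (cong₂ ℕ._+_ (trans (length-map (φ x) (allFuns A.enum n)) (size-functions n)) (go φ xs))

finFinite : ∀ n → Finite (Fin n)
finFinite n = record
  { _≈_ = _≡_ ; ≈-equiv = ≡-isEquivalence ; _≈?_ = _≟Fin_ ; enum = allFin n
  ; complete = ∈-allFin ; unique = allFin⁺ n }

size-fin : ∀ n → Finite.size (finFinite n) ≡ n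
size-fin n = length-tabulate (λ i → i)

not-true : ∀ {b} → not b ≡ true → b ≡ false
not-true {false} _ = refl

contradictory : ∀ {b} → b ≡ true → b ≡ false → ⊥
contradictory {true} _ ()
contradictory {false} ()

∧-true : ∀ {a b} → a ∧ b ≡ true → a ≡ true × b ≡ true
∧-true {true} {true} _ = refl , refl

∧-intro : ∀ {a b} → a ≡ true → b ≡ true → a ∧ b ≡ true
∧-intro refl refl = refl

∨-true : ∀ {a b} → a ∨ b ≡ true → a ≡ true ⊎ b ≡ true
∨-true {true} _ = inj₁ refl
∨-true {false} e = inj₂ e

∨-introˡ : ∀ {a b} → a ≡ true → a ∨ b ≡ true
∨-introˡ refl = refl

∨-introʳ : ∀ {a b} → b ≡ true → a ∨ b ≡ true
∨-introʳ {true} refl = refl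
∨-introʳ {false} refl = refl

does-true : ∀ {P : Set} (d : Dec P) → P → does d ≡ true
does-true (yes _) _ = refl
does-true (no n) p = ⊥-elim (n p)

true-does : ∀ {P : Set} (d : Dec P) → does d ≡ true → P
true-does (yes p) _ = p

-- A ring solver with integer coefficients.

module IntegerSolver {A : Set} {_+_ _*_ : A → A → A} { -_ : A → A} {0# 1# : A}
  (isCR : IsCommutativeRing _≡_ _+_ _*_ -_ 0# 1#) where

  commutativeRing : CommutativeRing 0ℓ 0ℓ
  commutativeRing = record { isCommutativeRing = isCR }

  private
    module R = CommutativeRing commutativeRing
    -- The optimised multiples compute `1 ×ⁿ 1#` to `1#`, so `con (pos 1)` stands for `1#` itself in
    -- the identities below.
    open import Algebra.Properties.Semiring.Mult.TCOptimised R.semiring using (1+×; ×-homo-+; ×1-homo-*) renaming (_×_ to _×ⁿ_)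
    open import Algebra.Properties.Ring R.ring using (-0#≈0#; -‿+-comm; -‿distribˡ-*; -‿distribʳ-*; -‿involutive)

    ⟦_⟧ : ℤ → A
    ⟦ pos n ⟧      = n ×ⁿ 1#
    ⟦ -[1+ n ] ⟧ = - (suc n ×ⁿ 1#)

    neg-homo : ∀ i → ⟦ ℤ.- i ⟧ ≡ - ⟦ i ⟧
    neg-homo (pos zero)    = sym -0#≈0#
    neg-homo (pos (suc n)) = refl
    neg-homo -[1+ n ]    = sym (-‿involutive _)

    ⊖-homo : ∀ m n → ⟦ m ℤ.⊖ n ⟧ ≡ (m ×ⁿ 1#) + (- (n ×ⁿ 1#))
    ⊖-homo zero zero = sym (trans (cong (0# +_) -0#≈0#) (R.+-identityˡ _))
    ⊖-homo zero (suc n) = sym (R.+-identityˡ _)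
    ⊖-homo (suc m) zero = sym (trans (cong ((suc m ×ⁿ 1#) +_) -0#≈0#) (R.+-identityʳ _))
    ⊖-homo (suc m) (suc n) = begin
      ⟦ suc m ℤ.⊖ suc n ⟧ ≡⟨ cong ⟦_⟧ (ℤP.[1+m]⊖[1+n]≡m⊖n m n) ⟩
      ⟦ m ℤ.⊖ n ⟧ ≡⟨ ⊖-homo m n ⟩
      (m ×ⁿ 1#) + (- (n ×ⁿ 1#)) ≡⟨ cong (_+ (- (n ×ⁿ 1#))) (sym (trans (cong (_+ (m ×ⁿ 1#)) (R.-‿inverseʳ 1#)) (R.+-identityˡ _))) ⟩
      ((1# + (- 1#)) + (m ×ⁿ 1#)) + (- (n ×ⁿ 1#)) ≡⟨ cong (_+ (- (n ×ⁿ 1#))) (trans (R.+-assoc _ _ _) (trans (cong (1# +_) (R.+-comm _ _)) (sym (R.+-assoc _ _ _)))) ⟩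
      ((1# + (m ×ⁿ 1#)) + (- 1#)) + (- (n ×ⁿ 1#)) ≡⟨ R.+-assoc _ _ _ ⟩
      (1# + (m ×ⁿ 1#)) + ((- 1#) + (- (n ×ⁿ 1#))) ≡⟨ cong₂ _+_ (sym (1+× m 1#)) (trans (-‿+-comm _ _) (cong -_ (sym (1+× n 1#)))) ⟩
      (suc m ×ⁿ 1#) + (- (suc n ×ⁿ 1#)) ∎
      where open ≡-Reasoning

    +-homo : ∀ i j → ⟦ i ℤ.+ j ⟧ ≡ (⟦ i ⟧ + ⟦ j ⟧)
    +-homo (pos m) (pos n) = ×-homo-+ 1# m n
    +-homo (pos m) -[1+ n ] = ⊖-homo m (suc n)
    +-homo -[1+ m ] (pos n) = trans (⊖-homo n (suc m)) (R.+-comm _ _)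
    +-homo -[1+ m ] -[1+ n ] = trans (cong (λ k → - (k ×ⁿ 1#)) (sym (ℕP.+-suc (suc m) n)))
      (trans (cong -_ (×-homo-+ 1# (suc m) (suc n))) (sym (-‿+-comm _ _)))

    *-homo : ∀ i j → ⟦ i ℤ.* j ⟧ ≡ (⟦ i ⟧ * ⟦ j ⟧)
    *-homo (pos m) (pos n) = trans (cong ⟦_⟧ (sym (ℤP.pos-* m n))) (×1-homo-* m n)
    *-homo (pos m) -[1+ n ] = trans (cong ⟦_⟧ (sym (ℤP.neg-distribʳ-* (pos m) (pos (suc n)))))
      (trans (neg-homo ((pos m) ℤ.* (pos (suc n)))) (trans (cong -_ (*-homo (pos m) (pos (suc n)))) (-‿distribʳ-* _ _)))
    *-homo -[1+ m ] (pos n) = trans (cong ⟦_⟧ (sym (ℤP.neg-distribˡ-* (pos (suc m)) (pos n))))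
      (trans (neg-homo ((pos (suc m)) ℤ.* (pos n))) (trans (cong -_ (*-homo (pos (suc m)) (pos n))) (-‿distribˡ-* _ _)))
    *-homo -[1+ m ] -[1+ n ] = trans (*-homo (pos (suc m)) (pos (suc n)))
      (sym (trans (sym (-‿distribˡ-* _ _)) (trans (cong -_ (sym (-‿distribʳ-* _ _))) (-‿involutive _))))

    morphism : ℤ.+-*-rawRing ACR.-Raw-AlmostCommutative⟶ ACR.fromCommutativeRing commutativeRing
    morphism = record { ⟦_⟧ = ⟦_⟧ ; +-homo = +-homo ; *-homo = *-homo ; -‿homo = neg-homo ; 0-homo = refl ; 1-homo = refl }

    _coeff≟_ : ∀ i j → Maybe (⟦ i ⟧ ≡ ⟦ j ⟧)
    i coeff≟ j with i ℤP.≟ j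
    ... | yes refl = just refl
    ... | no _     = nothing

  open RingSolver ℤ.+-*-rawRing (ACR.fromCommutativeRing commutativeRing) morphism _coeff≟_
    public using (solve; _:=_; con; _:+_; _:*_; :-_; _:-_)

-- Finite fields of odd characteristic, sums and vectors.

record FiniteField : Set₁ where
  infixl 6 _+_ _-_
  infixl 7 _*_
  infix 8 -_
  infix 4 _≟_
  field
    F        : Set
    _+_ _*_  : F → F → F
    -_       : F → F
    0# 1#    : F
    isCommutativeRing : IsCommutativeRing _≡_ _+_ _*_ -_ 0# 1#
    inv      : F → F
    *-inv    : ∀ {x} → x ≢ 0# → x * inv x ≡ 1#
    0≢1      : 0# ≢ 1#
    2≢0      : 1# + 1# ≢ 0#
    _≟_      : Decidable {A = F} _≡_
    elements : List F
    complete : ∀ x → x ∈ elements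
    unique   : Unique elements

  finite : Finite F
  finite = record { _≈_ = _≡_ ; ≈-equiv = ≡-isEquivalence ; _≈?_ = _≟_ ; enum = elements ; complete = complete ; unique = unique }

  open IsCommutativeRing isCommutativeRing public
    using (+-assoc; +-comm; +-identityˡ; +-identityʳ; *-assoc; *-comm; *-identityˡ; *-identityʳ; zeroˡ; zeroʳ; distribˡ; distribʳ; -‿inverseʳ; -‿inverseˡ)
  module Solver = IntegerSolver isCommutativeRing

  _-_ : F → F → F
  x - y = x + (- y)

  2# ½ : F
  2# = 1# + 1#
  ½ = inv 2#

  q : ℕ
  q = length elements

module FieldLemmas (𝔽 : FiniteField) where
  open FiniteField 𝔽
  open ≡-Reasoning
  open Solver using (solve; _:=_; con; _:+_; _:*_; :-_; _:-_)

  +-congˡ : ∀ {x y z} → y ≡ z → x + y ≡ x + z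
  +-congˡ {x} = cong (x +_)

  +-congʳ : ∀ {x y z} → y ≡ z → y + x ≡ z + x
  +-congʳ {x} = cong (_+ x)

  *-congˡ : ∀ {x y z} → y ≡ z → x * y ≡ x * z
  *-congˡ {x} = cong (x *_)

  *-congʳ : ∀ {x y z} → y ≡ z → y * x ≡ z * x
  *-congʳ {x} = cong (_* x)

  *-cancelˡ : ∀ {c x y} → c ≢ 0# → c * x ≡ c * y → x ≡ y
  *-cancelˡ {c} {x} {y} c≢0 e = trans (sym (back x)) (trans (cong (inv c *_) e) (back y))
    where
    back : ∀ z → inv c * (c * z) ≡ z
    back z = trans (solve 3 (λ i c z → i :* (c :* z) := (c :* i) :* z) refl (inv c) c z) (trans (cong (_* z) (*-inv c≢0)) (*-identityˡ z))

  *-inv-cancel : ∀ {c} x → c ≢ 0# → c * (inv c * x) ≡ x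
  *-inv-cancel {c} x c≢0 = trans (sym (*-assoc c (inv c) x)) (trans (*-congʳ (*-inv c≢0)) (*-identityˡ x))

  no-zero-divisors : ∀ {x y} → x ≢ 0# → y ≢ 0# → x * y ≢ 0#
  no-zero-divisors {x} {y} x≢0 y≢0 e = y≢0 (*-cancelˡ x≢0 (trans e (sym (zeroʳ x))))

  *-≢0ˡ : ∀ {x y} → x * y ≢ 0# → x ≢ 0#
  *-≢0ˡ {y = y} n refl = n (zeroˡ y)

  *-≢0ʳ : ∀ {x y} → x * y ≢ 0# → y ≢ 0#
  *-≢0ʳ {x} n refl = n (zeroʳ x)

  inv-≢0 : ∀ {x} → x ≢ 0# → inv x ≢ 0#
  inv-≢0 {x} x≢0 e = 0≢1 (trans (sym (zeroʳ x)) (trans (cong (x *_) (sym e)) (*-inv x≢0)))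

  -≡0 : ∀ {x y} → x - y ≡ 0# → x ≡ y
  -≡0 {x} {y} e = trans (solve 2 (λ x y → x := (x :- y) :+ y) refl x y) (trans (cong (_+ y) e) (+-identityˡ y))

  neg-≢0 : ∀ {x} → x ≢ 0# → - x ≢ 0#
  neg-≢0 {x} n e = n (trans (solve 1 (λ x → x := :- (:- x)) refl x) (trans (cong -_ e) (solve 0 (:- con (pos 0) := con (pos 0)) refl)))

  half : ∀ x → ½ * x + ½ * x ≡ x
  half x = trans (solve 2 (λ h x → h :* x :+ h :* x := ((con (pos 1) :+ con (pos 1)) :* h) :* x) refl ½ x)
    (trans (*-congʳ (*-inv 2≢0)) (*-identityˡ x))

  sum : ∀ n → (Fin n → F) → F
  sum zero    f = 0#
  sum (suc n) f = f Fin.zero + sum n (f ∘ Fin.suc)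

  sum-cong : ∀ n {f g : Fin n → F} → (∀ i → f i ≡ g i) → sum n f ≡ sum n g
  sum-cong zero e = refl
  sum-cong (suc n) e = cong₂ _+_ (e Fin.zero) (sum-cong n (e ∘ Fin.suc))

  sum-0 : ∀ n {f : Fin n → F} → (∀ i → f i ≡ 0#) → sum n f ≡ 0#
  sum-0 zero e = refl
  sum-0 (suc n) e = trans (cong₂ _+_ (e Fin.zero) (sum-0 n (e ∘ Fin.suc))) (+-identityˡ 0#)

  sum-+ : ∀ n (f g : Fin n → F) → sum n (λ i → f i + g i) ≡ sum n f + sum n g
  sum-+ zero f g = sym (+-identityˡ 0#)
  sum-+ (suc n) f g = trans (cong (f Fin.zero + g Fin.zero +_) (sum-+ n _ _))
    (solve 4 (λ a b c d → a :+ b :+ (c :+ d) := (a :+ c) :+ (b :+ d)) refl _ _ _ _)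

  sum-* : ∀ n c (f : Fin n → F) → sum n (λ i → c * f i) ≡ c * sum n f
  sum-* zero c f = sym (zeroʳ c)
  sum-* (suc n) c f = trans (cong (c * f Fin.zero +_) (sum-* n c _)) (sym (distribˡ c _ _))

  sum-lin : ∀ n c (f g : Fin n → F) → sum n (λ i → f i + c * g i) ≡ sum n f + c * sum n g
  sum-lin n c f g = trans (sum-+ n f _) (cong (sum n f +_) (sum-* n c g))

  sum-swap : ∀ m n (f : Fin m → Fin n → F) → sum m (λ i → sum n (f i)) ≡ sum n (λ j → sum m (λ i → f i j))
  sum-swap zero n f = sym (sum-0 n λ _ → refl)
  sum-swap (suc m) n f = trans (cong (sum n (f Fin.zero) +_) (sum-swap m n (f ∘ Fin.suc))) (sym (sum-+ n _ _))

  sum-single : ∀ n (k : Fin n) {f : Fin n → F} → (∀ i → i ≢ k → f i ≡ 0#) → sum n f ≡ f k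
  sum-single (suc n) Fin.zero h = trans (+-congˡ (sum-0 n λ i → h (Fin.suc i) λ ())) (+-identityʳ _)
  sum-single (suc n) (Fin.suc k) h = trans (cong₂ _+_ (h Fin.zero λ ()) (sum-single n k λ i ne → h (Fin.suc i) (ne ∘ suc-injective))) (+-identityˡ _)

  δ : ∀ {n} → Fin n → Fin n → F
  δ i j with i ≟Fin j
  ... | yes _ = 1#
  ... | no _  = 0#

  δ-refl : ∀ {n} (i : Fin n) → δ i i ≡ 1#
  δ-refl i with i ≟Fin i
  ... | yes _ = refl
  ... | no n  = ⊥-elim (n refl)

  δ-off : ∀ {n} {i j : Fin n} → i ≢ j → δ i j ≡ 0#
  δ-off {i = i} {j} n with i ≟Fin j
  ... | yes e = ⊥-elim (n e)
  ... | no _  = refl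

  sum-δ : ∀ n (k : Fin n) (f : Fin n → F) → sum n (λ i → f i * δ i k) ≡ f k
  sum-δ n k f = trans (sum-single n k λ i ne → trans (cong (f i *_) (δ-off ne)) (zeroʳ (f i)))
    (trans (cong (f k *_) (δ-refl k)) (*-identityʳ (f k)))

  V : ℕ → Set
  V n = Fin n → F

  FV : ∀ n → Finite (V n)
  FV = functions finite

  infix 4 _≗V_
  _≗V_ : ∀ {n} → V n → V n → Set
  x ≗V y = ∀ i → x i ≡ y i

  infixl 6 _⊕_
  infixl 7 _·_
  _⊕_ : ∀ {n} → V n → V n → V n
  (x ⊕ y) i = x i + y i

  _·_ : ∀ {n} → F → V n → V n
  (c · x) i = c * x i

  0V : ∀ {n} → V n
  0V _ = 0#

  comb : ∀ {m n} → V m → (Fin m → V n) → V n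
  comb {m} c e i = sum m (λ l → c l * e l i)

module Units (𝔽 : FiniteField) where
  open FiniteField 𝔽

  nonzero : F → Bool
  nonzero t = not (does (t ≟ 0#))

  nonzero-true : ∀ {t} → nonzero t ≡ true → t ≢ 0#
  nonzero-true {t} e with t ≟ 0#
  ... | no n = n

  true-nonzero : ∀ {t} → t ≢ 0# → nonzero t ≡ true
  true-nonzero {t} n with t ≟ 0#
  ... | no _ = refl
  ... | yes e = ⊥-elim (n e)

  units : ℕ
  units = Finite.# finite nonzero

  q≤1+units : q ≤ suc units
  q≤1+units = ℕP.≤-trans (ℕP.≤-reflexive (sym (#-true finite (λ _ → true) λ _ → refl)))
    (ℕP.≤-trans (#-∪ finite (λ _ → true) (λ t → does (t ≟ 0#)) nonzero (λ x _ → cases x))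
      (ℕP.+-mono-≤ {y = 1} (length-inject (λ x y → x ≡ y) _ (0# ∷ []) (All.map (λ {x} e → here (true-does (x ≟ 0#) e)) zeros)
        (AllPairs.map (λ n y e e′ → n (trans e (sym e′))) (filterᵇ-AllPairs (λ t → does (t ≟ 0#)) unique))) ℕP.≤-refl))
    where
    zeros = filterᵇ-all (λ t → does (t ≟ 0#)) elements
    cases : ∀ x → does (x ≟ 0#) ≡ true ⊎ nonzero x ≡ true
    cases x with x ≟ 0#
    ... | yes _ = inj₁ refl
    ... | no _  = inj₂ refl

-- Elimination and dependence of rows.

cons : {A : Set} {n : ℕ} → A → (Fin n → A) → Fin (suc n) → A
cons a f Fin.zero    = a
cons a f (Fin.suc i) = f i

module Elimination (𝔽 : FiniteField) where
  open FiniteField 𝔽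
  open FieldLemmas 𝔽
  open ≡-Reasoning
  open Solver using (solve; _:=_; con; _:+_; _:*_; :-_; _:-_)

  -- Gaussian elimination without row exchanges and without divisions.
  schur : ∀ {K h} → (Fin (suc K) → Fin h → F) → Fin h → Fin K → Fin h → F
  schur b j i m = b Fin.zero j * b (Fin.suc i) m - b (Fin.suc i) j * b Fin.zero m

  Schur : ∀ {K} → (Fin (suc K) → Fin (suc K) → F) → Fin K → Fin K → F
  Schur b i m = schur b Fin.zero i (Fin.suc m)

  -- The product of the pivots. It is non-zero exactly when all leading principal minors are, which
  -- is stronger than non-singularity.
  Δ : ∀ K → (Fin K → Fin K → F) → F
  Δ zero    b = 1#
  Δ (suc K) b = b Fin.zero Fin.zero * Δ K (Schur b)

  reduceRHS : ∀ {K} → (Fin (suc K) → Fin (suc K) → F) → V (suc K) → V K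
  reduceRHS b m i = b Fin.zero Fin.zero * m (Fin.suc i) - b (Fin.suc i) Fin.zero * m Fin.zero

  -- `Δ K b` times the solution of b x = m. With the denominator cleared, the entries are
  -- polynomials in those of `b` and `m`, whose degree along a curve can be bounded.
  cramer : ∀ K → (Fin K → Fin K → F) → V K → V K
  cramer (suc K) b m Fin.zero    = Δ K (Schur b) * m Fin.zero - sum K (λ j → b Fin.zero (Fin.suc j) * cramer K (Schur b) (reduceRHS b m) j)
  cramer (suc K) b m (Fin.suc j) = b Fin.zero Fin.zero * cramer K (Schur b) (reduceRHS b m) j

  Δ-cong : ∀ K {b b′ : Fin K → Fin K → F} → (∀ i j → b i j ≡ b′ i j) → Δ K b ≡ Δ K b′
  Δ-cong zero e = refl
  Δ-cong (suc K) e = cong₂ _*_ (e _ _) (Δ-cong K λ i j → cong₂ _-_ (cong₂ _*_ (e _ _) (e _ _)) (cong₂ _*_ (e _ _) (e _ _)))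

  cramer-cong : ∀ K {b b′ : Fin K → Fin K → F} {m m′ : V K} → (∀ i j → b i j ≡ b′ i j) → m ≗V m′ → cramer K b m ≗V cramer K b′ m′
  cramer-cong (suc K) {b} {b′} e f = go
    where
    S : ∀ i j → Schur b i j ≡ Schur b′ i j
    S i j = cong₂ _-_ (cong₂ _*_ (e _ _) (e _ _)) (cong₂ _*_ (e _ _) (e _ _))
    w = cramer-cong K S (λ i → cong₂ _-_ (cong₂ _*_ (e _ _) (f (Fin.suc i))) (cong₂ _*_ (e _ _) (f Fin.zero)))
    go : _ ≗V _
    go Fin.zero    = cong₂ _-_ (cong₂ _*_ (Δ-cong K S) (f _)) (sum-cong K λ j → cong₂ _*_ (e _ _) (w j))
    go (Fin.suc j) = cong₂ _*_ (e _ _) (w j)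

  cramer-solves : ∀ K b m i → sum K (λ l → b i l * cramer K b m l) ≡ Δ K b * m i
  cramer-solves (suc K) b m = go
    where
    x = b Fin.zero Fin.zero
    w = cramer K (Schur b) (reduceRHS b m)
    D = Δ K (Schur b)
    tail : ∀ i → sum K (λ l → b i (Fin.suc l) * (x * w l)) ≡ x * sum K (λ l → b i (Fin.suc l) * w l)
    tail i = trans (sum-cong K λ l → solve 3 (λ p x y → p :* (x :* y) := x :* (p :* y)) refl _ x _) (sum-* K x _)
    schur-sum : ∀ i → sum K (λ l → Schur b i l * w l) ≡
                x * sum K (λ l → b (Fin.suc i) (Fin.suc l) * w l) - b (Fin.suc i) Fin.zero * sum K (λ l → b Fin.zero (Fin.suc l) * w l)
    schur-sum i = begin
      sum K (λ l → Schur b i l * w l)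
        ≡⟨ sum-cong K (λ l → solve 5 (λ x p c r w → (x :* p :- c :* r) :* w := x :* (p :* w) :+ (:- c) :* (r :* w)) refl x _ (b (Fin.suc i) Fin.zero) _ _) ⟩
      sum K (λ l → x * (b (Fin.suc i) (Fin.suc l) * w l) + (- b (Fin.suc i) Fin.zero) * (b Fin.zero (Fin.suc l) * w l))
        ≡⟨ sum-lin K _ _ _ ⟩
      sum K (λ l → x * (b (Fin.suc i) (Fin.suc l) * w l)) + (- b (Fin.suc i) Fin.zero) * sum K (λ l → b Fin.zero (Fin.suc l) * w l)
        ≡⟨ cong₂ _+_ (sum-* K x _) (solve 2 (λ c s → (:- c) :* s := :- (c :* s)) refl _ _) ⟩
      _ ∎
    go : ∀ i → sum (suc K) (λ l → b i l * cramer (suc K) b m l) ≡ (x * D) * m i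
    go Fin.zero = trans (+-congˡ (tail Fin.zero))
      (solve 4 (λ x D m r → x :* (D :* m :- r) :+ x :* r := (x :* D) :* m) refl x D (m Fin.zero) _)
    go (Fin.suc i) = begin
      c * (D * m Fin.zero - r) + sum K (λ l → b (Fin.suc i) (Fin.suc l) * (x * w l)) ≡⟨ +-congˡ (tail (Fin.suc i)) ⟩
      c * (D * m Fin.zero - r) + x * p ≡⟨ solve 6 (λ c D m r x p → c :* (D :* m :- r) :+ x :* p := c :* (D :* m) :+ (x :* p :- c :* r)) refl c D (m Fin.zero) r x p ⟩
      c * (D * m Fin.zero) + (x * p - c * r) ≡⟨ +-congˡ (trans (sym (schur-sum i)) (cramer-solves K (Schur b) (reduceRHS b m) i)) ⟩
      c * (D * m Fin.zero) + D * (x * m (Fin.suc i) - c * m Fin.zero) ≡⟨ solve 5 (λ c D m x n → c :* (D :* m) :+ D :* (x :* n :- c :* m) := (x :* D) :* n) refl c D (m Fin.zero) x (m (Fin.suc i)) ⟩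
      (x * D) * m (Fin.suc i) ∎
      where
      c = b (Fin.suc i) Fin.zero
      r = sum K (λ j → b Fin.zero (Fin.suc j) * w j)
      p = sum K (λ l → b (Fin.suc i) (Fin.suc l) * w l)

  Δ-nonsingular : ∀ K b (y : V K) → Δ K b ≢ 0# → (∀ i → sum K (λ l → b i l * y l) ≡ 0#) → ∀ l → y l ≡ 0#
  Δ-nonsingular (suc K) b y nz h = go
    where
    x = b Fin.zero Fin.zero
    x≢0 = *-≢0ˡ nz
    y′ = y ∘ Fin.suc
    rest : ∀ l → y′ l ≡ 0#
    rest = Δ-nonsingular K (Schur b) y′ (*-≢0ʳ nz) λ i → begin
      sum K (λ l → Schur b i l * y′ l)
        ≡⟨ sum-cong K (λ l → solve 5 (λ x p c r w → (x :* p :- c :* r) :* w := x :* (p :* w) :+ (:- c) :* (r :* w)) refl x _ (b (Fin.suc i) Fin.zero) _ _) ⟩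
      sum K (λ l → x * (b (Fin.suc i) (Fin.suc l) * y′ l) + (- b (Fin.suc i) Fin.zero) * (b Fin.zero (Fin.suc l) * y′ l))
        ≡⟨ sum-lin K _ _ _ ⟩
      sum K (λ l → x * (b (Fin.suc i) (Fin.suc l) * y′ l)) + (- b (Fin.suc i) Fin.zero) * sum K (λ l → b Fin.zero (Fin.suc l) * y′ l)
        ≡⟨ +-congʳ (sum-* K x _) ⟩
      x * sum K (λ l → b (Fin.suc i) (Fin.suc l) * y′ l) + (- b (Fin.suc i) Fin.zero) * sum K (λ l → b Fin.zero (Fin.suc l) * y′ l)
        ≡⟨ solve 5 (λ x p c r z → x :* p :+ (:- c) :* r := x :* (c :* z :+ p) :- c :* (x :* z :+ r)) refl x _ (b (Fin.suc i) Fin.zero) _ (y Fin.zero) ⟩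
      x * (b (Fin.suc i) Fin.zero * y Fin.zero + sum K (λ l → b (Fin.suc i) (Fin.suc l) * y′ l)) - b (Fin.suc i) Fin.zero * (x * y Fin.zero + sum K (λ l → b Fin.zero (Fin.suc l) * y′ l))
        ≡⟨ cong₂ (λ u v → x * u - b (Fin.suc i) Fin.zero * v) (h (Fin.suc i)) (h Fin.zero) ⟩
      x * 0# - b (Fin.suc i) Fin.zero * 0# ≡⟨ solve 2 (λ x c → x :* con (pos 0) :- c :* con (pos 0) := con (pos 0)) refl x _ ⟩
      0# ∎
    go : ∀ l → y l ≡ 0#
    go (Fin.suc l) = rest l
    go Fin.zero = *-cancelˡ x≢0 (trans (sym (+-identityʳ _)) (trans (cong (x * y Fin.zero +_)
      (sym (sum-0 K λ l → trans (cong (b Fin.zero (Fin.suc l) *_) (rest l)) (zeroʳ _)))) (trans (h Fin.zero) (sym (zeroʳ x)))))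

  -- This is `c` to the power 2^K - 1, because every elimination step doubles the degree in the
  -- entries.
  scale : ℕ → F → F
  scale zero    c = 1#
  scale (suc K) c = c * scale K (c * c)

  scale-≢0 : ∀ K {c} → c ≢ 0# → scale K c ≢ 0#
  scale-≢0 zero    n = 0≢1 ∘ sym
  scale-≢0 (suc K) n = no-zero-divisors n (scale-≢0 K (no-zero-divisors n n))

  Δ-scale : ∀ K c b → Δ K (λ i j → c * b i j) ≡ scale K c * Δ K b
  Δ-scale zero c b = sym (*-identityˡ 1#)
  Δ-scale (suc K) c b = trans (cong (c * b Fin.zero Fin.zero *_)
    (trans (Δ-cong K λ i j → solve 5 (λ c x p q r → (c :* x) :* (c :* p) :- (c :* q) :* (c :* r) := (c :* c) :* (x :* p :- q :* r)) refl c _ _ _ _)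
      (Δ-scale K (c * c) (Schur b))))
    (solve 4 (λ c x s d → c :* x :* (s :* d) := c :* s :* (x :* d)) refl c _ _ _)

  Dependent : ∀ {K h} → (Fin K → Fin h → F) → Set
  Dependent {K} {h} b = Σ (V K) λ c → Σ (Fin K) λ k → c k ≡ 1# × (∀ m → sum K (λ i → c i * b i m) ≡ 0#)

  Independent : ∀ {K h} → (Fin K → Fin h → F) → Set
  Independent {K} {h} b = Σ (Fin K → Fin h) λ J → Δ K (λ i l → b i (J l)) ≢ 0#

  -- Elimination with a pivot column chosen in each row. Either a pivot is always found, and `J`
  -- lists the columns, or some row has become zero, and this is traced back to a relation between
  -- the original rows.
  independent-or-dependent : ∀ {K h} (b : Fin K → Fin h → F) → Independent b ⊎ Dependent b
  independent-or-dependent {zero} b = inj₁ ((λ ()) , 0≢1 ∘ sym)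
  independent-or-dependent {suc K} {h} b with any? (λ j → ¬? (b Fin.zero j ≟ 0#))
  ... | no none = inj₂ (cons 1# (λ _ → 0#) , Fin.zero , refl , λ m →
          trans (cong₂ _+_ (trans (*-identityˡ _) (decidable-stable (_ ≟ _) λ n → none (m , n))) (sum-0 K λ i → zeroˡ _)) (+-identityˡ 0#))
  ... | yes (j , x≢0) with independent-or-dependent (schur b j)
  ...   | inj₁ (J , nz) = inj₁ (cons j J , no-zero-divisors x≢0 nz)
  -- The coefficient of the first row is the one that clears column `j`; the relation between the
  -- rows of the Schur complement then clears all other columns.
  ...   | inj₂ (c , k , ck , dep) = inj₂ (cons (- (inv x * s)) c , Fin.suc k , ck , λ m → *-cancelˡ x≢0 (begin
          x * (- (inv x * s) * b Fin.zero m + sum K (λ i → c i * b (Fin.suc i) m))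
            ≡⟨ solve 5 (λ x i s z t → x :* (:- (i :* s) :* z :+ t) := (x :* t :+ (:- z) :* s) :+ (s :* z :- (x :* i) :* (s :* z))) refl x (inv x) s _ _ ⟩
          (x * sum K (λ i → c i * b (Fin.suc i) m) + (- b Fin.zero m) * s) + (s * b Fin.zero m - x * inv x * (s * b Fin.zero m))
            ≡⟨ cong₂ _+_ (rows m) (trans (cong (λ u → s * b Fin.zero m - u * (s * b Fin.zero m)) (*-inv x≢0)) (solve 1 (λ z → z :- con (pos 1) :* z := con (pos 0)) refl _)) ⟩
          0# + 0# ≡⟨ trans (+-identityˡ 0#) (sym (zeroʳ x)) ⟩
          x * 0# ∎))
    where
    x = b Fin.zero j
    s = sum K (λ i → c i * b (Fin.suc i) j)
    rows : ∀ m → x * sum K (λ i → c i * b (Fin.suc i) m) + (- b Fin.zero m) * s ≡ 0#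
    rows m = trans (trans (+-congʳ (sym (sum-* K x _))) (sym (sum-lin K _ _ _)))
      (trans (sum-cong K λ i → solve 5 (λ x c p z q → x :* (c :* p) :+ (:- z) :* (c :* q) := c :* (x :* p :- q :* z)) refl x (c i) _ _ _) (dep m))

-- Polynomial curves over a finite field.

module _ (𝔽 : FiniteField) where
  open FiniteField 𝔽
  open FieldLemmas 𝔽

  -- `Q` is a mere predicate, without a Boolean test; its size is therefore bounded through lists of
  -- distinct elements.
  Few : ℕ → (F → Set) → Set
  Few D Q = ∀ ts → Unique ts → All Q ts → length ts ≤ D

  -- Curve D g is meant as: g is a polynomial function of degree at most D.
  record CurveTheory : Set₁ where
    field
      Curve : ℕ → (F → F) → Set
      curve-cong  : ∀ {D g h} → (∀ t → g t ≡ h t) → Curve D g → Curve D h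
      curve-const : ∀ c → Curve 0 (λ _ → c)
      curve-id    : Curve 1 (λ t → t)
      curve-+     : ∀ {D g h} → Curve D g → Curve D h → Curve D (λ t → g t + h t)
      curve-*     : ∀ {D E g h} → Curve D g → Curve E h → Curve (D ℕ.+ E) (λ t → g t * h t)
      curve-≤     : ∀ {D E g} → D ≤ E → Curve D g → Curve E g
      curve-few   : ∀ {D g} → Curve D g → ∀ t₀ → g t₀ ≢ 0# → Few D (λ t → g t ≡ 0#)

-- Equal to (2^K - 1) r, by the same doubling as in `scale`.
degΔ : ℕ → ℕ → ℕ
degΔ zero    r = 0
degΔ (suc K) r = r ℕ.+ degΔ K (r ℕ.+ r)

degCramer : ℕ → ℕ → ℕ → ℕ
degCramer zero    r s = 0
degCramer (suc K) r s = (degΔ K (r ℕ.+ r) ℕ.+ s) ℕ.+ (r ℕ.+ degCramer K (r ℕ.+ r) (r ℕ.+ s))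

module CurveLemmas (𝔽 : FiniteField) (𝒞 : CurveTheory 𝔽) where
  open FiniteField 𝔽
  open FieldLemmas 𝔽
  open Elimination 𝔽
  open CurveTheory 𝒞
  open Solver using (solve; _:=_; con; _:+_; _:*_; :-_; _:-_)

  few-∪ : ∀ {D E} {Q R : F → Set} → Few 𝔽 D Q → Few 𝔽 E R → Few 𝔽 (D ℕ.+ E) (λ t → Q t ⊎ R t)
  few-∪ {D} {E} {Q} {R} fq fr ts u qs with split ts u qs
    where
    split : ∀ ts → Unique ts → All (λ t → Q t ⊎ R t) ts →
            Σ (List F) λ xs → Σ (List F) λ ys → Unique xs × All Q xs × Unique ys × All R ys × length ts ≡ length xs ℕ.+ length ys
              × (∀ (P : F → Set) → All P ts → All P xs × All P ys)
    split [] [] [] = [] , [] , [] , [] , [] , [] , refl , λ P a → a , a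
    split (t ∷ ts) (d ∷ u) (s ∷ ss) with split ts u ss
    ... | xs , ys , ux , qx , uy , ry , e , sub with s
    ...   | inj₁ q = t ∷ xs , ys , proj₁ (sub _ d) ∷ ux , q ∷ qx , uy , ry , cong suc e , λ { P (p ∷ ps) → p ∷ proj₁ (sub P ps) , proj₂ (sub P ps) }
    ...   | inj₂ r = xs , t ∷ ys , ux , qx , proj₂ (sub _ d) ∷ uy , r ∷ ry , trans (cong suc e) (sym (ℕP.+-suc _ _)) , λ { P (p ∷ ps) → proj₁ (sub P ps) , p ∷ proj₂ (sub P ps) }
  ... | xs , ys , ux , qx , uy , ry , e , _ = subst (_≤ D ℕ.+ E) (sym e) (ℕP.+-mono-≤ (fq xs ux qx) (fr ys uy ry))

  few-pick : ∀ {D} {Q : F → Set} → Few 𝔽 D Q → (∀ t → Dec (Q t)) → D < q → Σ F λ t → ¬ Q t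
  few-pick {D} {Q} few dec D<q with find elements
    where
    find : ∀ ts → (Σ F λ t → ¬ Q t) ⊎ All Q ts
    find [] = inj₂ []
    find (t ∷ ts) with dec t | find ts
    ... | no n  | _ = inj₁ (t , n)
    ... | yes y | inj₁ r = inj₁ r
    ... | yes y | inj₂ a = inj₂ (y ∷ a)
  ... | inj₁ r = r
  ... | inj₂ a = ⊥-elim (ℕP.<⇒≱ D<q (few elements unique a))

  curve-scale : ∀ {D g} c → Curve D g → Curve D (λ t → c * g t)
  curve-scale c = curve-* (curve-const c)

  curve-neg : ∀ {D g} → Curve D g → Curve D (λ t → - g t)
  curve-neg c = curve-cong (λ t → solve 1 (λ x → (:- con (pos 1)) :* x := :- x) refl _) (curve-scale (- 1#) c)

  curve-- : ∀ {D g h} → Curve D g → Curve D h → Curve D (λ t → g t - h t)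
  curve-- c d = curve-+ c (curve-neg d)

  curve-sum : ∀ {D} n {g : Fin n → F → F} → (∀ i → Curve D (g i)) → Curve D (λ t → sum n (λ i → g i t))
  curve-sum zero c = curve-≤ z≤n (curve-const 0#)
  curve-sum (suc n) c = curve-+ (c Fin.zero) (curve-sum n (c ∘ Fin.suc))

  curve-line : ∀ a b → Curve 1 (λ t → a + t * b)
  curve-line a b = curve-+ (curve-≤ z≤n (curve-const a)) (curve-* curve-id (curve-const b))

  Δ-curve : ∀ K {r} {b : Fin K → Fin K → F → F} → (∀ i j → Curve r (b i j)) → Curve (degΔ K r) (λ t → Δ K (λ i j → b i j t))
  Δ-curve zero c = curve-const 1#
  Δ-curve (suc K) c = curve-* (c _ _) (Δ-curve K λ i j → curve-- (curve-* (c _ _) (c _ _)) (curve-* (c _ _) (c _ _)))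

  cramer-curve : ∀ K {r s} {b : Fin K → Fin K → F → F} {m : Fin K → F → F} → (∀ i j → Curve r (b i j)) → (∀ i → Curve s (m i)) →
                 ∀ l → Curve (degCramer K r s) (λ t → cramer K (λ i j → b i j t) (λ i → m i t) l)
  cramer-curve (suc K) {r} {s} {b} {m} cb cm = go
    where
    S : ∀ i j → Curve (r ℕ.+ r) (λ t → Schur (λ i j → b i j t) i j)
    S i j = curve-- (curve-* (cb _ _) (cb _ _)) (curve-* (cb _ _) (cb _ _))
    w : ∀ l → Curve (degCramer K (r ℕ.+ r) (r ℕ.+ s)) (λ t → cramer K (Schur (λ i j → b i j t)) (reduceRHS (λ i j → b i j t) (λ i → m i t)) l)
    w = cramer-curve K S (λ i → curve-- (curve-* (cb _ _) (cm _)) (curve-* (cb _ _) (cm _)))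
    go : ∀ l → Curve (degCramer (suc K) r s) (λ t → cramer (suc K) (λ i j → b i j t) (λ i → m i t) l)
    go Fin.zero = curve-- (curve-≤ (ℕP.m≤m+n _ _) (curve-* (Δ-curve K S) (cm _)))
      (curve-≤ (ℕP.m≤n+m _ (degΔ K (r ℕ.+ r) ℕ.+ s)) (curve-sum K λ j → curve-* (cb _ _) (w j)))
    go (Fin.suc l) = curve-≤ (ℕP.m≤n+m _ (degΔ K (r ℕ.+ r) ℕ.+ s)) (curve-* (cb _ _) (w l))

-- Symmetric bilinear forms and Gram matrices.

record Form (𝔽 : FiniteField) (d : ℕ) : Set where
  open FiniteField 𝔽
  open FieldLemmas 𝔽
  field
    ⟨_,_⟩     : V d → V d → F
    form-cong : ∀ {x x′ y y′} → x ≗V x′ → y ≗V y′ → ⟨ x , y ⟩ ≡ ⟨ x′ , y′ ⟩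
    form-sym  : ∀ x y → ⟨ x , y ⟩ ≡ ⟨ y , x ⟩
    form-⊕ˡ   : ∀ x y z → ⟨ x ⊕ y , z ⟩ ≡ ⟨ x , z ⟩ + ⟨ y , z ⟩
    form-·ˡ   : ∀ c x z → ⟨ c · x , z ⟩ ≡ c * ⟨ x , z ⟩

  form-⊕ʳ : ∀ z x y → ⟨ z , x ⊕ y ⟩ ≡ ⟨ z , x ⟩ + ⟨ z , y ⟩
  form-⊕ʳ z x y = trans (form-sym z _) (trans (form-⊕ˡ x y z) (cong₂ _+_ (form-sym x z) (form-sym y z)))

  form-·ʳ : ∀ c z x → ⟨ z , c · x ⟩ ≡ c * ⟨ z , x ⟩
  form-·ʳ c z x = trans (form-sym z _) (trans (form-·ˡ c x z) (*-congˡ (form-sym x z)))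

  form-0ˡ : ∀ z → ⟨ 0V , z ⟩ ≡ 0#
  form-0ˡ z = trans (form-cong {x′ = 0# · 0V} (λ i → sym (zeroˡ 0#)) (λ _ → refl)) (trans (form-·ˡ 0# 0V z) (zeroˡ _))

  form-combˡ : ∀ {m} (c : V m) (e : Fin m → V d) z → ⟨ comb c e , z ⟩ ≡ sum m (λ l → c l * ⟨ e l , z ⟩)
  form-combˡ {zero} c e z = form-0ˡ z
  form-combˡ {suc m} c e z = trans (form-⊕ˡ (c Fin.zero · e Fin.zero) (comb (c ∘ Fin.suc) (e ∘ Fin.suc)) z)
    (cong₂ _+_ (form-·ˡ _ _ z) (form-combˡ (c ∘ Fin.suc) (e ∘ Fin.suc) z))

  form-combʳ : ∀ {m} (c : V m) (e : Fin m → V d) z → ⟨ z , comb c e ⟩ ≡ sum m (λ l → c l * ⟨ z , e l ⟩)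
  form-combʳ {m} c e z = trans (form-sym z _) (trans (form-combˡ c e z) (sum-cong m λ l → *-congˡ (form-sym _ z)))

  gram : ∀ {K} → (Fin K → V d) → Fin K → Fin K → F
  gram n i j = ⟨ n i , n j ⟩

  gram-cong : ∀ {K} {n n′ : Fin K → V d} → (∀ i a → n i a ≡ n′ i a) → ∀ i j → gram n i j ≡ gram n′ i j
  gram-cong e i j = form-cong (e i) (e j)

  gram-sym : ∀ {K} (n : Fin K → V d) i j → gram n i j ≡ gram n j i
  gram-sym n i j = form-sym _ _

-- Charts and the flow inside a chart.

numeratorDegree : ℕ → ℕ
numeratorDegree K = (degΔ K 1 ℕ.+ 1) ℕ.+ degCramer K 1 2

module Ambient (𝔽 : FiniteField) (𝒞 : CurveTheory 𝔽) (d K : ℕ) (form : Form 𝔽 d) where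
  open FiniteField 𝔽
  open FieldLemmas 𝔽
  open Elimination 𝔽
  open CurveTheory 𝒞
  open CurveLemmas 𝔽 𝒞
  open Form form
  open Units 𝔽 public
  open ≡-Reasoning
  open Solver using (solve; _:=_; con; _:+_; _:*_; :-_; _:-_)

  Mat : Set
  Mat = Fin K → Fin K → F

  Pt : Set
  Pt = Fin K → V d

  FMat : Finite Mat
  FMat = functions (FV K) K

  FPt : Finite Pt
  FPt = functions (FV d) K

  infix 4 _≋_
  _≋_ : Pt → Pt → Set
  n ≋ m = ∀ i a → n i a ≡ m i a

  -- Along the flow the coordinates have degree 1 and the matrix `M` degree 2, whence the arguments
  -- of `degCramer`. A sum stands in for the maximum of the degrees of the two terms of `num`.
  degNum : ℕ
  degNum = numeratorDegree K

  det-degree : degΔ K 1 ≤ degNum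
  det-degree = ℕP.≤-trans (ℕP.m≤m+n _ 1) (ℕP.m≤m+n _ _)

  -- Ω consists of the points whose Gram matrix lies in an affine set W of matrices;
  -- Bad n is to be thought of as "the polynomial does not vanish at n".
  record Problem (s : ℕ) : Set₁ where
    field
      W        : Mat → Bool
      W-affine : ∀ {g g′ g″ : Mat} t → (∀ i j → g″ i j ≡ g i j + t * (g′ i j - g i j)) → W g ≡ true → W g′ ≡ true → W g″ ≡ true
      Bad      : Pt → Set
      -- N / Dn is a rational curve through the bad point `n₀`, and `Q` collects the exceptional
      -- parameters. Points are attached to parameters by equations without inverses, so that
      -- polynomial curves suffice.
      bad-curve : ∀ {D} (N : Fin K → Fin d → F → F) (Dn : F → F) → (∀ i a → Curve D (N i a)) → Curve D Dn →
        ∀ t₀ n₀ → Dn t₀ ≢ 0# → (∀ i a → Dn t₀ * n₀ i a ≡ N i a t₀) → Bad n₀ →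
        Σ (F → Set) λ Q → (∀ t → Dec (Q t)) × Few 𝔽 (s ℕ.* D) Q ×
          (∀ t n → Dn t ≢ 0# → (∀ i a → Dn t * n i a ≡ N i a t) → ¬ Q t → Bad n)
      G        : Pt → Bool
      G-resp   : ∀ {n m} → n ≋ m → G n ≡ true → G m ≡ true
      G-good   : ∀ n → G n ≡ true → ¬ Bad n

    W-resp : ∀ {g g′ : Mat} → (∀ i j → g i j ≡ g′ i j) → W g ≡ true → W g′ ≡ true
    -- Any matrix pointwise equal to `g` is the affine combination of `g` with itself at parameter
    -- 0.
    W-resp e w = W-affine 0# (λ i j → trans (sym (e i j)) (solve 1 (λ x → x := x :+ con (pos 0) :* (x :- x)) refl _)) w w

    Ω : Pt → Bool
    Ω n = W (gram n)

    Ω-resp : ∀ {n m} → n ≋ m → Ω n ≡ true → Ω m ≡ true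
    Ω-resp e = W-resp (gram-cong e)

    field
      G⊆Ω : ∀ n → G n ≡ true → Ω n ≡ true

  -- Given K mutually orthogonal isotropic vectors E_l, the points n with Δ(⟨n_k , E_l⟩) ≠ 0 are
  -- parametrised by pairs (z, M) with Gram(z) + M + Mᵀ ∈ W, through n = z + M (⟨z_k , E_l⟩)⁻ᵀ E.
  module Chart (E : Fin K → V d) (EE : ∀ i j → ⟨ E i , E j ⟩ ≡ 0#) where

    coords : Pt → Mat
    coords z k l = ⟨ z k , E l ⟩

    det : Pt → F
    det z = Δ K (coords z)

    coords-cong : ∀ {z z′} → z ≋ z′ → ∀ k l → coords z k l ≡ coords z′ k l
    coords-cong e k l = form-cong (e k) (λ _ → refl)

    det-cong : ∀ {z z′} → z ≋ z′ → det z ≡ det z′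
    det-cong e = Δ-cong K (coords-cong e)

    shift : Pt → Mat → Fin K → V K
    shift z M i l = inv (det z) * cramer K (coords z) (M i) l

    pt : Pt → Mat → Pt
    pt z M i = z i ⊕ comb (shift z M i) E

    shift-cong : ∀ {z z′ M M′} → (∀ k l → coords z k l ≡ coords z′ k l) → (∀ i j → M i j ≡ M′ i j) → ∀ i l → shift z M i l ≡ shift z′ M′ i l
    shift-cong e f i l = cong₂ _*_ (cong inv (Δ-cong K e)) (cramer-cong K e (f i) l)

    pt-cong : ∀ {z z′ M M′} → z ≋ z′ → (∀ i j → M i j ≡ M′ i j) → pt z M ≋ pt z′ M′
    pt-cong e f i a = cong₂ _+_ (e i a) (sum-cong K λ l → *-congʳ (shift-cong (coords-cong e) f i l))

    num : Pt → Mat → Pt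
    num z M i = (det z · z i) ⊕ comb (cramer K (coords z) (M i)) E

    pt-num : ∀ z M → det z ≢ 0# → ∀ i a → det z * pt z M i a ≡ num z M i a
    pt-num z M nz i a = trans (distribˡ _ _ _) (+-congˡ (trans (sym (sum-* K _ _))
      (sum-cong K λ l → trans (solve 4 (λ D i c e → D :* (i :* c :* e) := (D :* (i :* c)) :* e) refl _ _ _ _) (*-congʳ (*-inv-cancel _ nz)))))

    comb-E : ∀ (c : V K) l → ⟨ comb c E , E l ⟩ ≡ 0#
    comb-E c l = trans (form-combˡ c E (E l)) (sum-0 K λ k → trans (*-congˡ (EE k l)) (zeroʳ _))

    -- The span of the E_l is totally isotropic, so shifting along it is invisible to the
    -- coordinates. The shift, the chart determinant and the chart domain can thus be computed at
    -- either end.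
    coords-shift : ∀ (z : Pt) (c : Fin K → V K) k l → ⟨ z k ⊕ comb (c k) E , E l ⟩ ≡ coords z k l
    coords-shift z c k l = trans (form-⊕ˡ _ _ _) (trans (+-congˡ (comb-E (c k) l)) (+-identityʳ _))

    coords-pt : ∀ z M k l → coords (pt z M) k l ≡ coords z k l
    coords-pt z M = coords-shift z (shift z M)

    shift-solves : ∀ z M → det z ≢ 0# → ∀ i j → ⟨ comb (shift z M i) E , z j ⟩ ≡ M i j
    shift-solves z M nz i j = begin
      ⟨ comb (shift z M i) E , z j ⟩ ≡⟨ form-combˡ _ E (z j) ⟩
      sum K (λ l → shift z M i l * ⟨ E l , z j ⟩)
        ≡⟨ sum-cong K (λ l → trans (*-congˡ (form-sym _ _)) (solve 3 (λ D c b → D :* c :* b := D :* (b :* c)) refl _ _ _)) ⟩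
      sum K (λ l → inv (det z) * (coords z j l * cramer K (coords z) (M i) l)) ≡⟨ sum-* K _ _ ⟩
      inv (det z) * sum K (λ l → coords z j l * cramer K (coords z) (M i) l) ≡⟨ *-congˡ (cramer-solves K (coords z) (M i) j) ⟩
      inv (det z) * (det z * M i j) ≡⟨ solve 3 (λ i c m → i :* (c :* m) := c :* (i :* m)) refl _ _ _ ⟩
      det z * (inv (det z) * M i j) ≡⟨ *-inv-cancel _ nz ⟩
      M i j ∎

    isotropic-combs : ∀ (c c′ : V K) → ⟨ comb c E , comb c′ E ⟩ ≡ 0#
    isotropic-combs c c′ = trans (form-combʳ c′ E _) (sum-0 K λ l → trans (*-congˡ (comb-E c l)) (zeroʳ _))

    -- The vectors `A i` are orthogonal to each other and isotropic, so only the cross terms remain,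
    -- and `shift` solves the linear system that makes these `M` and its transpose.
    gram-pt : ∀ z M → det z ≢ 0# → ∀ i j → gram (pt z M) i j ≡ gram z i j + M i j + M j i
    gram-pt z M nz i j = begin
      ⟨ z i ⊕ A i , z j ⊕ A j ⟩ ≡⟨ trans (form-⊕ˡ _ _ _) (cong₂ _+_ (form-⊕ʳ _ _ _) (form-⊕ʳ _ _ _)) ⟩
      (⟨ z i , z j ⟩ + ⟨ z i , A j ⟩) + (⟨ A i , z j ⟩ + ⟨ A i , A j ⟩)
        ≡⟨ cong₂ _+_ (+-congˡ (trans (form-sym _ _) (shift-solves z M nz j i))) (cong₂ _+_ (shift-solves z M nz i j) (isotropic-combs _ _)) ⟩
      (gram z i j + M j i) + (M i j + 0#) ≡⟨ solve 3 (λ g m n → (g :+ n) :+ (m :+ con (pos 0)) := g :+ m :+ n) refl _ _ _ ⟩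
      gram z i j + M i j + M j i ∎
      where
      A : Fin K → V d
      A i = comb (shift z M i) E

    gramV : Pt → Mat → Mat
    gramV z M i j = gram z i j + M i j + M j i

    gramV-cong : ∀ {z z′ M M′} → z ≋ z′ → (∀ i j → M i j ≡ M′ i j) → ∀ i j → gramV z M i j ≡ gramV z′ M′ i j
    gramV-cong e f i j = cong₂ _+_ (cong₂ _+_ (gram-cong e i j) (f i j)) (f j i)

    -- The curve t ↦ (zAt z t , MAt z M t) joins (x₀ , 0) to (z , M), and its Gram matrix moves along a line.
    module Flow (x₀ : Pt) where
      diff : Pt → Pt
      diff z i a = z i a - x₀ i a

      zAt : Pt → F → Pt
      zAt z t i = x₀ i ⊕ t · diff z i

      -- The Gram matrix of `zAt z t` contains t² Gram(`diff z`). The correction t(1 - t)/2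
      -- Gram(`diff z`) enters M + Mᵀ twice, turns this into a linear term, and vanishes at both
      -- ends.
      MAt : Pt → Mat → F → Mat
      MAt z M t i j = t * M i j + ½ * ((t * (1# - t)) * gram (diff z) i j)

      zAt-cong : ∀ {z z′} t → z ≋ z′ → zAt z t ≋ zAt z′ t
      zAt-cong t e i a = +-congˡ (*-congˡ (+-congʳ (e i a)))

      MAt-cong : ∀ {z z′ M M′} t → z ≋ z′ → (∀ i j → M i j ≡ M′ i j) → ∀ i j → MAt z M t i j ≡ MAt z′ M′ t i j
      MAt-cong t e f i j = cong₂ _+_ (*-congˡ (f i j)) (*-congˡ (*-congˡ (gram-cong (λ i a → +-congʳ (e i a)) i j)))

      zAt-zAt : ∀ z t u → zAt (zAt z t) u ≋ zAt z (u * t)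
      zAt-zAt z t u i a = solve 4 (λ x z t u → x :+ u :* (x :+ t :* (z :- x) :- x) := x :+ (u :* t) :* (z :- x)) refl (x₀ i a) (z i a) t u

      -- Composition of flows multiplies the times, so for t ≠ 0 the flow at time `inv t` undoes the
      -- one at time t.
      MAt-MAt : ∀ z M t u i j → MAt (zAt z t) (MAt z M t) u i j ≡ MAt z M (u * t) i j
      MAt-MAt z M t u i j = trans (+-congˡ (*-congˡ (*-congˡ quad)))
        (solve 5 (λ t u m h γ → u :* (t :* m :+ h :* ((t :* (con (pos 1) :- t)) :* γ)) :+ h :* ((u :* (con (pos 1) :- u)) :* (t :* (t :* γ)))
                   := (u :* t) :* m :+ h :* (((u :* t) :* (con (pos 1) :- u :* t)) :* γ)) refl t u (M i j) ½ (gram (diff z) i j))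
        where
        quad : gram (diff (zAt z t)) i j ≡ t * (t * gram (diff z) i j)
        quad = trans (form-cong {x′ = t · diff z i} {y′ = t · diff z j} (scaled i) (scaled j)) (trans (form-·ˡ t _ _) (*-congˡ (form-·ʳ t _ _)))
          where
          scaled : ∀ i a → diff (zAt z t) i a ≡ t * diff z i a
          scaled i a = solve 3 (λ x w t → x :+ t :* w :- x := t :* w) refl (x₀ i a) (diff z i a) t

      zAt-1 : ∀ z {t} → t ≡ 1# → zAt z t ≋ z
      zAt-1 z refl i a = solve 2 (λ x z → x :+ con (pos 1) :* (z :- x) := z) refl (x₀ i a) (z i a)

      MAt-1 : ∀ z M {t} → t ≡ 1# → ∀ i j → MAt z M t i j ≡ M i j
      MAt-1 z M refl i j = solve 3 (λ m h γ → con (pos 1) :* m :+ h :* ((con (pos 1) :* (con (pos 1) :- con (pos 1))) :* γ) := m) refl (M i j) ½ _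

      zAt-0 : ∀ z {t} → t ≡ 0# → zAt z t ≋ x₀
      zAt-0 z refl i a = solve 2 (λ x z → x :+ con (pos 0) :* (z :- x) := x) refl (x₀ i a) (z i a)

      MAt-0 : ∀ z M {t} → t ≡ 0# → ∀ i j → MAt z M t i j ≡ 0#
      MAt-0 z M refl i j = solve 3 (λ m h γ → con (pos 0) :* m :+ h :* ((con (pos 0) :* (con (pos 1) :- con (pos 0))) :* γ) := con (pos 0)) refl (M i j) ½ _

      gram-flow : ∀ z M t i j → gramV (zAt z t) (MAt z M t) i j ≡ gram x₀ i j + t * (gramV z M i j - gram x₀ i j)
      gram-flow z M t i j = begin
        gram (zAt z t) i j + (t * M i j + ½ * ((t * (1# - t)) * γ)) + (t * M j i + ½ * ((t * (1# - t)) * gram (diff z) j i))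
          ≡⟨ cong₂ (λ x y → x + (t * M i j + ½ * ((t * (1# - t)) * γ)) + (t * M j i + ½ * ((t * (1# - t)) * y))) (expand t) (gram-sym (diff z) j i) ⟩
        (g + t * α + (t * β + t * (t * γ))) + (t * M i j + ½ * ((t * (1# - t)) * γ)) + (t * M j i + ½ * ((t * (1# - t)) * γ))
          ≡⟨ solve 8 (λ g t α β γ m n h → (g :+ t :* α :+ (t :* β :+ t :* (t :* γ))) :+ (t :* m :+ h :* ((t :* (con (pos 1) :- t)) :* γ)) :+ (t :* n :+ h :* ((t :* (con (pos 1) :- t)) :* γ))
                := (g :+ t :* α :+ (t :* β :+ t :* (t :* γ))) :+ t :* (m :+ n) :+ (h :* ((t :* (con (pos 1) :- t)) :* γ) :+ h :* ((t :* (con (pos 1) :- t)) :* γ))) refl g t α β γ (M i j) (M j i) ½ ⟩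
        (g + t * α + (t * β + t * (t * γ))) + t * (M i j + M j i) + (½ * ((t * (1# - t)) * γ) + ½ * ((t * (1# - t)) * γ))
          ≡⟨ +-congˡ (half _) ⟩
        (g + t * α + (t * β + t * (t * γ))) + t * (M i j + M j i) + (t * (1# - t)) * γ
          ≡⟨ solve 7 (λ g t α β γ m n → (g :+ t :* α :+ (t :* β :+ t :* (t :* γ))) :+ t :* (m :+ n) :+ (t :* (con (pos 1) :- t)) :* γ
                := g :+ t :* ((g :+ con (pos 1) :* α :+ (con (pos 1) :* β :+ con (pos 1) :* (con (pos 1) :* γ))) :+ m :+ n :- g)) refl g t α β γ (M i j) (M j i) ⟩
        g + t * ((g + 1# * α + (1# * β + 1# * (1# * γ))) + M i j + M j i - g)
          ≡⟨ cong (λ x → g + t * (x + M i j + M j i - g)) (trans (sym (expand 1#)) (gram-cong (zAt-1 z refl) i j)) ⟩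
        g + t * (gramV z M i j - g) ∎
        where
        g = gram x₀ i j
        α = ⟨ x₀ i , diff z j ⟩
        β = ⟨ diff z i , x₀ j ⟩
        γ = gram (diff z) i j
        expand : ∀ t → gram (zAt z t) i j ≡ g + t * α + (t * β + t * (t * γ))
        expand t = trans (form-⊕ˡ _ _ _) (cong₂ _+_ (trans (form-⊕ʳ _ _ _) (+-congˡ (form-·ʳ t _ _)))
          (trans (form-⊕ʳ _ _ _) (cong₂ _+_ (form-·ˡ t _ _) (trans (form-·ˡ t _ _) (*-congˡ (form-·ʳ t _ _))))))

      coords-zAt : ∀ (e : V d) z t k → ⟨ zAt z t k , e ⟩ ≡ ⟨ x₀ k , e ⟩ + t * ⟨ diff z k , e ⟩
      coords-zAt e z t k = trans (form-⊕ˡ _ _ _) (+-congˡ (form-·ˡ t _ _))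

      coords-curve : ∀ (e : V d) z k → Curve 1 (λ t → ⟨ zAt z t k , e ⟩)
      coords-curve e z k = curve-cong (λ t → sym (coords-zAt e z t k)) (curve-line _ _)

      det-curve : ∀ z → Curve (degΔ K 1) (λ t → det (zAt z t))
      det-curve z = Δ-curve K λ k l → coords-curve (E l) z k

      num-curve : ∀ z M i a → Curve degNum (λ t → num (zAt z t) (MAt z M t) i a)
      num-curve z M i a = curve-+ (curve-≤ (ℕP.m≤m+n _ _) (curve-* (det-curve z) (curve-line _ _)))
        (curve-≤ (ℕP.m≤n+m _ (degΔ K 1 ℕ.+ 1)) (curve-sum K λ l → curve-cong (λ t → *-comm _ _) (curve-scale (E l a)
          (cramer-curve K (λ k l → coords-curve (E l) z k) (λ j → curve-+ (curve-≤ (s≤s z≤n) (curve-* curve-id (curve-const _)))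
             (curve-scale ½ (curve-* (curve-* curve-id (curve-- (curve-≤ z≤n (curve-const 1#)) curve-id)) (curve-const _)))) l))))

      -- At time 0 the matrix vanishes, and with it the shift, the coordinates of `x₀` being
      -- non-singular: the rational curve does start at `x₀`.
      num-0 : ∀ z M → det x₀ ≢ 0# → ∀ i a → det (zAt z 0#) * x₀ i a ≡ num (zAt z 0#) (MAt z M 0#) i a
      num-0 z M nz i a = trans (sym (+-identityʳ _)) (cong₂ _+_ (*-congˡ (sym (zAt-0 z refl i a)))
        (sym (sum-0 K λ l → trans (*-congʳ (Δ-nonsingular K (coords (zAt z 0#)) _ (nz ∘ trans (det-cong λ k b → sym (zAt-0 z refl k b)))
          (λ k → trans (cramer-solves K (coords (zAt z 0#)) (MAt z M 0# i) k) (trans (*-congˡ (MAt-0 z M refl i k)) (zeroʳ _))) l)) (zeroˡ _))))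

-- Counting good points in one chart.

private
  double-sum : ∀ a b → (a ℕ.+ b) ℕ.+ (a ℕ.+ b) ≡ 2 ℕ.* a ℕ.+ 2 ℕ.* b
  double-sum = solve-∀

  regroup : ∀ D o m → D ℕ.* (2 ℕ.* (o ℕ.* m)) ≡ o ℕ.* (2 ℕ.* D) ℕ.* m
  regroup = solve-∀

-- Zeros of the chart determinant, plus the parameters to which badness is not transferred: at all
-- other times a flow from a bad point is at a bad point.
badDegree : ℕ → ℕ → ℕ
badDegree K s = degΔ K 1 ℕ.+ s ℕ.* numeratorDegree K

module Charts (𝔽 : FiniteField) (𝒞 : CurveTheory 𝔽) (d K : ℕ) (form : Form 𝔽 d) (s : ℕ) (problem : Ambient.Problem 𝔽 𝒞 d K form s) where
  open FiniteField 𝔽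
  open FieldLemmas 𝔽
  open Elimination 𝔽
  open CurveTheory 𝒞
  open CurveLemmas 𝔽 𝒞
  open Form form
  open Ambient 𝔽 𝒞 d K form
  open Problem problem
  open Solver using (solve; _:=_; con; _:+_; _:*_; :-_; _:-_)

  private
    module FPt = Finite FPt
    module FMat = Finite FMat

  degBad : ℕ
  degBad = badDegree K s

  module ChartAt (E : Fin K → V d) (EE : ∀ i j → ⟨ E i , E j ⟩ ≡ 0#) (x₀ : Pt) (x₀∈Ω : Ω x₀ ≡ true) (x₀-bad : Bad x₀)
    (x₀-chart : Chart.det E EE x₀ ≢ 0#) where
    open Chart E EE
    open Flow x₀

    inV : Pt × Mat → Bool
    inV (z , M) = W (gramV z M)

    inV-resp : ∀ {z z′ M M′} → z ≋ z′ → (∀ i j → M i j ≡ M′ i j) → inV (z , M) ≡ true → inV (z′ , M′) ≡ true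
    inV-resp e f = W-resp (gramV-cong e f)

    inV-flow : ∀ z M t → inV (z , M) ≡ true → inV (zAt z t , MAt z M t) ≡ true
    inV-flow z M t v = W-affine t (gram-flow z M t) x₀∈Ω v

    Ω-pt : ∀ z M → det z ≢ 0# → inV (z , M) ≡ true → Ω (pt z M) ≡ true
    Ω-pt z M nz v = W-resp (λ i j → sym (gram-pt z M nz i j)) v

    bad-on-curve : ∀ z M → Σ (F → Set) λ Q → (∀ t → Dec (Q t)) × Few 𝔽 (s ℕ.* degNum) Q ×
                   (∀ t → det (zAt z t) ≢ 0# → ¬ Q t → Bad (pt (zAt z t) (MAt z M t)))
    bad-on-curve z M = proj₁ r , proj₁ (proj₂ r) , proj₁ (proj₂ (proj₂ r)) ,
        λ t nz nq → proj₂ (proj₂ (proj₂ r)) t _ nz (pt-num (zAt z t) (MAt z M t) nz) nq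
      where
      r = bad-curve (λ i a t → num (zAt z t) (MAt z M t) i a) (λ t → det (zAt z t)) (num-curve z M)
        (curve-≤ det-degree (det-curve z)) 0# x₀ (x₀-chart ∘ trans (det-cong λ k a → sym (zAt-0 z refl k a))) (num-0 z M x₀-chart) x₀-bad

    det-few : ∀ z → Few 𝔽 (degΔ K 1) (λ t → det (zAt z t) ≡ 0#)
    det-few z = curve-few (det-curve z) 0# (x₀-chart ∘ trans (det-cong λ k a → sym (zAt-0 z refl k a)))

    -- Three small sets of times have to be avoided. The first two are small because the curve
    -- starts at `x₀`, which is bad and in the chart; the third because `ψ` is non-zero at `t₁`.
    link : ∀ {D} z M → inV (z , M) ≡ true → (ψ : F → F) → Curve D ψ → ∀ t₁ → ψ t₁ ≢ 0# → degBad ℕ.+ D < q →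
           Σ F λ t → det (zAt z t) ≢ 0# × ψ t ≢ 0# × Bad (pt (zAt z t) (MAt z M t)) × Ω (pt (zAt z t) (MAt z M t)) ≡ true
    link z M v ψ c t₁ nz lt = t , n ∘ inj₁ ∘ inj₁ , n ∘ inj₂ , proj₂ (proj₂ (proj₂ b)) t (n ∘ inj₁ ∘ inj₁) (n ∘ inj₁ ∘ inj₂) ,
        Ω-pt _ _ (n ∘ inj₁ ∘ inj₁) (inV-flow z M t v)
      where
      b = bad-on-curve z M
      picked = few-pick (few-∪ (few-∪ (det-few z) (proj₁ (proj₂ (proj₂ b)))) (curve-few c t₁ nz))
        (λ t → ((det (zAt z t) ≟ 0#) ⊎-dec proj₁ (proj₂ b) t) ⊎-dec (ψ t ≟ 0#)) lt
      t = proj₁ picked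
      n = proj₂ picked

    FV×M = product FPt FMat
    private module FVM = Finite FV×M

    -- Parameters that define no point, or a good one. Both kinds are bounded by the same count; the
    -- first is needed separately to compare the parameter space with Ω.
    exceptional : Pt × Mat → Bool
    exceptional (z , M) = inV (z , M) ∧ (does (det z ≟ 0#) ∨ G (pt z M))

    exceptional-resp : FVM.Respects exceptional
    exceptional-resp {z , M} {z′ , M′} (e , f) x =
        ∧-intro (inV-resp e f (proj₁ (∧-true {inV (z , M)} x))) (case (∨-true {does (det z ≟ 0#)} (proj₂ (∧-true {inV (z , M)} x))))
      where
      case : does (det z ≟ 0#) ≡ true ⊎ G (pt z M) ≡ true → does (det z′ ≟ 0#) ∨ G (pt z′ M′) ≡ true
      case (inj₁ t) = ∨-introˡ (does-true (det z′ ≟ 0#) (trans (sym (det-cong e)) (true-does (det z ≟ 0#) t)))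
      case (inj₂ t) = ∨-introʳ {does (det z′ ≟ 0#)} (G-resp (pt-cong e f) t)

    hits : (Pt × Mat) × F → Bool
    hits ((z , M) , t) = inV (z , M) ∧ (nonzero t ∧ exceptional (zAt z t , MAt z M t))

    few-hits : ∀ v → inV v ≡ true → Finite.# finite (λ t → hits (v , t)) ≤ degBad
    few-hits (z , M) v = few-∪ (det-few z) (proj₁ (proj₂ (proj₂ b))) _ (filterᵇ-AllPairs (λ t → hits ((z , M) , t)) unique)
        (All.map (λ {t} h → why t (∨-true (proj₂ (∧-true {inV (zAt z t , MAt z M t)} (proj₂ (∧-true {nonzero t} (proj₂ (∧-true {inV (z , M)} h))))))))
          (filterᵇ-all (λ t → hits ((z , M) , t)) elements))
      where
      b = bad-on-curve z M
      why : ∀ t → does (det (zAt z t) ≟ 0#) ≡ true ⊎ G (pt (zAt z t) (MAt z M t)) ≡ true → det (zAt z t) ≡ 0# ⊎ proj₁ b t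
      why t (inj₁ e) = inj₁ (true-does (det (zAt z t) ≟ 0#) e)
      why t (inj₂ g) = decide (det (zAt z t) ≟ 0#)
        where
        decide : Dec (det (zAt z t) ≡ 0#) → det (zAt z t) ≡ 0# ⊎ proj₁ b t
        decide (yes e) = inj₁ e
        decide (no nz) = inj₂ (decidable-stable (proj₁ (proj₂ b) t) λ nq → G-good _ g (proj₂ (proj₂ (proj₂ b)) t nz nq))

    -- Pairs of a parameter point and a time t ≠ 0 are counted. Flowing an exceptional point at time
    -- `inv t` injects its pairs into those whose flow at time t is exceptional, and each starting
    -- point has at most `degBad` such times.
    exceptional-bound : units ℕ.* FVM.# exceptional ≤ degBad ℕ.* FVM.# inV
    exceptional-bound = subst₂ _≤_ (ℕP.*-comm _ units) (ℕP.*-comm _ degBad)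
      (ℕP.≤-trans (#-pairs-lower FV×M finite exceptional (λ (v , t) → exceptional v ∧ nonzero t) units (λ v x → #-mono finite _ _ λ t n → ∧-intro x n))
        (ℕP.≤-trans (#-inject (product FV×M finite) (product FV×M finite) _ hits back hits-resp
            (λ { ((z , M) , t) x → back-hits z M t (proj₁ (∧-true {exceptional (z , M)} x)) (nonzero-true (proj₂ (∧-true {exceptional (z , M)} x))) })
            (λ { ((z , M) , t) ((z′ , M′) , t′) x x′ ((e , f) , refl) →
               let nz = nonzero-true (proj₂ (∧-true {exceptional (z , M)} x)) in
               ( (λ i a → trans (sym (forth-z z nz i a)) (trans (zAt-cong t e i a) (forth-z z′ nz i a)))
               , λ i j → trans (sym (forth-M z M nz i j)) (trans (MAt-cong t e f i j) (forth-M z′ M′ nz i j)) ) , refl }))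
          (#-pairs-upper FV×M finite inV hits degBad few-hits (λ v t x → proj₁ (∧-true {inV v} x)))))
      where
      back : (Pt × Mat) × F → (Pt × Mat) × F
      back ((z , M) , t) = (zAt z (inv t) , MAt z M (inv t)) , t
      forth-z : ∀ z {t} → t ≢ 0# → zAt (zAt z (inv t)) t ≋ z
      forth-z z {t} nz i a = trans (zAt-zAt z (inv t) t i a) (zAt-1 z (*-inv nz) i a)
      forth-M : ∀ z M {t} → t ≢ 0# → ∀ i j → MAt (zAt z (inv t)) (MAt z M (inv t)) t i j ≡ M i j
      forth-M z M {t} nz i j = trans (MAt-MAt z M (inv t) t i j) (MAt-1 z M (*-inv nz) i j)
      back-hits : ∀ z M t → exceptional (z , M) ≡ true → t ≢ 0# → hits (back ((z , M) , t)) ≡ true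
      back-hits z M t x nz = ∧-intro (inV-flow z M (inv t) (proj₁ (∧-true {inV (z , M)} x))) (∧-intro (true-nonzero nz)
        (exceptional-resp {z , M} {zAt (zAt z (inv t)) t , MAt (zAt z (inv t)) (MAt z M (inv t)) t}
          ((λ i a → sym (forth-z z nz i a)) , λ i j → sym (forth-M z M nz i j)) x))
      hits-resp : Finite.Respects (product FV×M finite) hits
      hits-resp {(z , M) , t} {(z′ , M′) , .t} ((e , f) , refl) h with ∧-true {inV (z , M)} h
      ... | v , h′ with ∧-true {nonzero t} h′
      ...   | n , x = ∧-intro (inV-resp e f v) (∧-intro n
                (exceptional-resp {zAt z t , MAt z M t} {zAt z′ t , MAt z′ M′ t} (zAt-cong t e , MAt-cong t e f) x))

    G∩chart : Pt → Bool
    G∩chart n = G n ∧ nonzero (det n)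

    unshift : Pt → Mat → Pt
    unshift n M i = n i ⊕ comb (λ l → - shift n M i l) E

    coords-unshift : ∀ n M k l → coords (unshift n M) k l ≡ coords n k l
    coords-unshift n M = coords-shift n _

    pt-unshift : ∀ n M → pt (unshift n M) M ≋ n
    pt-unshift n M i a = trans (cong₂ _+_ (+-congˡ {n i a} (trans (sum-cong K λ l → solve 2 (λ c e → (:- c) :* e := (:- con (pos 1)) :* (c :* e)) refl _ _) (sum-* K _ _)))
        (sum-cong K λ l → *-congʳ (shift-cong {M = M} {M} (coords-unshift n M) (λ _ _ → refl) i l)))
      (solve 2 (λ n c → n :+ (:- con (pos 1)) :* c :+ c := n) refl _ _)

    unshift-cancel : ∀ n n′ M M′ → unshift n M ≋ unshift n′ M′ → (∀ i j → M i j ≡ M′ i j) → n ≋ n′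
    unshift-cancel n n′ M M′ e f i a = trans (sym (pt-unshift n M i a)) (trans (pt-cong {M = M} {M′} e f i a) (pt-unshift n′ M′ i a))

    pt-cancel : ∀ z z′ M M′ → pt z M ≋ pt z′ M′ → (∀ i j → M i j ≡ M′ i j) → z ≋ z′
    pt-cancel z z′ M M′ e f i a = trans (solve 2 (λ z c → z := z :+ c :- c) refl (z i a) _) (trans
      (cong₂ _-_ (e i a) (sum-cong K λ l → *-congʳ (shift-cong {M = M} {M′} (λ k l → trans (sym (coords-pt z M k l)) (trans (coords-cong e k l) (coords-pt z′ M′ k l))) f i l)))
      (solve 2 (λ z c → z :+ c :- c := z) refl (z′ i a) _))

    -- A point of the chart arises once for every matrix `M`: subtract the shift, which depends on
    -- the coordinates only and is the same at both ends.
    G-fibres : FPt.# G∩chart ℕ.* FMat.size ≤ FVM.# exceptional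
    G-fibres = ℕP.≤-trans (#-pairs-lower FPt FMat G∩chart (G∩chart ∘ proj₁) FMat.size (λ n x → ℕP.≤-reflexive (sym (#-true FMat _ λ _ → x))))
      (#-inject FV×M FV×M _ exceptional (λ (n , M) → unshift n M , M) exceptional-resp
        (λ { (n , M) x → let g = proj₁ (∧-true {G n} x) ; nz = nonzero-true (proj₂ (∧-true {G n} x)) in
          ∧-intro (W-resp (λ i j → trans (sym (gram-cong (pt-unshift n M) i j)) (gram-pt (unshift n M) M (nz ∘ trans (sym (Δ-cong K (coords-unshift n M)))) i j)) (G⊆Ω n g))
                  (∨-introʳ {does (det (unshift n M) ≟ 0#)} (G-resp (λ i a → sym (pt-unshift n M i a)) g)) })
        (λ { (n , M) (n′ , M′) _ _ (e , f) → unshift-cancel n n′ M M′ e f , f }))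

    generic : Pt × Mat → Bool
    generic (z , M) = inV (z , M) ∧ nonzero (det z)

    singular : Pt × Mat → Bool
    singular (z , M) = inV (z , M) ∧ does (det z ≟ 0#)

    generic-bound : FVM.# generic ≤ FPt.# Ω ℕ.* FMat.size
    generic-bound = ℕP.≤-trans
      (#-inject FV×M FV×M generic (Ω ∘ proj₁) (λ (z , M) → pt z M , M) (λ { (e , _) → Ω-resp e })
        (λ { (z , M) x → Ω-pt z M (nonzero-true (proj₂ (∧-true {inV (z , M)} x))) (proj₁ (∧-true {inV (z , M)} x)) })
        (λ { (z , M) (z′ , M′) _ _ (e , f) → pt-cancel z z′ M M′ e f , f }))
      (#-pairs-upper FPt FMat Ω (Ω ∘ proj₁) FMat.size (λ n _ → #≤size FMat _) (λ _ _ x → x))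

    V-bound : 2 ℕ.* suc degBad ≤ units → FVM.# inV ≤ 2 ℕ.* FVM.# generic
    V-bound big = ℕP.+-cancelˡ-≤ _ _ _ (ℕP.≤-trans (ℕP.+-mono-≤ cover cover) (ℕP.≤-trans (ℕP.≤-reflexive rearrange) (ℕP.+-monoˡ-≤ _ half-singular)))
      where
      v = FVM.# inV
      s₀ = FVM.# singular
      g₀ = FVM.# generic
      cover : v ≤ s₀ ℕ.+ g₀
      cover = #-∪ FV×M inV singular generic λ { (z , M) x → split z x }
        where
        split : ∀ z {b} → b ≡ true → b ∧ does (det z ≟ 0#) ≡ true ⊎ b ∧ nonzero (det z) ≡ true
        split z refl = decide (does (det z ≟ 0#))
          where
          decide : ∀ b → b ≡ true ⊎ not b ≡ true
          decide true  = inj₁ refl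
          decide false = inj₂ refl
      rearrange : (s₀ ℕ.+ g₀) ℕ.+ (s₀ ℕ.+ g₀) ≡ 2 ℕ.* s₀ ℕ.+ 2 ℕ.* g₀
      rearrange = double-sum s₀ g₀
      half-singular : 2 ℕ.* s₀ ≤ v
      -- The factor is `suc degBad` because it must be non-zero to be cancelled.
      half-singular = ℕP.*-cancelˡ-≤ (suc degBad) (begin
        suc degBad ℕ.* (2 ℕ.* s₀) ≡⟨ trans (sym (ℕP.*-assoc (suc degBad) 2 s₀)) (cong (ℕ._* s₀) (ℕP.*-comm (suc degBad) 2)) ⟩
        2 ℕ.* suc degBad ℕ.* s₀ ≤⟨ ℕP.*-monoˡ-≤ s₀ big ⟩
        units ℕ.* s₀ ≤⟨ ℕP.*-monoʳ-≤ units (#-mono FV×M singular exceptional λ { (z , M) x → ∧-intro (proj₁ (∧-true {inV (z , M)} x)) (∨-introˡ (proj₂ (∧-true {inV (z , M)} x))) }) ⟩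
        units ℕ.* FVM.# exceptional ≤⟨ exceptional-bound ⟩
        degBad ℕ.* v ≤⟨ ℕP.*-monoˡ-≤ v (ℕP.n≤1+n degBad) ⟩
        suc degBad ℕ.* v ∎)
        where open ℕP.≤-Reasoning

    chart-bound : 2 ℕ.* suc degBad ≤ units → .{{_ : ℕ.NonZero FMat.size}} → FPt.# G∩chart ℕ.* units ≤ FPt.# Ω ℕ.* (2 ℕ.* degBad)
    chart-bound big = ℕP.*-cancelʳ-≤ _ _ FMat.size (begin
      FPt.# G∩chart ℕ.* units ℕ.* m ≡⟨ trans (ℕP.*-assoc (FPt.# G∩chart) units m) (trans (cong (FPt.# G∩chart ℕ.*_) (ℕP.*-comm units m)) (trans (sym (ℕP.*-assoc (FPt.# G∩chart) m units)) (ℕP.*-comm _ units))) ⟩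
      units ℕ.* (FPt.# G∩chart ℕ.* m) ≤⟨ ℕP.*-monoʳ-≤ units G-fibres ⟩
      units ℕ.* FVM.# exceptional ≤⟨ exceptional-bound ⟩
      degBad ℕ.* FVM.# inV ≤⟨ ℕP.*-monoʳ-≤ degBad (ℕP.≤-trans (V-bound big) (ℕP.*-monoʳ-≤ 2 generic-bound)) ⟩
      degBad ℕ.* (2 ℕ.* (FPt.# Ω ℕ.* m)) ≡⟨ regroup degBad (FPt.# Ω) m ⟩
      FPt.# Ω ℕ.* (2 ℕ.* degBad) ℕ.* m ∎)
      where
      open ℕP.≤-Reasoning
      m = FMat.size

-- Linear algebra by counting.

swap-middle : ∀ a b c → a ℕ.* (b ℕ.* c) ≡ b ℕ.* (a ℕ.* c)
swap-middle = solve-∀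

module LinearCounting (𝔽 : FiniteField) where
  open FiniteField 𝔽
  open FieldLemmas 𝔽
  open Solver using (solve; _:=_; con; _:+_; _:*_; :-_; _:-_)

  zeroV? : ∀ {n} (w : V n) → Dec (∀ i → w i ≡ 0#)
  zeroV? w = all? λ i → w i ≟ 0#

  apply : ∀ {K h} → (Fin K → Fin h → F) → V h → V K
  apply {h = h} y β i = sum h (λ m → y i m * β m)

  apply-- : ∀ {K h} (y : Fin K → Fin h → F) β γ i → apply y (λ m → β m - γ m) i ≡ apply y β i - apply y γ i
  apply-- {h = h} y β γ i = trans (sum-cong h λ m → solve 3 (λ y b c → y :* (b :- c) := y :* b :+ (:- con (pos 1)) :* (y :* c)) refl _ _ _)
    (trans (sum-lin h _ _ _) (solve 2 (λ a b → a :+ (:- con (pos 1)) :* b := a :- b) refl _ _))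

  apply-cong : ∀ {K h} (y : Fin K → Fin h → F) {β γ} → β ≗V γ → apply y β ≗V apply y γ
  apply-cong {h = h} y e i = sum-cong h λ m → *-congˡ (e m)

  kernel : ∀ {K h} → (Fin K → Fin h → F) → V h → Bool
  kernel y β = does (zeroV? (apply y β))

  kernel-true : ∀ {K h} (y : Fin K → Fin h → F) β → kernel y β ≡ true → ∀ i → apply y β i ≡ 0#
  kernel-true y β = true-does (zeroV? (apply y β))

  true-kernel : ∀ {K h} (y : Fin K → Fin h → F) β → (∀ i → apply y β i ≡ 0#) → kernel y β ≡ true
  true-kernel y β = does-true (zeroV? (apply y β))

  kernel-resp : ∀ {K h} (y : Fin K → Fin h → F) → Finite.Respects (FV h) (kernel y)
  kernel-resp y {β} {γ} e t = true-kernel y γ λ i → trans (sym (apply-cong y e i)) (kernel-true y β t i)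

  private
    module FVK (n : ℕ) = Finite (FV n)

  -- Rank–nullity, as an inequality between cardinalities.
  kernel-size : ∀ {K h} (y : Fin K → Fin h → F) (Im : V K → Bool) → Finite.Respects (FV K) Im → (∀ β → Im (apply y β) ≡ true) →
                q ℕ.^ h ≤ FVK.# K Im ℕ.* FVK.# h (kernel y)
  kernel-size {K} {h} y Im resp im = subst (_≤ FVK.# K Im ℕ.* FVK.# h (kernel y))
    (trans (ℕP.*-identityʳ _) (trans (#-true (FV h) (λ _ → true) λ _ → refl) (size-functions finite h)))
    (#-double (FV h) (FV K) (λ _ → true) Im r 1 (FVK.# h (kernel y))
      (λ { {w , β} {w′ , β′} (e , f) t → does-true (Finite._≈?_ (FV K) (apply y β′) w′)
           λ i → trans (sym (apply-cong y f i)) (trans (true-does (Finite._≈?_ (FV K) (apply y β) w) t i) (e i)) })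
      (λ β _ → #-positive (FV K) _ (λ {w} {w′} e t → does-true (Finite._≈?_ (FV K) (apply y β) w′) λ i → trans (true-does (Finite._≈?_ (FV K) (apply y β) w) t i) (e i)) (apply y β)
        (does-true (Finite._≈?_ (FV K) (apply y β) (apply y β)) λ _ → refl))
      (λ w _ → fibre w)
      (λ β w t → resp (true-does (Finite._≈?_ (FV K) (apply y β) w) t) (im β)))
    where
    r : V h × V K → Bool
    r (β , w) = does (Finite._≈?_ (FV K) (apply y β) w)
    r-true : ∀ β w → r (β , w) ≡ true → apply y β ≗V w
    r-true β w = true-does (Finite._≈?_ (FV K) (apply y β) w)
    -- A non-empty fibre is a translate of the kernel.
    fibre : ∀ w → FVK.# h (λ β → r (β , w)) ≤ FVK.# h (kernel y)
    fibre w = by-search (search (FV h) (λ β → r (β , w)) (λ {β} {γ} e t → does-true (Finite._≈?_ (FV K) (apply y γ) w)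
        λ i → trans (sym (apply-cong y e i)) (r-true β w t i)))
      where
      by-search : (Σ (V h) λ β → r (β , w) ≡ true) ⊎ (∀ β → r (β , w) ≡ false) → FVK.# h (λ β → r (β , w)) ≤ FVK.# h (kernel y)
      by-search (inj₂ none) = #-mono (FV h) _ _ λ β t → ⊥-elim (contradictory t (none β))
      by-search (inj₁ (γ , t)) = #-inject (FV h) (FV h) _ (kernel y) (λ β m → β m - γ m) (kernel-resp y)
        (λ β t′ → true-kernel y _ λ i → trans (apply-- y β γ i) (trans (cong₂ _-_ (r-true β w t′ i) (r-true γ w t i)) (-‿inverseʳ _)))
        (λ β β′ _ _ e m → trans (solve 2 (λ b c → b := b :- c :+ c) refl (β m) (γ m)) (trans (+-congʳ (e m)) (solve 2 (λ b c → b :- c :+ c := b) refl (β′ m) (γ m))))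

  pairing : ∀ {K} → V K → V K → F
  pairing {K} c w = sum K (λ i → c i * w i)

  annihilator : ∀ {K} → V K → V K → Bool
  annihilator c w = does (pairing c w ≟ 0#)

  annihilator-resp : ∀ {K} (c : V K) → Finite.Respects (FV K) (annihilator c)
  annihilator-resp {K} c {w} {w′} e t = does-true (pairing c w′ ≟ 0#) (trans (sum-cong K λ i → *-congˡ (sym (e i))) (true-does (pairing c w ≟ 0#) t))

  -- Translating the hyperplane along the k-th basis vector gives q disjoint copies: the pairing
  -- with `c` tells by which multiple a vector was translated.
  annihilator-size : ∀ {K} (c : V K) k → c k ≢ 0# → FVK.# K (annihilator c) ℕ.* q ≤ q ℕ.^ K
  annihilator-size {K} c k ck = ℕP.≤-trans
    (#-pairs-lower (FV K) finite (annihilator c) (annihilator c ∘ proj₁) q λ w t → ℕP.≤-reflexive (sym (#-true finite _ λ _ → t)))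
    (ℕP.≤-trans (#-inject (product (FV K) finite) (FV K) _ (λ _ → true) φ (λ _ _ → refl) (λ _ _ → refl) inj)
      (ℕP.≤-reflexive (trans (#-true (FV K) _ λ _ → refl) (size-functions finite K))))
    where
    φ : V K × F → V K
    φ (w , λ′) i = w i + λ′ * δ i k
    pairing-φ : ∀ w λ′ → pairing c w ≡ 0# → pairing c (φ (w , λ′)) ≡ λ′ * c k
    pairing-φ w λ′ z = trans (sum-cong K λ i → solve 4 (λ c w l d → c :* (w :+ l :* d) := c :* w :+ l :* (c :* d)) refl _ _ _ _)
      (trans (sum-lin K λ′ _ _) (trans (cong₂ _+_ z (*-congˡ (sum-δ K k c))) (+-identityˡ _)))
    inj : ∀ x y → annihilator c (proj₁ x) ≡ true → annihilator c (proj₁ y) ≡ true → φ x ≗V φ y → Finite._≈_ (product (FV K) finite) x y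
    inj (w , l) (w′ , l′) t t′ e = (λ i → trans (solve 3 (λ w l d → w := w :+ l :* d :- l :* d) refl (w i) l (δ i k))
        (trans (cong₂ _-_ (e i) (*-congʳ l≡l′)) (solve 3 (λ w l d → w :+ l :* d :- l :* d := w) refl (w′ i) l′ (δ i k)))) , l≡l′
      where
      l≡l′ : l ≡ l′
      l≡l′ = *-cancelˡ ck (trans (*-comm _ _) (trans (sym (pairing-φ w l (true-does (pairing c w ≟ 0#) t)))
        (trans (sum-cong K λ i → *-congˡ (e i)) (trans (pairing-φ w′ l′ (true-does (pairing c w′ ≟ 0#) t′)) (*-comm _ _)))))

-- Moves that preserve the Gram matrix.

module Escaping (𝔽 : FiniteField) (𝒞 : CurveTheory 𝔽) (d K h : ℕ) (form : Form 𝔽 d) where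
  open FiniteField 𝔽
  open FieldLemmas 𝔽
  open Elimination 𝔽
  open Form form
  open Ambient 𝔽 𝒞 d K form
  open LinearCounting 𝔽
  open ≡-Reasoning
  open Solver using (solve; _:=_; con; _:+_; _:*_; :-_; _:-_)

  coordsIn : (Fin h → V d) → Pt → Fin K → Fin h → F
  coordsIn e n i m = ⟨ n i , e m ⟩

  coordsIn-cong : ∀ e {n n′} → n ≋ n′ → ∀ i m → coordsIn e n i m ≡ coordsIn e n′ i m
  coordsIn-cong e eq i m = form-cong (eq i) (λ _ → refl)

  -- Made total by a dummy value, so that it can enter a map between finite sets; its properties are
  -- claimed at dependent points only.
  relation : ∀ {h} (b : Fin K → Fin h → F) → Fin K → Independent b ⊎ Dependent b → V K × Fin K
  relation b k (inj₁ _)           = 0V , k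
  relation b _ (inj₂ (c , k , _)) = c , k

  dependent? : ∀ {b : Fin K → Fin h → F} → Independent b ⊎ Dependent b → Bool
  dependent? (inj₁ _) = false
  dependent? (inj₂ _) = true

  isDependent : (Fin K → Fin h → F) → Bool
  isDependent b = dependent? (independent-or-dependent b)

  dependent : ∀ b → isDependent b ≡ true → Dependent b
  dependent b t = go (independent-or-dependent b) t
    where
    go : (o : Independent b ⊎ Dependent b) → dependent? o ≡ true → Dependent b
    go (inj₂ x) _ = x

  independent : ∀ b → isDependent b ≡ false → Independent b
  independent b t = go (independent-or-dependent b) t
    where
    go : (o : Independent b ⊎ Dependent b) → dependent? o ≡ false → Independent b
    go (inj₁ x) _ = x

  -- Adding combinations of the isotropic vectors f_m to a point changes its coordinates with respect to the dual
  -- vectors e_m, but not those with respect to the f_m.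
  module Moves (e f : Fin h → V d) (ff : ∀ i j → ⟨ f i , f j ⟩ ≡ 0#) (fe : ∀ i j → ⟨ f i , e j ⟩ ≡ δ i j) where
    x y : Pt → Fin K → Fin h → F
    x = coordsIn e
    y = coordsIn f

    add : Pt → (Fin K → V h) → Pt
    add n c i = n i ⊕ comb (c i) f

    δ-sum : ∀ (c : V h) m → sum h (λ l → c l * δ l m) ≡ c m
    δ-sum c m = sum-δ h m c

    x-add : ∀ n c i m → x (add n c) i m ≡ x n i m + c i m
    x-add n c i m = trans (form-⊕ˡ _ _ _) (+-congˡ (trans (form-combˡ (c i) f (e m)) (trans (sum-cong h λ l → *-congˡ (fe l m)) (δ-sum (c i) m))))

    comb-f : ∀ (c : V h) m → ⟨ comb c f , f m ⟩ ≡ 0#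
    comb-f c m = trans (form-combˡ c f (f m)) (sum-0 h λ l → trans (*-congˡ (ff l m)) (zeroʳ _))

    y-add : ∀ n c i m → y (add n c) i m ≡ y n i m
    y-add n c i m = trans (form-⊕ˡ _ _ _) (trans (+-congˡ (comb-f (c i) m)) (+-identityʳ _))

    -- The hypothesis says that every added vector is orthogonal to all rows of `n`; being
    -- combinations of the f_m, the added vectors are also orthogonal to each other.
    gram-add : ∀ n c → (∀ i j → apply (y n) (c i) j ≡ 0#) → ∀ i j → gram (add n c) i j ≡ gram n i j
    gram-add n c z i j = begin
      ⟨ n i ⊕ comb (c i) f , n j ⊕ comb (c j) f ⟩ ≡⟨ trans (form-⊕ˡ _ _ _) (cong₂ _+_ (form-⊕ʳ _ _ _) (form-⊕ʳ _ _ _)) ⟩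
      (gram n i j + ⟨ n i , comb (c j) f ⟩) + (⟨ comb (c i) f , n j ⟩ + ⟨ comb (c i) f , comb (c j) f ⟩)
        ≡⟨ cong₂ _+_ (+-congˡ (cross i j)) (cong₂ _+_ (trans (form-sym _ _) (cross j i)) (trans (form-combʳ (c j) f _) (sum-0 h λ m → trans (*-congˡ (comb-f (c i) m)) (zeroʳ _)))) ⟩
      (gram n i j + 0#) + (0# + 0#) ≡⟨ solve 1 (λ g → (g :+ con (pos 0)) :+ (con (pos 0) :+ con (pos 0)) := g) refl _ ⟩
      gram n i j ∎
      where
      cross : ∀ i j → ⟨ n i , comb (c j) f ⟩ ≡ 0#
      cross i j = trans (form-combʳ (c j) f (n i)) (trans (sum-cong h λ m → *-comm _ _) (z j i))

    at : Fin K → V h → Fin K → V h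
    at k β i m = δ i k * β m

    move : Pt → Fin K → V h → Pt
    move n k β = add n (at k β)

    apply-at : ∀ (b : Fin K → Fin h → F) k β → (∀ j → apply b β j ≡ 0#) → ∀ i j → apply b (at k β i) j ≡ 0#
    apply-at b k β z i j = trans (sum-cong h λ m → solve 3 (λ y d b → y :* (d :* b) := d :* (y :* b)) refl _ (δ i k) _)
      (trans (sum-* h _ _) (trans (*-congˡ (z j)) (zeroʳ _)))

    -- If c is a relation between the rows of x(n) with c_k = 1, then β is recovered from n + β f (added in row k) and c.
    recover : ∀ n k β (c : V K) → c k ≡ 1# → (∀ m → sum K (λ i → c i * x n i m) ≡ 0#) → ∀ m → sum K (λ i → c i * x (move n k β) i m) ≡ β m
    recover n k β c ck dep m = trans (sum-cong K λ i → trans (*-congˡ (x-add n (at k β) i m)) (solve 4 (λ c x d b → c :* (x :+ d :* b) := c :* x :+ b :* (c :* d)) refl _ _ _ _))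
      (trans (sum-lin K (β m) _ _) (trans (cong₂ _+_ (dep m) (*-congˡ (trans (sum-δ K k c) ck))) (solve 1 (λ b → con (pos 0) :+ b :* con (pos 1) := b) refl _)))

    -- Moving row `k n` by `β` and recording a non-zero multiple of the relation loses nothing:
    -- entry `k n` of `μ · c n` is `μ`, so `c n` is known, `recover` yields `β`, and `n` follows by
    -- subtraction. Each point of `T` has at least σ · `units` images, each point of `Q` is hit by
    -- at most σ · K of them. The free scalar `μ` is what gains a factor of order q.
    module DependentCount (Q T : Pt → Bool) (Q-resp : Finite.Respects FPt Q) (c : Pt → V K) (k : Pt → Fin K)
      (c-k : ∀ n → T n ≡ true → c n (k n) ≡ 1#) (c-dep : ∀ n → T n ≡ true → ∀ m → sum K (λ i → c n i * x n i m) ≡ 0#)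
      (C : V K → Bool) (C-resp : Finite.Respects (FV K) C) (c∈C : ∀ n t → T n ≡ true → C (t · c n) ≡ true)
      (σ : ℕ) (C≤σ : Finite.# (FV K) C ≤ σ) (σ≤kernel : ∀ n → T n ≡ true → σ ≤ Finite.# (FV h) (kernel (y n)))
      (stay : ∀ n β → T n ≡ true → kernel (y n) β ≡ true → Q (move n (k n) β) ≡ true) where

      private
        FVF : Finite (V h × F)
        FVF = product (FV h) finite
        Source : Finite (Pt × V h × F)
        Source = product FPt FVF
        Target : Finite (Pt × V K × Fin K)
        Target = product FPt (product (FV K) (finFinite K))

        moves : Pt × V h × F → Bool
        moves (n , β , μ) = T n ∧ (kernel (y n) β ∧ nonzero μ)

        φ : Pt × V h × F → Pt × V K × Fin K
        φ (n , β , μ) = move n (k n) β , μ · c n , k n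

        target : Pt × V K × Fin K → Bool
        target (n , v , _) = Q n ∧ C v

        inj : ∀ a b → moves a ≡ true → moves b ≡ true → Finite._≈_ Target (φ a) (φ b) → Finite._≈_ Source a b
        inj (n , β , μ) (n′ , β′ , μ′) t t′ (en , ev , ek) = n≋ , β≗ , μ≡
          where
          T₁ = proj₁ (∧-true {T n} t)
          T₂ = proj₁ (∧-true {T n′} t′)
          μ≢0 = nonzero-true {μ} (proj₂ (∧-true {kernel (y n) β} (proj₂ (∧-true {T n} t))))
          c′k : c n′ (k n) ≡ 1#
          c′k = trans (cong (c n′) ek) (c-k n′ T₂)
          μ≡ : μ ≡ μ′
          μ≡ = trans (sym (*-identityʳ μ)) (trans (*-congˡ (sym (c-k n T₁))) (trans (ev (k n)) (trans (*-congˡ c′k) (*-identityʳ μ′))))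
          c≡ : ∀ i → c n i ≡ c n′ i
          c≡ i = *-cancelˡ μ≢0 (trans (ev i) (*-congʳ (sym μ≡)))
          β≗ : ∀ m → β m ≡ β′ m
          β≗ m = trans (sym (recover n (k n) β (c n) (c-k n T₁) (c-dep n T₁) m)) (trans
            (sum-cong K λ i → cong₂ _*_ (c≡ i) (coordsIn-cong e en i m))
            (recover n′ (k n′) β′ (c n′) (c-k n′ T₂) (c-dep n′ T₂) m))
          n≋ : n ≋ n′
          n≋ i a = trans (solve 2 (λ n s → n := n :+ s :- s) refl (n i a) _) (trans
            (cong₂ _-_ (en i a) (sum-cong h λ m → *-congʳ (cong₂ _*_ (cong (δ i) ek) (β≗ m))))
            (solve 2 (λ n s → n :+ s :- s := n) refl (n′ i a) _))

      bound : .{{_ : ℕ.NonZero σ}} → Finite.# FPt T ℕ.* units ≤ Finite.# FPt Q ℕ.* K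
      bound = ℕP.*-cancelˡ-≤ σ (ℕP.≤-trans (ℕP.≤-reflexive (swap-middle σ (Finite.# FPt T) units)) (ℕP.≤-trans lower (ℕP.≤-trans middle (ℕP.≤-trans upper
          (ℕP.≤-reflexive (swap-middle (Finite.# FPt Q) σ K))))))
        where
        lower : Finite.# FPt T ℕ.* (σ ℕ.* units) ≤ Finite.# Source moves
        lower = #-pairs-lower FPt FVF T moves (σ ℕ.* units) λ n t → ℕP.≤-trans (ℕP.*-monoˡ-≤ units (σ≤kernel n t))
          (#-pairs-lower (FV h) finite (kernel (y n)) _ units λ β kb → #-mono finite nonzero _ λ μ nz → ∧-intro t (∧-intro kb nz))
        middle : Finite.# Source moves ≤ Finite.# Target target
        middle = #-inject Source Target moves target φ
          (λ { {n , v , _} {n′ , v′ , _} (en , ev , _) t → ∧-intro (Q-resp en (proj₁ (∧-true {Q n} t))) (C-resp ev (proj₂ (∧-true {Q n} t))) })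
          (λ { (n , β , μ) t → let Tn = proj₁ (∧-true {T n} t) in
               ∧-intro (stay n β Tn (proj₁ (∧-true {kernel (y n) β} (proj₂ (∧-true {T n} t))))) (c∈C n μ Tn) })
          inj
        upper : Finite.# Target target ≤ Finite.# FPt Q ℕ.* (σ ℕ.* K)
        upper = #-pairs-upper FPt (product (FV K) (finFinite K)) Q target (σ ℕ.* K)
          (λ n _ → ℕP.≤-trans (#-pairs-upper (FV K) (finFinite K) C _ K (λ v _ → ℕP.≤-trans (#≤size (finFinite K) _) (ℕP.≤-reflexive (size-fin K)))
             (λ v _ t → proj₂ (∧-true {Q n} t))) (ℕP.*-monoˡ-≤ K C≤σ))
          (λ n _ t → proj₁ (∧-true {Q n} t))

-- Slices, and how to escape from dependence.

module Slices (𝔽 : FiniteField) (𝒞 : CurveTheory 𝔽) (d K h : ℕ) (1+h≡2K : suc h ≡ K ℕ.+ K) (form : Form 𝔽 d) where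
  open FiniteField 𝔽
  open FieldLemmas 𝔽
  open Elimination 𝔽
  open Form form
  open Ambient 𝔽 𝒞 d K form
  open LinearCounting 𝔽
  open Escaping 𝔽 𝒞 d K h form
  open Solver using (solve; _:=_; con; _:+_; _:*_; :-_; _:-_)

  instance
    q-nonZero : ℕ.NonZero q
    q-nonZero = ℕ.>-nonZero (∈-length (complete 0#))

    q^K-nonZero : ℕ.NonZero (q ℕ.^ K)
    q^K-nonZero = ℕP.m^n≢0 q K

  private
    module FPt = Finite FPt
    module FVh = Finite (FV h)
    module FVK = Finite (FV K)

  q*q^h : q ℕ.* q ℕ.^ h ≡ q ℕ.^ K ℕ.* q ℕ.^ K
  q*q^h = trans (cong (q ℕ.^_) 1+h≡2K) (ℕP.^-distribˡ-+-* q K K)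

  -- A relation confines the image of `b` to a hyperplane with q^(K - 1) elements; rank-nullity
  -- leaves q^(h - K + 1) = q^K for the kernel.
  dependent-kernel : ∀ (b : Fin K → Fin h → F) → Dependent b → q ℕ.^ K ≤ FVh.# (kernel b)
  dependent-kernel b (c , k , ck , dep) = ℕP.*-cancelˡ-≤ (q ℕ.^ K) (begin
    q ℕ.^ K ℕ.* q ℕ.^ K ≡⟨ q*q^h ⟨
    q ℕ.* q ℕ.^ h ≤⟨ ℕP.*-monoʳ-≤ q (kernel-size b (annihilator c) (annihilator-resp c) λ β → does-true (pairing c (apply b β) ≟ 0#) (swapped β)) ⟩
    q ℕ.* (FVK.# (annihilator c) ℕ.* FVh.# (kernel b)) ≡⟨ ℕP.*-assoc q _ (FVh.# (kernel b)) ⟨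
    q ℕ.* FVK.# (annihilator c) ℕ.* FVh.# (kernel b) ≤⟨ ℕP.*-monoˡ-≤ _ (ℕP.≤-trans (ℕP.≤-reflexive (ℕP.*-comm q _)) (annihilator-size c k (λ z → 0≢1 (trans (sym z) ck)))) ⟩
    q ℕ.^ K ℕ.* FVh.# (kernel b) ∎)
    where
    open ℕP.≤-Reasoning
    swapped : ∀ β → pairing c (apply b β) ≡ 0#
    swapped β = trans (sum-cong K λ i → sym (sum-* h (c i) _)) (trans (sum-swap K h _)
      (sum-0 h λ m → trans (sum-cong K λ i → solve 3 (λ c b β → c :* (b :* β) := β :* (c :* b)) refl _ _ _)
        (trans (sum-* K (β m) _) (trans (*-congˡ (dep m)) (zeroʳ _)))))

  relation-coeff : ∀ {b : Fin K → Fin h → F} k o → dependent? {b = b} o ≡ true → proj₁ (relation b k o) (proj₂ (relation b k o)) ≡ 1#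
  relation-coeff k (inj₂ (c , k′ , ck , dep)) _ = ck

  relation-dep : ∀ {b : Fin K → Fin h → F} k o → dependent? {b = b} o ≡ true → ∀ m → sum K (λ i → proj₁ (relation b k o) i * b i m) ≡ 0#
  relation-dep k (inj₂ (c , k′ , ck , dep)) _ = dep

  module SliceOf (e f : Fin h → V d) (ff : ∀ i j → ⟨ f i , f j ⟩ ≡ 0#) (fe : ∀ i j → ⟨ f i , e j ⟩ ≡ δ i j) (k₀ : Fin K) where
    open Moves e f ff fe

    rel : Pt → V K × Fin K
    rel n = relation (x n) k₀ (independent-or-dependent (x n))

    -- Dependence of `y n` makes its kernel at least as large as the set of all conceivable
    -- relations between the rows of `x n`, which is what `DependentCount` asks for with σ = q^K.
    doubly-dependent-bound : (Q : Pt → Bool) → FPt.Respects Q →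
      (∀ n k β → Q n ≡ true → kernel (y n) β ≡ true → Q (move n k β) ≡ true) →
      FPt.# (λ n → Q n ∧ (isDependent (x n) ∧ isDependent (y n))) ℕ.* units ≤ FPt.# Q ℕ.* K
    doubly-dependent-bound Q resp stay = DependentCount.bound Q T resp (proj₁ ∘ rel) (proj₂ ∘ rel)
      (λ n t → relation-coeff k₀ (independent-or-dependent (x n)) (proj₁ (∧-true {isDependent (x n)} (proj₂ (∧-true {Q n} t)))))
      (λ n t → relation-dep k₀ (independent-or-dependent (x n)) (proj₁ (∧-true {isDependent (x n)} (proj₂ (∧-true {Q n} t)))))
      (λ _ → true) (λ _ _ → refl) (λ _ _ _ → refl) (q ℕ.^ K)
      (ℕP.≤-trans (#≤size (FV K) _) (ℕP.≤-reflexive (size-functions finite K)))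
      (λ n t → dependent-kernel (y n) (dependent (y n) (proj₂ (∧-true {isDependent (x n)} (proj₂ (∧-true {Q n} t))))))
      (λ n β t kb → stay n _ β (proj₁ (∧-true {Q n} t)) kb)
      where
      T : Pt → Bool
      T n = Q n ∧ (isDependent (x n) ∧ isDependent (y n))

    module At (z : Pt) where
      offset : Pt → Fin K → V h
      offset n i m = x n i m - x z i m

      -- The points obtained from `z` by adding combinations of the f_m orthogonal to all rows of
      -- `z`. The coefficients are read off as differences of coordinates, which keeps the condition
      -- decidable.
      Slice : Pt → Set
      Slice n = n ≋ add z (offset n) × (∀ i j → apply (y z) (offset n i) j ≡ 0#)

      slice? : ∀ n → Dec (Slice n)
      slice? n = (FPt._≈?_ n (add z (offset n))) ×-dec (all? λ i → zeroV? (apply (y z) (offset n i)))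

      slice : Pt → Bool
      slice n = does (slice? n)

      Slice-resp : ∀ {n n′} → n ≋ n′ → Slice n → Slice n′
      Slice-resp {n} {n′} eq (s , o) =
        (λ i a → trans (sym (eq i a)) (trans (s i a) (+-congˡ (sum-cong h λ m → *-congʳ (off i m)))))
        , λ i j → trans (apply-cong (y z) (λ m → sym (off i m)) j) (o i j)
        where
        off : ∀ i m → offset n i m ≡ offset n′ i m
        off i m = +-congʳ (coordsIn-cong e eq i m)

      slice-resp : FPt.Respects slice
      slice-resp {n} {n′} eq t = does-true (slice? n′) (Slice-resp eq (true-does (slice? n) t))

      z∈slice : Slice z
      z∈slice = (λ i a → sym (trans (+-congˡ (sum-0 h λ m → trans (*-congʳ (-‿inverseʳ _)) (zeroˡ _))) (+-identityʳ _)))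
        , λ i j → sum-0 h λ m → trans (*-congˡ (-‿inverseʳ _)) (zeroʳ _)

      y-slice : ∀ {n} → Slice n → ∀ i m → y n i m ≡ y z i m
      y-slice {n} (s , _) i m = trans (coordsIn-cong f s i m) (y-add z (offset n) i m)

      gram-slice : ∀ {n} → Slice n → ∀ i j → gram n i j ≡ gram z i j
      gram-slice {n} (s , o) i j = trans (gram-cong s i j) (gram-add z (offset n) o i j)

      slice-move : ∀ {n} k β → Slice n → kernel (y n) β ≡ true → Slice (move n k β)
      slice-move {n} k β (s , o) kb =
        (λ i a → trans (+-congʳ (s i a)) (trans (+-assoc _ _ _) (+-congˡ (trans (sym (sum-+ h _ _))
           (sum-cong h λ m → trans (sym (distribʳ _ _ _)) (*-congʳ (sym (off i m))))))))
        , λ i j → trans (sum-cong h λ m → trans (*-congˡ (off i m)) (distribˡ _ _ _)) (trans (sum-+ h _ _)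
            (trans (cong₂ _+_ (o i j) (apply-at (y z) k β (λ j → trans (sum-cong h λ m → *-congʳ (sym (y-slice {n} (s , o) j m))) (kernel-true (y n) β kb j)) i j)) (+-identityˡ 0#)))
        where
        off : ∀ i m → offset (move n k β) i m ≡ offset n i m + at k β i m
        off i m = trans (+-congʳ (x-add n (at k β) i m)) (solve 3 (λ a b c → a :+ b :- c := a :- c :+ b) refl _ _ _)

      -- Multiples of coefficients in the kernel stay in the kernel. This provides a curve of
      -- constant Gram matrix without any chart or denominator.
      line : ∀ {n} t → Slice n → ∀ i j → gram (λ i → z i ⊕ t · (λ a → n i a - z i a)) i j ≡ gram z i j
      line {n} t (s , o) i j = trans (gram-cong {n = λ i → z i ⊕ t · (λ a → n i a - z i a)} points i j) (gram-add z (λ i m → t * offset n i m)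
          (λ i j → trans (sum-cong h λ m → solve 3 (λ y t o → y :* (t :* o) := t :* (y :* o)) refl _ t _) (trans (sum-* h t _) (trans (*-congˡ (o i j)) (zeroʳ t)))) i j)
        where
        points : ∀ i a → z i a + t * (n i a - z i a) ≡ add z (λ i m → t * offset n i m) i a
        points i a = +-congˡ (trans (*-congˡ (trans (+-congʳ (s i a)) (solve 2 (λ z c → z :+ c :- z := c) refl (z i a) _)))
          (trans (sym (sum-* h t _)) (sum-cong h λ m → sym (*-assoc t _ _))))

      T : Pt → Bool
      T n = slice n ∧ isDependent (x n)

      T-dep : ∀ n → T n ≡ true → isDependent (x n) ≡ true
      T-dep n t = proj₂ (∧-true {slice n} t)

      T-slice : ∀ n → T n ≡ true → Slice n
      T-slice n t = true-does (slice? n) (proj₁ (∧-true {slice n} t))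

      module _ (K<units : K < units) where
        from-bound : FPt.# T ℕ.* units ≤ FPt.# slice ℕ.* K → Σ Pt λ n → Slice n × Independent (x n)
        from-bound b = found (#-escape FPt T slice (ℕP.≰⇒> λ le → ℕP.<⇒≱ K<units
            (ℕP.*-cancelˡ-≤ (FPt.# slice) {{ℕ.>-nonZero (#-positive FPt slice slice-resp z (does-true (slice? z) z∈slice))}} (ℕP.≤-trans (ℕP.*-monoˡ-≤ units le) b))))
          where
          ∧-false : ∀ {a b} → a ≡ true → a ∧ b ≡ false → b ≡ false
          ∧-false refl e = e
          found : (Σ Pt λ n → slice n ≡ true × T n ≡ false) → Σ Pt λ n → Slice n × Independent (x n)
          found (n , sl , nt) = n , true-does (slice? n) sl , independent (x n) (∧-false sl nt)

        escape-dependent : Dependent (y z) → Σ Pt λ n → Slice n × Independent (x n)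
        escape-dependent (c , k , ck , dep) = from-bound (DependentCount.bound slice T slice-resp (proj₁ ∘ rel) (proj₂ ∘ rel)
          (λ n t → relation-coeff k₀ (independent-or-dependent (x n)) (T-dep n t))
          (λ n t → relation-dep k₀ (independent-or-dependent (x n)) (T-dep n t))
          (λ _ → true) (λ _ _ → refl) (λ _ _ _ → refl) (q ℕ.^ K)
          (ℕP.≤-trans (#≤size (FV K) _) (ℕP.≤-reflexive (size-functions finite K)))
          (λ n t → dependent-kernel (y n) (c , k , ck , λ m → trans (sum-cong K λ i → *-congˡ (y-slice (T-slice n t) i m)) (dep m)))
          (λ n β t kb → does-true (slice? _) (slice-move _ β (T-slice n t) kb)))

        -- Constant on the slice, since coefficients in the kernel pair to zero with row `k₀` of
        -- `y z`. Consequently every relation between the rows of `x n` also annihilates `cross`.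
        cross : Fin K → F
        cross i = sum h (λ m → x z i m * y z k₀ m)

        -- When `y z` is not assumed dependent, the kernel is only known to have q^(K - 1) elements.
        -- The balance is restored because the relations lie in the hyperplane annihilating `cross`,
        -- a proper one as `cross k₀` is non-zero.
        escape-cross : ∀ K′ → K ≡ suc K′ → cross k₀ ≢ 0# → Σ Pt λ n → Slice n × Independent (x n)
        escape-cross K′ K≡ nz = from-bound (DependentCount.bound slice T slice-resp (proj₁ ∘ rel) (proj₂ ∘ rel)
          (λ n t → relation-coeff k₀ (independent-or-dependent (x n)) (T-dep n t))
          (λ n t → relation-dep k₀ (independent-or-dependent (x n)) (T-dep n t))
          (annihilator cross) (annihilator-resp cross) (λ n t Tn → does-true (pairing cross _ ≟ 0#) (killed n t Tn)) (q ℕ.^ K′)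
          (ℕP.*-cancelˡ-≤ q (ℕP.≤-trans (ℕP.≤-reflexive (ℕP.*-comm q _)) (ℕP.≤-trans (annihilator-size cross k₀ nz) (ℕP.≤-reflexive (cong (q ℕ.^_) K≡)))))
          (λ n t → kernel-lower (y n))
          (λ n β t kb → does-true (slice? _) (slice-move _ β (T-slice n t) kb)) {{ℕP.m^n≢0 q K′}})
          where
          kernel-lower : ∀ b → q ℕ.^ K′ ≤ FVh.# (kernel b)
          kernel-lower b = ℕP.*-cancelˡ-≤ q (ℕP.*-cancelˡ-≤ (q ℕ.^ K) (begin
            q ℕ.^ K ℕ.* (q ℕ.* q ℕ.^ K′) ≡⟨ cong (λ k → q ℕ.^ K ℕ.* q ℕ.^ k) K≡ ⟨
            q ℕ.^ K ℕ.* q ℕ.^ K ≡⟨ q*q^h ⟨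
            q ℕ.* q ℕ.^ h ≤⟨ ℕP.*-monoʳ-≤ q (ℕP.≤-trans (kernel-size b (λ _ → true) (λ _ _ → refl) (λ _ → refl))
                 (ℕP.*-monoˡ-≤ _ (ℕP.≤-trans (#≤size (FV K) _) (ℕP.≤-reflexive (size-functions finite K))))) ⟩
            q ℕ.* (q ℕ.^ K ℕ.* FVh.# (kernel b)) ≡⟨ swap-middle q (q ℕ.^ K) (FVh.# (kernel b)) ⟩
            q ℕ.^ K ℕ.* (q ℕ.* FVh.# (kernel b)) ∎))
            where open ℕP.≤-Reasoning
          killed : ∀ n t → T n ≡ true → pairing cross (t · proj₁ (rel n)) ≡ 0#
          killed n t Tn = trans (sum-cong K λ i → trans (*-congʳ (sym (cross-slice i))) (solve 3 (λ s t c → s :* (t :* c) := t :* (c :* s)) refl _ t _))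
            (trans (sum-* K t _) (trans (*-congˡ zero-pairing) (zeroʳ t)))
            where
            c = proj₁ (rel n)
            cross-slice : ∀ i → sum h (λ m → x n i m * y z k₀ m) ≡ cross i
            cross-slice i = trans (sum-cong h λ m → solve 3 (λ a b y → a :* y := b :* y :+ y :* (a :- b)) refl (x n i m) (x z i m) (y z k₀ m))
              (trans (sum-+ h _ _) (trans (+-congˡ (proj₂ (T-slice n Tn) i k₀)) (+-identityʳ _)))
            zero-pairing : sum K (λ i → c i * sum h (λ m → x n i m * y z k₀ m)) ≡ 0#
            zero-pairing = trans (sum-cong K λ i → sym (sum-* h (c i) _)) (trans (sum-swap K h _)
              (sum-0 h λ m → trans (sum-cong K λ i → solve 3 (λ c x y → c :* (x :* y) := y :* (c :* x)) refl _ _ _)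
                (trans (sum-* K (y z k₀ m) _) (trans (*-congˡ (relation-dep k₀ (independent-or-dependent (x n)) (T-dep n Tn) m)) (zeroʳ (y z k₀ m))))))

-- From one bad point to all charts; the global count.

private
  distribute : ∀ o N D K → N ℕ.* (o ℕ.* (2 ℕ.* D)) ℕ.+ N ℕ.* (o ℕ.* (2 ℕ.* D)) ℕ.+ o ℕ.* K ≡ o ℕ.* (N ℕ.* (2 ℕ.* D) ℕ.+ N ℕ.* (2 ℕ.* D) ℕ.+ K)
  distribute = solve-∀

-- The h^K choices of columns on either side contribute 2 · `badDegree` each, and the points
-- dependent on both sides contribute K.
chartConstant : ℕ → ℕ → ℕ → ℕ
chartConstant K h s = h ℕ.^ K ℕ.* (2 ℕ.* badDegree K s) ℕ.+ h ℕ.^ K ℕ.* (2 ℕ.* badDegree K s) ℕ.+ K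

-- An orthogonal sum of h hyperbolic planes with bases e_i, f_i, and an anisotropic vector
-- orthogonal to it.
record Frame (𝔽 : FiniteField) {d : ℕ} (form : Form 𝔽 d) (h : ℕ) : Set where
  open FiniteField 𝔽
  open FieldLemmas 𝔽
  open Form form
  field
    e f : Fin h → V d
    u   : V d
    ee  : ∀ i j → ⟨ e i , e j ⟩ ≡ 0#
    ff  : ∀ i j → ⟨ f i , f j ⟩ ≡ 0#
    ef  : ∀ i j → ⟨ e i , f j ⟩ ≡ δ i j
    eu  : ∀ i → ⟨ e i , u ⟩ ≡ 0#
    fu  : ∀ i → ⟨ f i , u ⟩ ≡ 0#
    uu  : ⟨ u , u ⟩ ≢ 0#

  δ-sym : ∀ (i j : Fin h) → δ i j ≡ δ j i
  δ-sym i j = by (i ≟Fin j)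
    where
    by : Dec (i ≡ j) → δ i j ≡ δ j i
    by (yes refl) = refl
    by (no n)     = trans (δ-off n) (sym (δ-off (n ∘ sym)))

  fe : ∀ i j → ⟨ f i , e j ⟩ ≡ δ i j
  fe i j = trans (form-sym _ _) (trans (ef j i) (δ-sym j i))

opposite : ∀ {𝔽 d form h} → Frame 𝔽 {d} form h → Frame 𝔽 form h
opposite r = record { e = f ; f = e ; u = u ; ee = ff ; ff = ee ; ef = fe ; eu = fu ; fu = eu ; uu = uu }
  where open Frame r

module Counting (𝔽 : FiniteField) (𝒞 : CurveTheory 𝔽) (d K K′ h : ℕ) (K≡ : K ≡ suc K′) (k₀ : Fin K) (1+h≡2K : suc h ≡ K ℕ.+ K) (form : Form 𝔽 d)
  (s : ℕ) (problem : Ambient.Problem 𝔽 𝒞 d K form s) where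
  open FiniteField 𝔽
  open FieldLemmas 𝔽
  open Elimination 𝔽
  open CurveTheory 𝒞
  open CurveLemmas 𝔽 𝒞
  open Form form
  open Ambient 𝔽 𝒞 d K form
  open Problem problem
  open Charts 𝔽 𝒞 d K form s problem
  open Escaping 𝔽 𝒞 d K h form
  open Slices 𝔽 𝒞 d K h 1+h≡2K form
  open Solver using (solve; _:=_; con; _:+_; _:*_; :-_; _:-_)

  private
    module FPt = Finite FPt
    module FMat = Finite FMat

  record Large : Set where
    field
      large-chart : 2 ℕ.* suc degBad ≤ units
      large-link  : degBad ℕ.+ degΔ K 1 < q
      large-cross : degBad ℕ.+ degΔ K degNum < q
      large-line  : s ℕ.* 1 ℕ.+ degΔ K 1 < q
      large-K     : K < units

  restrict : ∀ {h} → (Fin K → Fin h → F) → (Fin K → Fin h) → Mat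
  restrict b J i l = b i (J l)

  module Side (large : Large) (frame : Frame 𝔽 form h) where
    open Frame frame
    open Large large

    E : (Fin K → Fin h) → Fin K → V d
    E J l = e (J l)

    E-isotropic : ∀ J i j → ⟨ E J i , E J j ⟩ ≡ 0#
    E-isotropic J i j = ee (J i) (J j)

    Hit : (Fin K → Fin h) → Set
    Hit J = Σ Pt λ n → Ω n ≡ true × Bad n × Δ K (restrict (coordsIn e n) J) ≢ 0#

    zeroMat : Mat
    zeroMat _ _ = 0#

    form-comb-⊥ : ∀ {m} (c : V m) (v : Fin m → V d) w → (∀ l → ⟨ v l , w ⟩ ≡ 0#) → ⟨ comb c v , w ⟩ ≡ 0#
    form-comb-⊥ {m} c v w z = trans (form-combˡ c v w) (sum-0 m λ l → trans (*-congˡ (z l)) (zeroʳ _))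

    module From (J : Fin K → Fin h) (hit : Hit J) where
      x₀ = proj₁ hit
      x₀∈Ω = proj₁ (proj₂ hit)
      x₀-bad = proj₁ (proj₂ (proj₂ hit))
      x₀-chart = proj₂ (proj₂ (proj₂ hit))
      open Chart (E J) (E-isotropic J) public
      open Flow x₀ public
      open ChartAt (E J) (E-isotropic J) x₀ x₀∈Ω x₀-bad x₀-chart public

      Ω⇒inV : ∀ y → Ω y ≡ true → inV (y , zeroMat) ≡ true
      Ω⇒inV y = W-resp λ i j → solve 1 (λ g → g := g :+ con (pos 0) :+ con (pos 0)) refl _

      -- `y` may lie outside chart `J`. The products with the vectors of `J′` do not see the shift,
      -- so they can be followed on `zAt` alone, where they are generic at time 1 even if the curve
      -- in Ω has no point there.
      same-side : ∀ y J′ → Ω y ≡ true → Δ K (restrict (coordsIn e y) J′) ≢ 0# → Hit J′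
      same-side y J′ y∈Ω nz = pt (zAt y t) (MAt y zeroMat t) , proj₂ (proj₂ (proj₂ (proj₂ l))) , proj₁ (proj₂ (proj₂ (proj₂ l))) ,
          proj₁ (proj₂ (proj₂ l)) ∘ trans (Δ-cong K λ k m → sym (unmoved k m))
        where
        l = link y zeroMat (Ω⇒inV y y∈Ω) (λ t → Δ K (λ k m → ⟨ zAt y t k , e (J′ m) ⟩)) (Δ-curve K λ k m → coords-curve (e (J′ m)) y k)
              1# (nz ∘ trans (Δ-cong K λ k m → form-cong (λ a → sym (zAt-1 y refl k a)) (λ _ → refl))) large-link
        t = proj₁ l
        unmoved : ∀ k m → ⟨ pt (zAt y t) (MAt y zeroMat t) k , e (J′ m) ⟩ ≡ ⟨ zAt y t k , e (J′ m) ⟩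
        unmoved k m = trans (form-⊕ˡ _ _ _) (trans (+-congˡ (form-comb-⊥ _ _ _ λ l → ee (J l) (J′ m))) (+-identityʳ _))

      num-form : ∀ z M w → det z ≢ 0# → ∀ k → ⟨ num z M k , w ⟩ ≡ det z * ⟨ pt z M k , w ⟩
      num-form z M w nz k = trans (form-cong (λ a → sym (pt-num z M nz k a)) (λ _ → refl)) (form-·ˡ _ _ _)

      num-form-curve : ∀ z M w k → Curve degNum (λ t → ⟨ num (zAt z t) (MAt z M t) k , w ⟩)
      num-form-curve z M w k = curve-cong (λ t → sym (trans (form-⊕ˡ _ _ _) (cong₂ _+_ (form-·ˡ _ _ _) (form-combˡ (cramer K (coords (zAt z t)) (MAt z M t k)) (E J) w))))
        (curve-+ (curve-≤ (ℕP.m≤m+n _ _) (curve-* (det-curve z) (coords-curve w z k)))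
          (curve-≤ (ℕP.m≤n+m _ (degΔ K 1 ℕ.+ 1)) (curve-sum K λ l → curve-cong (λ t → *-comm _ _) (curve-scale ⟨ E J l , w ⟩
            (cramer-curve K {m = λ j t → MAt z M t k j} (λ k l → coords-curve (E J l) z k) (λ j → curve-+ (curve-≤ (s≤s z≤n) (curve-* curve-id (curve-const _)))
               (curve-scale ½ (curve-* (curve-* curve-id (curve-- (curve-≤ z≤n (curve-const 1#)) curve-id)) (curve-const _)))) l)))))

      det-num : ∀ (v : Fin K → V d) z M → det z ≢ 0# → Δ K (λ k m → ⟨ num z M k , v m ⟩) ≡ scale K (det z) * Δ K (λ k m → ⟨ pt z M k , v m ⟩)
      det-num v z M nz = trans (Δ-cong K λ k m → num-form z M (v m) nz k) (Δ-scale K (det z) _)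

      pt-0 : ∀ z {M} → det z ≢ 0# → (∀ i j → M i j ≡ 0#) → pt z M ≋ z
      pt-0 z {M} nz m i a = trans (+-congˡ (sum-0 K λ l → trans (*-congʳ (trans (*-congˡ
          (Δ-nonsingular K (coords z) _ nz (λ k → trans (cramer-solves K (coords z) (M i) k) (trans (*-congˡ (m i k)) (zeroʳ _))) l)) (zeroʳ _))) (zeroˡ _))) (+-identityʳ _)

      -- A point of Ω in the chart which is moreover generic for the family v is joined to x₀ by a curve; a generic point
      -- of that curve is bad and generic for v.
      other-side : ∀ y → Ω y ≡ true → Δ K (restrict (coordsIn e y) J) ≢ 0# → (v : Fin K → V d) → Δ K (λ k m → ⟨ y k , v m ⟩) ≢ 0# →
                   Σ Pt λ n → Ω n ≡ true × Bad n × Δ K (λ k m → ⟨ n k , v m ⟩) ≢ 0#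
      other-side y y∈Ω ny v nz = pt (zAt y t) (MAt y zeroMat t) , proj₂ (proj₂ (proj₂ (proj₂ l))) , proj₁ (proj₂ (proj₂ (proj₂ l))) ,
          *-≢0ʳ (proj₁ (proj₂ (proj₂ l)) ∘ trans (det-num v (zAt y t) (MAt y zeroMat t) (proj₁ (proj₂ l))))
        where
        det1 : det (zAt y 1#) ≢ 0#
        det1 = ny ∘ trans (det-cong λ i a → sym (zAt-1 y refl i a))
        at1 : pt (zAt y 1#) (MAt y zeroMat 1#) ≋ y
        at1 i a = trans (pt-0 (zAt y 1#) det1 (MAt-1 y zeroMat refl) i a) (zAt-1 y refl i a)
        l = link y zeroMat (Ω⇒inV y y∈Ω) (λ t → Δ K (λ k m → ⟨ num (zAt y t) (MAt y zeroMat t) k , v m ⟩))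
              (Δ-curve K λ k m → num-form-curve y zeroMat (v m) k) 1#
              (λ z → no-zero-divisors (scale-≢0 K det1) (λ z′ → nz (trans (Δ-cong K λ k m → form-cong (λ a → sym (at1 k a)) (λ _ → refl)) z′))
                       (trans (sym (det-num v (zAt y 1#) (MAt y zeroMat 1#) det1)) z)) large-cross
        t = proj₁ l

      module Mixed = SliceOf f e ee ef k₀

      crossOf : Pt → F
      crossOf n = sum h (λ m → ⟨ n k₀ , f m ⟩ * ⟨ n k₀ , e m ⟩)

      -- Moving along the e_m keeps the Gram matrix and all products with the e_m, hence also chart
      -- `J`, while a non-zero cross term allows the products with the f_m to become independent.
      -- Badness of the point so found is not known, and is supplied by `other-side`.
      from-cross : ∀ z → Ω z ≡ true → det z ≢ 0# → crossOf z ≢ 0# → Σ (Fin K → Fin h) λ J′ →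
                   Σ Pt λ n → Ω n ≡ true × Bad n × Δ K (restrict (coordsIn f n) J′) ≢ 0#
      from-cross z z∈Ω nz cz = J′ , other-side n (W-resp (λ i j → sym (Mixed.At.gram-slice z n∈ i j)) z∈Ω)
          (nz ∘ trans (Δ-cong K λ k l → sym (Mixed.At.y-slice z n∈ k (J l)))) (f ∘ J′) (proj₂ (proj₂ (proj₂ r)))
        where
        r = Mixed.At.escape-cross z large-K K′ K≡ cz
        n = proj₁ r
        n∈ = proj₁ (proj₂ r)
        J′ = proj₁ (proj₂ (proj₂ r))

      -- If the cross term of x₀ vanishes, it is changed by moving the first vector in the anisotropic direction u.
      module Perturb (ε : F) where
        z : Pt
        z i = x₀ i ⊕ (δ i k₀ * ε) · u

        -- Half of what the Gram matrix lost, so that `pt z M` has the Gram matrix of `x₀` again.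
        M : Mat
        M i j = ½ * (gram x₀ i j - gram z i j)

        z-⊥ : ∀ w → ⟨ u , w ⟩ ≡ 0# → ∀ k → ⟨ z k , w ⟩ ≡ ⟨ x₀ k , w ⟩
        z-⊥ w uw k = trans (form-⊕ˡ _ _ _) (trans (+-congˡ (trans (form-·ˡ _ _ _) (trans (*-congˡ uw) (zeroʳ _)))) (+-identityʳ _))

        z-e : ∀ m k → ⟨ z k , e m ⟩ ≡ ⟨ x₀ k , e m ⟩
        z-e m = z-⊥ (e m) (trans (form-sym _ _) (eu m))

        z-f : ∀ m k → ⟨ z k , f m ⟩ ≡ ⟨ x₀ k , f m ⟩
        z-f m = z-⊥ (f m) (trans (form-sym _ _) (fu m))

        det-z : det z ≢ 0#
        det-z = x₀-chart ∘ trans (Δ-cong K λ k l → sym (z-e (J l) k))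

        n : Pt
        n = pt z M

        n∈Ω : Ω n ≡ true
        n∈Ω = W-resp (λ i j → sym (trans (gram-pt z M det-z i j) (sum-half i j))) x₀∈Ω
          where
          sum-half : ∀ i j → gram z i j + M i j + M j i ≡ gram x₀ i j
          sum-half i j = trans (+-congˡ {gram z i j + M i j} (cong (½ *_) (cong₂ _-_ (gram-sym x₀ j i) (gram-sym z j i))))
            (trans (+-assoc (gram z i j) _ _) (trans (+-congˡ (half _)) (solve 2 (λ a b → a :+ (b :- a) := b) refl (gram z i j) (gram x₀ i j))))

        det-n : det n ≢ 0#
        det-n = det-z ∘ trans (Δ-cong K λ k l → sym (coords-pt z M k l))

        n-e : ∀ m → ⟨ n k₀ , e m ⟩ ≡ ⟨ x₀ k₀ , e m ⟩
        n-e m = trans (form-⊕ˡ _ _ _) (trans (cong₂ _+_ (z-e m k₀) (form-comb-⊥ _ _ _ λ l → ee (J l) m)) (+-identityʳ _))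

        n-f : ∀ m → ⟨ n k₀ , f m ⟩ ≡ ⟨ x₀ k₀ , f m ⟩ + sum K (λ l → shift z M k₀ l * δ (J l) m)
        n-f m = trans (form-⊕ˡ _ _ _) (cong₂ _+_ (z-f m k₀) (trans (form-combˡ (shift z M k₀) (E J) (f m)) (sum-cong K λ l → *-congˡ (ef (J l) m))))

        -- The vector u is orthogonal to the whole frame, so only the compensating shift is felt. It
        -- leaves the products with the e_m alone, and its contribution to the sum is its own
        -- product with row `k₀` of `z`, which `shift` made equal to `M k₀ k₀`.
        cross-n : crossOf n ≡ crossOf x₀ + M k₀ k₀
        cross-n = trans (sum-cong h λ m → trans (cong₂ _*_ (n-f m) (n-e m)) (distribʳ _ _ _)) (trans (sum-+ h _ _) (+-congˡ (begin
          sum h (λ m → sum K (λ l → Y l * δ (J l) m) * b m)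
            ≡⟨ sum-cong h (λ m → trans (*-comm _ _) (trans (sym (sum-* K (b m) _)) (sum-cong K λ l → solve 3 (λ b y d → b :* (y :* d) := y :* (b :* d)) refl _ _ _))) ⟩
          sum h (λ m → sum K (λ l → Y l * (b m * δ (J l) m))) ≡⟨ sum-swap h K _ ⟩
          sum K (λ l → sum h (λ m → Y l * (b m * δ (J l) m)))
            ≡⟨ sum-cong K (λ l → trans (sum-* h (Y l) _) (*-congˡ (trans (sum-cong h λ m → *-congˡ (δ-sym (J l) m)) (sum-δ h (J l) b)))) ⟩
          sum K (λ l → Y l * b (J l)) ≡⟨ sum-cong K (λ l → *-congˡ (trans (sym (z-e (J l) k₀)) (form-sym _ _))) ⟩
          sum K (λ l → Y l * ⟨ E J l , z k₀ ⟩) ≡⟨ form-combˡ Y (E J) (z k₀) ⟨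
          ⟨ comb Y (E J) , z k₀ ⟩ ≡⟨ shift-solves z M det-z k₀ k₀ ⟩
          M k₀ k₀ ∎)))
          where
          open ≡-Reasoning
          Y = shift z M k₀
          b : V h
          b m = ⟨ x₀ k₀ , e m ⟩

        gram-z : gram z k₀ k₀ ≡ gram x₀ k₀ k₀ + ε * (2# * ⟨ x₀ k₀ , u ⟩ + ε * ⟨ u , u ⟩)
        gram-z = trans (form-cong {x′ = x₀ k₀ ⊕ ε · u} {y′ = x₀ k₀ ⊕ ε · u} first first) (begin
          ⟨ x₀ k₀ ⊕ ε · u , x₀ k₀ ⊕ ε · u ⟩ ≡⟨ trans (form-⊕ˡ _ _ _) (cong₂ _+_ (form-⊕ʳ _ _ _) (form-⊕ʳ _ _ _)) ⟩
          (g + ⟨ x₀ k₀ , ε · u ⟩) + (⟨ ε · u , x₀ k₀ ⟩ + ⟨ ε · u , ε · u ⟩)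
            ≡⟨ cong₂ _+_ (+-congˡ (form-·ʳ _ _ _)) (cong₂ _+_ (trans (form-·ˡ _ _ _) (*-congˡ (form-sym _ _))) (trans (form-·ˡ _ _ _) (*-congˡ (form-·ʳ _ _ _)))) ⟩
          (g + ε * ⟨ x₀ k₀ , u ⟩) + (ε * ⟨ x₀ k₀ , u ⟩ + ε * (ε * ⟨ u , u ⟩))
            ≡⟨ solve 4 (λ g e x u → (g :+ e :* x) :+ (e :* x :+ e :* (e :* u)) := g :+ e :* ((con (pos 1) :+ con (pos 1)) :* x :+ e :* u)) refl g ε _ _ ⟩
          g + ε * (2# * ⟨ x₀ k₀ , u ⟩ + ε * ⟨ u , u ⟩) ∎)
          where
          open ≡-Reasoning
          g = gram x₀ k₀ k₀
          first : ∀ a → z k₀ a ≡ (x₀ k₀ ⊕ ε · u) a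
          first a = +-congˡ (*-congʳ (trans (*-congʳ (δ-refl k₀)) (*-identityˡ ε)))

        M-00 : M k₀ k₀ ≡ - (½ * (ε * (2# * ⟨ x₀ k₀ , u ⟩ + ε * ⟨ u , u ⟩)))
        M-00 = trans (*-congˡ (cong (λ w → gram x₀ k₀ k₀ - w) gram-z)) (solve 3 (λ h g w → h :* (g :- (g :+ w)) := :- (h :* w)) refl ½ _ _)

        crossed : crossOf x₀ ≡ 0# → ε ≢ 0# → 2# * ⟨ x₀ k₀ , u ⟩ + ε * ⟨ u , u ⟩ ≢ 0# → Σ (Fin K → Fin h) λ J′ →
                  Σ Pt λ n → Ω n ≡ true × Bad n × Δ K (restrict (coordsIn f n) J′) ≢ 0#
        crossed c0 nε nz = from-cross n n∈Ω det-n λ z → neg-≢0 (no-zero-divisors (inv-≢0 2≢0) (no-zero-divisors nε nz))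
          (trans (sym M-00) (trans (sym (+-identityˡ _)) (trans (+-congʳ (sym c0)) (trans (sym cross-n) z))))

      crossing : Σ (Fin K → Fin h) λ J′ → Σ Pt λ n → Ω n ≡ true × Bad n × Δ K (restrict (coordsIn f n) J′) ≢ 0#
      crossing = by-cross (crossOf x₀ ≟ 0#)
        where
        v = ⟨ x₀ k₀ , u ⟩
        w = ⟨ u , u ⟩
        -1≢0 : - 1# ≢ 0#
        -1≢0 = neg-≢0 (0≢1 ∘ sym)
        -- ε = 1 and ε = -1 cannot both fail: the expressions 2⟨x₀ k₀ , u⟩ ± ⟨u , u⟩ differ by 2⟨u ,
        -- u⟩.
        by-sign : crossOf x₀ ≡ 0# → Dec (2# * v + 1# * w ≡ 0#) → _
        by-sign c0 (no n)  = Perturb.crossed 1# c0 (0≢1 ∘ sym) n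
        by-sign c0 (yes p) = Perturb.crossed (- 1#) c0 -1≢0 λ m → no-zero-divisors 2≢0 uu
          (trans (solve 2 (λ v w → (con (pos 1) :+ con (pos 1)) :* w := ((con (pos 1) :+ con (pos 1)) :* v :+ con (pos 1) :* w) :- ((con (pos 1) :+ con (pos 1)) :* v :+ (:- con (pos 1)) :* w)) refl v w)
            (trans (cong₂ _-_ p m) (-‿inverseʳ 0#)))
        by-cross : Dec (crossOf x₀ ≡ 0#) → _
        by-cross (no n)   = from-cross x₀ x₀∈Ω x₀-chart n
        by-cross (yes c0) = by-sign c0 (2# * v + 1# * w ≟ 0#)

    FJ : Finite (Fin K → Fin h)
    FJ = functions (finFinite h) K

    generic : Pt → Bool
    generic n = G n ∧ not (isDependent (coordsIn e n))

    module _ (J₀ : Fin K → Fin h) (hit : Hit J₀) .{{_ : ℕ.NonZero FMat.size}} where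
      private
        inChart : (Pt × F) × (Fin K → Fin h) → Bool
        inChart ((n , t) , J) = (G n ∧ nonzero (Δ K (restrict (coordsIn e n) J))) ∧ nonzero t

        X : ℕ
        X = FPt.# Ω ℕ.* (2 ℕ.* degBad)

        -- If the chart contains a point of `G` at all, that point is a target for a curve from the
        -- known hit, and this curve brings a hit into the chart.
        in-one-chart : ∀ J → FPt.# (λ n → G n ∧ nonzero (Δ K (restrict (coordsIn e n) J))) ℕ.* units ≤ X
        in-one-chart J = by-search (search FPt P P-resp)
          where
          P : Pt → Bool
          P n = G n ∧ nonzero (Δ K (restrict (coordsIn e n) J))
          P-resp : FPt.Respects P
          P-resp {n} {m} e₁ t = ∧-intro (G-resp e₁ (proj₁ (∧-true {G n} t)))
            (true-nonzero (nonzero-true (proj₂ (∧-true {G n} t)) ∘ trans (Δ-cong K λ k l → form-cong (e₁ k) (λ _ → refl))))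
          by-search : (Σ Pt λ n → P n ≡ true) ⊎ (∀ n → P n ≡ false) → FPt.# P ℕ.* units ≤ X
          by-search (inj₁ (y , t)) = From.chart-bound J (From.same-side J₀ hit y J (G⊆Ω y (proj₁ (∧-true {G y} t))) (nonzero-true (proj₂ (∧-true {G y} t)))) large-chart
          by-search (inj₂ none) = ℕP.≤-trans (ℕP.*-monoˡ-≤ units (ℕP.≤-trans (#-mono FPt P (λ _ → false) λ n t → ⊥-elim (contradictory t (none n))) (ℕP.≤-reflexive zero-count))) z≤n
            where
            zero-count : FPt.# (λ _ → false) ≡ 0
            zero-count = go FPt.enum
              where
              go : ∀ xs → length (filterᵇ (λ (_ : Pt) → false) xs) ≡ 0
              go [] = refl
              go (x ∷ xs) = go xs

      -- An independent point lies in at least one chart, so the bounds for the charts add up.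
      -- Points are counted together with a non-zero scalar, which turns each of these bounds into a
      -- plain bound on the size of a fibre.
      generic-bound : FPt.# generic ℕ.* units ≤ h ℕ.^ K ℕ.* X
      generic-bound = ℕP.≤-trans (#-pairs-lower FPt finite generic (λ (n , t) → generic n ∧ nonzero t) units (λ n t → #-mono finite _ _ λ μ nz → ∧-intro t nz))
        (ℕP.≤-trans (ℕP.≤-reflexive (sym (ℕP.*-identityʳ _))) (ℕP.≤-trans
          (#-double FPF FJ (λ (n , t) → generic n ∧ nonzero t) (λ _ → true) inChart 1 X
            (λ { {J , n , t} {J′ , n′ , .t} (eJ , eₙ , refl) x → ∧-intro
               (let y = proj₁ (∧-true {G n ∧ nonzero (Δ K (restrict (coordsIn e n) J))} x) in
                ∧-intro (G-resp eₙ (proj₁ (∧-true {G n} y))) (true-nonzero (nonzero-true (proj₂ (∧-true {G n} y)) ∘ trans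
                  (Δ-cong K λ k l → trans (form-cong (eₙ k) (λ _ → refl)) (cong (coordsIn e n′ k) (eJ l))))))
               (proj₂ (∧-true {G n ∧ nonzero (Δ K (restrict (coordsIn e n) J))} x)) })
            (λ { (n , t) x → covered n t x })
            (λ J _ → ℕP.≤-trans (#-pairs-upper FPt finite (λ n → G n ∧ nonzero (Δ K (restrict (coordsIn e n) J))) _ units
                (λ n _ → #-mono finite _ nonzero λ t x → proj₂ (∧-true {G n ∧ nonzero (Δ K (restrict (coordsIn e n) J))} x))
                (λ n t x → proj₁ (∧-true {G n ∧ nonzero (Δ K (restrict (coordsIn e n) J))} x))) (in-one-chart J))
            (λ _ _ _ → refl))
          (ℕP.*-monoˡ-≤ X (ℕP.≤-trans (#≤size FJ _) (ℕP.≤-reflexive (trans (size-functions (finFinite h) K) (cong (ℕ._^ K) (size-fin h))))))))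
        where
        FPF : Finite (Pt × F)
        FPF = product FPt finite
        covered : ∀ n t → generic n ∧ nonzero t ≡ true → 1 ≤ Finite.# FJ (λ J → inChart ((n , t) , J))
        covered n t x = #-positive FJ (λ J → inChart ((n , t) , J))
          (λ {J} {J′} eJ y → ∧-intro (let y′ = proj₁ (∧-true {G n ∧ nonzero (Δ K (restrict (coordsIn e n) J))} y) in
             ∧-intro (proj₁ (∧-true {G n} y′)) (true-nonzero (nonzero-true (proj₂ (∧-true {G n} y′)) ∘ trans (Δ-cong K λ k l → cong (coordsIn e n k) (eJ l)))))
             (proj₂ (∧-true {G n ∧ nonzero (Δ K (restrict (coordsIn e n) J))} y)))
          (proj₁ ind) (∧-intro (∧-intro (proj₁ (∧-true {G n} g)) (true-nonzero (proj₂ ind))) (proj₂ (∧-true {generic n} x)))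
          where
          g = proj₁ (∧-true {generic n} x)
          ind = independent (coordsIn e n) (not-true (proj₂ (∧-true {G n} g)))

  module Final (large : Large) (frame : Frame 𝔽 form h) .{{_ : ℕ.NonZero FMat.size}} where
    open Frame frame
    open Large large
    private
      module L = Side large frame
      module R = Side large (opposite frame)
      module S = SliceOf e f ff fe k₀

    start : ∀ x₀ → Ω x₀ ≡ true → Bad x₀ → (Σ _ L.Hit) ⊎ (Σ _ R.Hit)
    start x₀ x₀∈Ω bad = by (independent-or-dependent (coordsIn e x₀)) (independent-or-dependent (coordsIn f x₀))
      where
      by : Independent (coordsIn e x₀) ⊎ Dependent (coordsIn e x₀) → Independent (coordsIn f x₀) ⊎ Dependent (coordsIn f x₀) → (Σ _ L.Hit) ⊎ (Σ _ R.Hit)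
      by (inj₁ (J , nz)) _ = inj₁ (J , x₀ , x₀∈Ω , bad , nz)
      by _ (inj₁ (J , nz)) = inj₂ (J , x₀ , x₀∈Ω , bad , nz)
      -- No chart contains `x₀`, so it is left along the straight line to an independent point of
      -- its slice. The constant Gram matrix keeps the line in Ω, and a generic point on it is bad
      -- and lies in a chart.
      by (inj₂ _) (inj₂ dep) = inj₁ (J , line t , W-resp (λ i j → sym (S.At.line x₀ t n∈ i j)) x₀∈Ω , bad-at , n∉ ∘ inj₂)
        where
        r = S.At.escape-dependent x₀ large-K dep
        n = proj₁ r
        n∈ = proj₁ (proj₂ r)
        J = proj₁ (proj₂ (proj₂ r))
        line : F → Pt
        line t i = x₀ i ⊕ t · (λ a → n i a - x₀ i a)
        at0 : ∀ i a → 1# * x₀ i a ≡ line 0# i a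
        at0 i a = solve 2 (λ x n → con (pos 1) :* x := x :+ con (pos 0) :* (n :- x)) refl (x₀ i a) (n i a)
        at1 : ∀ i a → line 1# i a ≡ n i a
        at1 i a = solve 2 (λ x n → x :+ con (pos 1) :* (n :- x) := n) refl (x₀ i a) (n i a)
        c = bad-curve (λ i a t → line t i a) (λ _ → 1#) (λ i a → curve-line _ _) (curve-≤ z≤n (curve-const 1#)) 0# x₀ (0≢1 ∘ sym) at0 bad
        gen-curve : Curve (degΔ K 1) (λ t → Δ K (λ k l → ⟨ line t k , e (J l) ⟩))
        gen-curve = Δ-curve K λ k l → curve-cong (λ t → sym (trans (form-⊕ˡ _ _ _) (+-congˡ (form-·ˡ t _ _)))) (curve-line _ _)
        picked = few-pick (few-∪ (proj₁ (proj₂ (proj₂ c))) (curve-few gen-curve 1#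
            (proj₂ (proj₂ (proj₂ r)) ∘ trans (Δ-cong K λ k l → form-cong (λ a → sym (at1 k a)) (λ _ → refl)))))
          (λ t → proj₁ (proj₂ c) t ⊎-dec (_ ≟ 0#)) large-line
        t = proj₁ picked
        n∉ = proj₂ picked
        bad-at : Bad (line t)
        bad-at = proj₂ (proj₂ (proj₂ c)) t (line t) (0≢1 ∘ sym) (λ i a → *-identityˡ _) (n∉ ∘ inj₁)

    both : ∀ x₀ → Ω x₀ ≡ true → Bad x₀ → (Σ _ L.Hit) × (Σ _ R.Hit)
    both x₀ x₀∈Ω bad = by (start x₀ x₀∈Ω bad)
      where
      by : (Σ _ L.Hit) ⊎ (Σ _ R.Hit) → (Σ _ L.Hit) × (Σ _ R.Hit)
      by (inj₁ (J , hit)) = (J , hit) , L.From.crossing J hit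
      by (inj₂ (J , hit)) = R.From.crossing J hit , (J , hit)

    constant : ℕ
    constant = chartConstant K h s

    main-bound : ∀ x₀ → Ω x₀ ≡ true → Bad x₀ → FPt.# G ℕ.* units ≤ FPt.# Ω ℕ.* constant
    main-bound x₀ x₀∈Ω bad = begin
      FPt.# G ℕ.* units ≤⟨ ℕP.*-monoˡ-≤ units cover ⟩
      (FPt.# L.generic ℕ.+ FPt.# R.generic ℕ.+ FPt.# rare) ℕ.* units
        ≡⟨ trans (ℕP.*-distribʳ-+ units (FPt.# L.generic ℕ.+ FPt.# R.generic) _) (cong (ℕ._+ FPt.# rare ℕ.* units) (ℕP.*-distribʳ-+ units (FPt.# L.generic) (FPt.# R.generic))) ⟩
      FPt.# L.generic ℕ.* units ℕ.+ FPt.# R.generic ℕ.* units ℕ.+ FPt.# rare ℕ.* units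
        ≤⟨ ℕP.+-mono-≤ (ℕP.+-mono-≤ (L.generic-bound (proj₁ (proj₁ hits)) (proj₂ (proj₁ hits))) (R.generic-bound (proj₁ (proj₂ hits)) (proj₂ (proj₂ hits)))) rare-bound ⟩
      h ℕ.^ K ℕ.* X ℕ.+ h ℕ.^ K ℕ.* X ℕ.+ FPt.# Ω ℕ.* K ≡⟨ distribute (FPt.# Ω) (h ℕ.^ K) degBad K ⟩
      FPt.# Ω ℕ.* constant ∎
      where
      open ℕP.≤-Reasoning
      X = FPt.# Ω ℕ.* (2 ℕ.* degBad)
      hits = both x₀ x₀∈Ω bad
      rare : Pt → Bool
      rare n = Ω n ∧ (isDependent (coordsIn e n) ∧ isDependent (coordsIn f n))
      rare-bound : FPt.# rare ℕ.* units ≤ FPt.# Ω ℕ.* K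
      rare-bound = S.doubly-dependent-bound Ω Ω-resp λ n k β t kb → W-resp (λ i j → sym (Moves.gram-add e f ff fe n _
        (Moves.apply-at e f ff fe (coordsIn f n) k β (LinearCounting.kernel-true 𝔽 (coordsIn f n) β kb)) i j)) t
      generic′ : Pt → Bool
      generic′ n = G n ∧ (not (isDependent (coordsIn e n)) ∨ not (isDependent (coordsIn f n)))
      cover : FPt.# G ≤ FPt.# L.generic ℕ.+ FPt.# R.generic ℕ.+ FPt.# rare
      cover = ℕP.≤-trans (#-∪ FPt G generic′ rare λ n g → split (isDependent (coordsIn e n)) (isDependent (coordsIn f n)) g (G⊆Ω n g))
        (ℕP.+-monoˡ-≤ _ (#-∪ FPt generic′ L.generic R.generic λ n t → split′ (G n) (isDependent (coordsIn e n)) (isDependent (coordsIn f n)) t))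
        where
        split : ∀ {g o} a b → g ≡ true → o ≡ true → g ∧ (not a ∨ not b) ≡ true ⊎ o ∧ (a ∧ b) ≡ true
        split true  true  refl refl = inj₂ refl
        split true  false refl refl = inj₁ refl
        split false _     refl refl = inj₁ refl
        split′ : ∀ g a b → g ∧ (not a ∨ not b) ≡ true → g ∧ not a ≡ true ⊎ g ∧ not b ≡ true
        split′ true true  b t = inj₂ t
        split′ true false b t = inj₁ refl

-- Orthogonal families and hyperbolic frames.

twice : ℕ → ℕ
twice zero    = zero
twice (suc h) = suc (suc (twice h))

module Orthogonal (𝔽 : FiniteField) (d : ℕ) (form : Form 𝔽 d) where
  open FiniteField 𝔽
  open FieldLemmas 𝔽
  open Form form
  open LinearCounting 𝔽
  open Units 𝔽
  open Solver using (solve; _:=_; con; _:+_; _:*_; :-_; _:-_)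

  module Quadratic (a b : F) (b≢0 : b ≢ 0#) where
    φ : F → F
    φ x = a + b * (x * x)

    hit : F → F → Bool
    hit v x = does (φ x ≟ v)

    Image : F → Bool
    Image v = not (does (Finite.# finite (hit v) ℕ.≟ 0))

    image-intro : ∀ v x → φ x ≡ v → Image v ≡ true
    image-intro v x e = go (Finite.# finite (hit v) ℕ.≟ 0)
      where
      go : (c : Dec (Finite.# finite (hit v) ≡ 0)) → not (does c) ≡ true
      go (yes z) = ⊥-elim (ℕP.1+n≰n (subst (1 ≤_) z (#-positive finite (hit v) (λ { refl t → t }) x (does-true (φ x ≟ v) e))))
      go (no _)  = refl

    image-elim : ∀ v → Image v ≡ true → Σ F λ x → φ x ≡ v
    image-elim v t = go (search finite (hit v) (λ { refl t → t }))
      where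
      go : (Σ F λ x → hit v x ≡ true) ⊎ (∀ x → hit v x ≡ false) → Σ F λ x → φ x ≡ v
      go (inj₁ (x , e)) = x , true-does (φ x ≟ v) e
      go (inj₂ none) = ⊥-elim (empty (Finite.# finite (hit v) ℕ.≟ 0) t)
        where
        count0 : Finite.# finite (hit v) ≡ 0
        count0 = count elements
          where
          count : ∀ xs → length (filterᵇ (hit v) xs) ≡ 0
          count [] = refl
          count (x ∷ xs) rewrite none x = count xs
        empty : (c : Dec (Finite.# finite (hit v) ≡ 0)) → not (does c) ≡ true → ⊥
        empty (no n) _ = n count0

    square-roots : ∀ {x y} → φ x ≡ φ y → x ≡ y ⊎ x ≡ - y
    square-roots {x} {y} e = by (x - y ≟ 0#) (x + y ≟ 0#)
      where
      product-zero : (x - y) * (x + y) ≡ 0#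
      product-zero = *-cancelˡ b≢0 (trans (solve 4 (λ a b x y → b :* ((x :- y) :* (x :+ y)) := (a :+ b :* (x :* x)) :- (a :+ b :* (y :* y))) refl a b x y)
        (trans (cong (_- φ y) e) (trans (-‿inverseʳ _) (sym (zeroʳ b)))))
      by : Dec (x - y ≡ 0#) → Dec (x + y ≡ 0#) → x ≡ y ⊎ x ≡ - y
      by (yes z) _ = inj₁ (-≡0 z)
      by _ (yes z) = inj₂ (trans (solve 2 (λ x y → x := x :+ y :- y) refl x y) (trans (+-congʳ z) (+-identityˡ _)))
      by (no m) (no n) = ⊥-elim (no-zero-divisors m n product-zero)

    proper : F → Bool
    proper v = Image v ∧ not (does (v ≟ a))

    -- The q - 1 non-zero arguments produce values different from `a`, each at most twice; the value
    -- `a` itself is attained at 0.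
    image-size : suc q ≤ 2 ℕ.* Finite.# finite Image
    image-size = begin
      suc q ≤⟨ s≤s q≤1+units ⟩
      2 ℕ.+ units ≡⟨ cong (2 ℕ.+_) (ℕP.*-identityʳ units) ⟨
      2 ℕ.+ units ℕ.* 1 ≤⟨ ℕP.+-monoʳ-≤ 2 (#-double finite finite nonzero proper (λ (x , v) → nonzero x ∧ hit v x) 1 2
          (λ { (refl , refl) t → t })
          (λ x nz → #-positive finite _ (λ { refl t → t }) (φ x) (∧-intro nz (does-true (φ x ≟ φ x) refl)))
          (λ v _ → fibre v)
          (λ x v t → ∧-intro (image-intro v x (true-does (φ x ≟ v) (proj₂ (∧-true {nonzero x} t))))
            (not-a x v (proj₁ (∧-true {nonzero x} t)) (true-does (φ x ≟ v) (proj₂ (∧-true {nonzero x} t)))))) ⟩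
      2 ℕ.+ Finite.# finite proper ℕ.* 2 ≡⟨ cong (2 ℕ.+_) (ℕP.*-comm (Finite.# finite proper) 2) ⟩
      2 ℕ.+ 2 ℕ.* Finite.# finite proper ≡⟨ ℕP.*-distribˡ-+ 2 1 (Finite.# finite proper) ⟨
      2 ℕ.* suc (Finite.# finite proper) ≤⟨ ℕP.*-monoʳ-≤ 2 (list≤# finite finite (a ∷ filterᵇ proper elements) (λ v → Image v ≡ true) Image (λ v → v)
          (image-intro a 0# (solve 2 (λ a b → a :+ b :* (con (pos 0) :* con (pos 0)) := a) refl a b) ∷ All.map (λ {v} t → proj₁ (∧-true {Image v} t)) (filterᵇ-all proper elements))
          (All.map (λ {v} t e → distinct v (proj₂ (∧-true {Image v} t)) e) (filterᵇ-all proper elements) ∷ filterᵇ-AllPairs proper unique)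
          (λ { refl t → t }) (λ _ t → t) (λ _ _ _ _ e → e)) ⟩
      2 ℕ.* Finite.# finite Image ∎
      where
      open ℕP.≤-Reasoning
      distinct : ∀ v → not (does (v ≟ a)) ≡ true → a ≢ v
      distinct v t refl = contradictory (does-true (a ≟ a) refl) (not-true t)
      not-a : ∀ x v → nonzero x ≡ true → φ x ≡ v → not (does (v ≟ a)) ≡ true
      not-a x v nz e = go (v ≟ a)
        where
        go : (c : Dec (v ≡ a)) → not (does c) ≡ true
        go (no _) = refl
        go (yes e′) = ⊥-elim (no-zero-divisors b≢0 (no-zero-divisors (nonzero-true nz) (nonzero-true nz))
          (trans (solve 2 (λ a w → w := (a :+ w) :- a) refl a _) (trans (cong (_- a) (trans e e′)) (-‿inverseʳ a))))
      fibre : ∀ v → Finite.# finite (λ x → nonzero x ∧ hit v x) ≤ 2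
      fibre v = bound (filterᵇ-all (λ x → nonzero x ∧ hit v x) elements) (filterᵇ-AllPairs (λ x → nonzero x ∧ hit v x) unique)
        where
        φ≡ : ∀ x → nonzero x ∧ hit v x ≡ true → φ x ≡ v
        φ≡ x t = true-does (φ x ≟ v) (proj₂ (∧-true {nonzero x} t))
        bound : ∀ {xs} → All (λ x → nonzero x ∧ hit v x ≡ true) xs → AllPairs.AllPairs _≢_ xs → length xs ≤ 2
        bound {[]} _ _ = z≤n
        bound {x ∷ xs} (t ∷ ts) u = length-inject _≡_ (x ∷ xs) (x ∷ (- x) ∷ [])
          (here refl ∷ All.map (λ {y} t′ → choose (square-roots (trans (φ≡ y t′) (sym (φ≡ x t))))) ts)
          (AllPairs.map (λ n y e e′ → n (trans e (sym e′))) u)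
          where
          choose : ∀ {y} → y ≡ x ⊎ y ≡ - x → Any (y ≡_) (x ∷ (- x) ∷ [])
          choose (inj₁ e) = here e
          choose (inj₂ e) = there (here e)

  -- Two sets of (q + 1)/2 values must meet.
  binary-represents : ∀ a b c → a ≢ 0# → b ≢ 0# → Σ F λ x → Σ F λ y → a * (x * x) + b * (y * y) ≡ c
  binary-represents a b c a≢0 b≢0 = finish (#-escape finite (not ∘ P.Image) R.Image (ℕP.*-cancelˡ-< 2 _ _ (begin-strict
      2 ℕ.* Finite.# finite (not ∘ P.Image) <⟨ ℕP.+-cancelˡ-< (2 ℕ.* Finite.# finite P.Image) _ _ (begin-strict
          2 ℕ.* Finite.# finite P.Image ℕ.+ 2 ℕ.* Finite.# finite (not ∘ P.Image) ≡⟨ ℕP.*-distribˡ-+ 2 (Finite.# finite P.Image) _ ⟨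
          2 ℕ.* (Finite.# finite P.Image ℕ.+ Finite.# finite (not ∘ P.Image)) ≡⟨ cong (2 ℕ.*_) (#-complement finite P.Image) ⟩
          2 ℕ.* q ≡⟨ cong (q ℕ.+_) (ℕP.+-identityʳ q) ⟩
          q ℕ.+ q <⟨ ℕP.+-mono-< P.image-size R.image-size ⟩
          2 ℕ.* Finite.# finite P.Image ℕ.+ 2 ℕ.* Finite.# finite R.Image ∎) ⟩
      2 ℕ.* Finite.# finite R.Image ∎)))
    where
    open ℕP.≤-Reasoning
    module P = Quadratic 0# a a≢0
    module R = Quadratic c (- b) (neg-≢0 b≢0)
    not-false : ∀ {b} → not b ≡ false → b ≡ true
    not-false {true} _ = refl
    finish : (Σ F λ v → R.Image v ≡ true × not (P.Image v) ≡ false) → Σ F λ x → Σ F λ y → a * (x * x) + b * (y * y) ≡ c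
    finish (v , r , p) = proj₁ px , proj₁ ry , trans (solve 4 (λ a x b y → a :* (x :* x) :+ b :* (y :* y) := con (pos 0) :+ a :* (x :* x) :+ b :* (y :* y)) refl a _ b _)
        (trans (cong (_+ b * (proj₁ ry * proj₁ ry)) (trans (proj₂ px) (sym (proj₂ ry)))) (solve 3 (λ c b y → c :+ (:- b) :* (y :* y) :+ b :* (y :* y) := c) refl c b (proj₁ ry)))
      where
      px = P.image-elim v (not-false p)
      ry = R.image-elim v r

  record OrthogonalFamily (n : ℕ) : Set where
    field
      v    : Fin n → V d
      orth : ∀ i j → i ≢ j → ⟨ v i , v j ⟩ ≡ 0#
      anis : ∀ i → ⟨ v i , v i ⟩ ≢ 0#

  -- Let a x² + b y² = -c. Then e = x v₁ + y v₂ + v₃ is isotropic with ⟨e , v₃⟩ = c, and (v₃ -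
  -- e/2)/c is an isotropic vector dual to it; these coefficients are written out in `f₀`. The
  -- vector b y v₁ - a x v₂ is orthogonal to both and has norm -abc.
  module Hyperbolic (v₁ v₂ v₃ : V d) (o₁₂ : ⟨ v₁ , v₂ ⟩ ≡ 0#) (o₁₃ : ⟨ v₁ , v₃ ⟩ ≡ 0#) (o₂₃ : ⟨ v₂ , v₃ ⟩ ≡ 0#)
    (n₁ : ⟨ v₁ , v₁ ⟩ ≢ 0#) (n₂ : ⟨ v₂ , v₂ ⟩ ≢ 0#) (n₃ : ⟨ v₃ , v₃ ⟩ ≢ 0#) where
    private
      a = ⟨ v₁ , v₁ ⟩
      b = ⟨ v₂ , v₂ ⟩
      c = ⟨ v₃ , v₃ ⟩
      rep = binary-represents a b (- c) n₁ n₂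
      x = proj₁ rep
      y = proj₁ (proj₂ rep)
      rep-eq : a * (x * x) + b * (y * y) ≡ - c
      rep-eq = proj₂ (proj₂ rep)

    lin : F → F → F → V d
    lin α β γ = (α · v₁ ⊕ β · v₂) ⊕ γ · v₃

    lin-ˡ : ∀ α β γ z → ⟨ lin α β γ , z ⟩ ≡ α * ⟨ v₁ , z ⟩ + β * ⟨ v₂ , z ⟩ + γ * ⟨ v₃ , z ⟩
    lin-ˡ α β γ z = trans (form-⊕ˡ _ _ _) (cong₂ _+_ (trans (form-⊕ˡ _ _ _) (cong₂ _+_ (form-·ˡ _ _ _) (form-·ˡ _ _ _))) (form-·ˡ _ _ _))

    lin-⊥ : ∀ α β γ z → ⟨ v₁ , z ⟩ ≡ 0# → ⟨ v₂ , z ⟩ ≡ 0# → ⟨ v₃ , z ⟩ ≡ 0# → ⟨ lin α β γ , z ⟩ ≡ 0#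
    lin-⊥ α β γ z z₁ z₂ z₃ = trans (lin-ˡ α β γ z) (trans (cong₂ _+_ (cong₂ _+_ (*-congˡ z₁) (*-congˡ z₂)) (*-congˡ z₃))
      (solve 3 (λ α β γ → α :* con (pos 0) :+ β :* con (pos 0) :+ γ :* con (pos 0) := con (pos 0)) refl α β γ))

    lin-lin : ∀ α β γ α′ β′ γ′ → ⟨ lin α β γ , lin α′ β′ γ′ ⟩ ≡ α * (α′ * a) + β * (β′ * b) + γ * (γ′ * c)
    lin-lin α β γ α′ β′ γ′ = trans (lin-ˡ α β γ _) (cong₂ _+_ (cong₂ _+_ (*-congˡ r₁) (*-congˡ r₂)) (*-congˡ r₃))
      where
      flip : ∀ z → ⟨ z , lin α′ β′ γ′ ⟩ ≡ α′ * ⟨ v₁ , z ⟩ + β′ * ⟨ v₂ , z ⟩ + γ′ * ⟨ v₃ , z ⟩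
      flip z = trans (form-sym z _) (lin-ˡ α′ β′ γ′ z)
      r₁ : ⟨ v₁ , lin α′ β′ γ′ ⟩ ≡ α′ * a
      r₁ = trans (flip v₁) (trans (cong₂ (λ s t → α′ * a + β′ * s + γ′ * t) (trans (form-sym _ _) o₁₂) (trans (form-sym _ _) o₁₃))
        (solve 3 (λ w β γ → w :+ β :* con (pos 0) :+ γ :* con (pos 0) := w) refl _ β′ γ′))
      r₂ : ⟨ v₂ , lin α′ β′ γ′ ⟩ ≡ β′ * b
      r₂ = trans (flip v₂) (trans (cong₂ (λ s t → α′ * s + β′ * b + γ′ * t) o₁₂ (trans (form-sym _ _) o₂₃))
        (solve 3 (λ w α γ → α :* con (pos 0) :+ w :+ γ :* con (pos 0) := w) refl _ α′ γ′))
      r₃ : ⟨ v₃ , lin α′ β′ γ′ ⟩ ≡ γ′ * c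
      r₃ = trans (flip v₃) (trans (cong₂ (λ s t → α′ * s + β′ * t + γ′ * c) o₁₃ o₂₃)
        (solve 3 (λ w α β → α :* con (pos 0) :+ β :* con (pos 0) :+ w := w) refl _ α′ β′))

    private
      ic = inv c
      e₀ f₀ w : V d
      e₀ = lin x y 1#
      f₀ = lin (- (½ * (x * ic))) (- (½ * (y * ic))) (ic - ½ * ic)
      w  = lin (b * y) (- (a * x)) 0#

    e f u : V d
    e = e₀
    f = f₀
    u = w

    ee : ⟨ e , e ⟩ ≡ 0#
    ee = trans (lin-lin x y 1# x y 1#) (trans (solve 5 (λ x y a b c → x :* (x :* a) :+ y :* (y :* b) :+ con (pos 1) :* (con (pos 1) :* c) := (a :* (x :* x) :+ b :* (y :* y)) :+ c) refl x y a b c)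
      (trans (+-congʳ rep-eq) (-‿inverseˡ c)))

    ef : ⟨ e , f ⟩ ≡ 1#
    ef = trans (lin-lin x y 1# _ _ _) (trans
      (solve 7 (λ x y a b c i h → x :* ((:- (h :* (x :* i))) :* a) :+ y :* ((:- (h :* (y :* i))) :* b) :+ con (pos 1) :* ((i :- h :* i) :* c)
           := (c :* i) :- (h :* i) :* ((a :* (x :* x) :+ b :* (y :* y)) :+ c)) refl x y a b c ic ½)
      (trans (cong₂ (λ s t → s - ½ * ic * t) (*-inv n₃) (trans (+-congʳ rep-eq) (-‿inverseˡ c)))
        (solve 1 (λ z → con (pos 1) :- z :* con (pos 0) := con (pos 1)) refl _)))

    ff : ⟨ f , f ⟩ ≡ 0#
    ff = trans (lin-lin _ _ _ _ _ _) (trans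
      (solve 7 (λ x y a b c i h → (:- (h :* (x :* i))) :* ((:- (h :* (x :* i))) :* a) :+ (:- (h :* (y :* i))) :* ((:- (h :* (y :* i))) :* b) :+ (i :- h :* i) :* ((i :- h :* i) :* c)
           := (h :* i) :* (h :* i) :* ((a :* (x :* x) :+ b :* (y :* y)) :+ c) :+ (i :* i :* c) :* (con (pos 1) :- (h :* con (pos 1) :+ h :* con (pos 1)))) refl x y a b c ic ½)
      (trans (cong₂ (λ s t → ½ * ic * (½ * ic) * s + ic * ic * c * (1# - t)) (trans (+-congʳ rep-eq) (-‿inverseˡ c)) (half 1#))
        (solve 2 (λ s t → s :* con (pos 0) :+ t :* (con (pos 1) :- con (pos 1)) := con (pos 0)) refl _ _)))

    eu : ⟨ e , u ⟩ ≡ 0#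
    eu = trans (lin-lin _ _ _ _ _ _) (solve 5 (λ x y a b c → x :* ((b :* y) :* a) :+ y :* ((:- (a :* x)) :* b) :+ con (pos 1) :* (con (pos 0) :* c) := con (pos 0)) refl x y a b c)

    fu : ⟨ f , u ⟩ ≡ 0#
    fu = trans (lin-lin _ _ _ _ _ _) (solve 7 (λ x y a b c i h → (:- (h :* (x :* i))) :* ((b :* y) :* a) :+ (:- (h :* (y :* i))) :* ((:- (a :* x)) :* b) :+ (i :- h :* i) :* (con (pos 0) :* c) := con (pos 0)) refl x y a b c ic ½)

    uu : ⟨ u , u ⟩ ≢ 0#
    uu z = no-zero-divisors (no-zero-divisors n₁ n₂) (neg-≢0 n₃) (trans (sym (trans (lin-lin _ _ _ _ _ _)
      (trans (solve 5 (λ x y a b c → (b :* y) :* ((b :* y) :* a) :+ (:- (a :* x)) :* ((:- (a :* x)) :* b) :+ con (pos 0) :* (con (pos 0) :* c) := (a :* b) :* (a :* (x :* x) :+ b :* (y :* y))) refl x y a b c)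
        (*-congˡ rep-eq)))) z)

  -- A substitute for membership in the span: inheriting orthogonality is all that is needed to join
  -- a new hyperbolic pair to a frame.
  Spanned : ∀ {n h} → (Fin n → V d) → Frame 𝔽 form h → Set
  Spanned v frame = ∀ z → (∀ i → ⟨ v i , z ⟩ ≡ 0#) → (∀ i → ⟨ Frame.e frame i , z ⟩ ≡ 0#) × (∀ i → ⟨ Frame.f frame i , z ⟩ ≡ 0#) × ⟨ Frame.u frame , z ⟩ ≡ 0#

  -- Three vectors are traded for a hyperbolic pair and the anisotropic vector `H.u`, which joins
  -- the remaining ones. Each pair thus costs two vectors, and one is left over at the end.
  frame-from : ∀ h (w : OrthogonalFamily (suc (twice h))) → Σ (Frame 𝔽 form h) (Spanned (OrthogonalFamily.v w))
  frame-from zero w = record { e = λ () ; f = λ () ; u = v Fin.zero ; ee = λ () ; ff = λ () ; ef = λ () ; eu = λ () ; fu = λ () ; uu = anis Fin.zero }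
      , λ z ⊥ → (λ ()) , (λ ()) , ⊥ Fin.zero
    where open OrthogonalFamily w
  frame-from (suc h) w = record
      { e = cons H.e R.e ; f = cons H.f R.f ; u = R.u
      ; ee = λ { Fin.zero Fin.zero → H.ee ; Fin.zero (Fin.suc j) → trans (form-sym _ _) (proj₁ e⊥ j) ; (Fin.suc i) Fin.zero → proj₁ e⊥ i ; (Fin.suc i) (Fin.suc j) → R.ee i j }
      ; ff = λ { Fin.zero Fin.zero → H.ff ; Fin.zero (Fin.suc j) → trans (form-sym _ _) (proj₁ (proj₂ f⊥) j) ; (Fin.suc i) Fin.zero → proj₁ (proj₂ f⊥) i ; (Fin.suc i) (Fin.suc j) → R.ff i j }
      ; ef = λ { Fin.zero Fin.zero → trans H.ef (sym (δ-refl {suc h} Fin.zero)) ; Fin.zero (Fin.suc j) → trans (form-sym _ _) (trans (proj₁ (proj₂ e⊥) j) (sym (δ-off {suc h} {Fin.zero} {Fin.suc j} λ ())))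
               ; (Fin.suc i) Fin.zero → trans (proj₁ f⊥ i) (sym (δ-off {suc h} {Fin.suc i} {Fin.zero} λ ())) ; (Fin.suc i) (Fin.suc j) → trans (R.ef i j) (δ-suc i j) }
      ; eu = λ { Fin.zero → trans (form-sym _ _) (proj₂ (proj₂ e⊥)) ; (Fin.suc i) → R.eu i }
      ; fu = λ { Fin.zero → trans (form-sym _ _) (proj₂ (proj₂ f⊥)) ; (Fin.suc i) → R.fu i }
      ; uu = R.uu }
    , λ z ⊥ → let ⊥₁ = ⊥ Fin.zero ; ⊥₂ = ⊥ (Fin.suc Fin.zero) ; ⊥₃ = ⊥ (Fin.suc (Fin.suc Fin.zero))
                  r = proj₂ rest z λ { Fin.zero → H.lin-⊥ _ _ _ z ⊥₁ ⊥₂ ⊥₃ ; (Fin.suc i) → ⊥ (Fin.suc (Fin.suc (Fin.suc i))) } in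
        (λ { Fin.zero → H.lin-⊥ _ _ _ z ⊥₁ ⊥₂ ⊥₃ ; (Fin.suc i) → proj₁ r i })
      , (λ { Fin.zero → H.lin-⊥ _ _ _ z ⊥₁ ⊥₂ ⊥₃ ; (Fin.suc i) → proj₁ (proj₂ r) i })
      , proj₂ (proj₂ r)
    where
    open OrthogonalFamily w
    i₁ i₂ i₃ : Fin (suc (twice (suc h)))
    i₁ = Fin.zero
    i₂ = Fin.suc Fin.zero
    i₃ = Fin.suc (Fin.suc Fin.zero)
    module H = Hyperbolic (v i₁) (v i₂) (v i₃) (orth i₁ i₂ λ ()) (orth i₁ i₃ λ ()) (orth i₂ i₃ λ ()) (anis i₁) (anis i₂) (anis i₃)
    later : Fin (twice h) → V d
    later i = v (Fin.suc (Fin.suc (Fin.suc i)))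
    later-⊥ : ∀ i α β γ → ⟨ H.lin α β γ , later i ⟩ ≡ 0#
    later-⊥ i α β γ = H.lin-⊥ α β γ (later i) (orth _ _ λ ()) (orth _ _ λ ()) (orth _ _ λ ())
    w′ : OrthogonalFamily (suc (twice h))
    w′ = record
      { v = cons H.u later
      ; orth = λ { Fin.zero Fin.zero n → ⊥-elim (n refl) ; Fin.zero (Fin.suc j) _ → later-⊥ j _ _ _
                 ; (Fin.suc i) Fin.zero _ → trans (form-sym _ _) (later-⊥ i _ _ _)
                 ; (Fin.suc i) (Fin.suc j) n → orth _ _ λ { refl → n refl } }
      ; anis = λ { Fin.zero → H.uu ; (Fin.suc i) → anis _ } }
    rest = frame-from h w′
    module R = Frame (proj₁ rest)
    e⊥ = proj₂ rest H.e λ { Fin.zero → trans (form-sym _ _) H.eu ; (Fin.suc i) → trans (form-sym _ _) (later-⊥ i _ _ _) }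
    f⊥ = proj₂ rest H.f λ { Fin.zero → trans (form-sym _ _) H.fu ; (Fin.suc i) → trans (form-sym _ _) (later-⊥ i _ _ _) }
    δ-suc : ∀ (i j : Fin h) → δ i j ≡ δ (Fin.suc i) (Fin.suc j)
    δ-suc i j = by (i ≟Fin j)
      where
      by : Dec (i ≡ j) → δ i j ≡ δ (Fin.suc i) (Fin.suc j)
      by (yes refl) = trans (δ-refl i) (sym (δ-refl (Fin.suc i)))
      by (no n)     = trans (δ-off n) (sym (δ-off {i = Fin.suc i} {Fin.suc j} λ { refl → n refl }))

  module _ (nondegenerate : ∀ x → (∀ y → ⟨ x , y ⟩ ≡ 0#) → ∀ a → x a ≡ 0#) where

    basis : Fin d → V d
    basis a b = δ a b

    expand : ∀ x z → ⟨ z , x ⟩ ≡ sum d (λ a → ⟨ z , basis a ⟩ * x a)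
    expand x z = trans (form-cong (λ _ → refl) (λ b → sym (trans (sum-cong d λ a → refl) (sum-δ d b x))))
      (trans (form-combʳ x basis z) (sum-cong d λ a → *-comm _ _))

    partner : ∀ x → ¬ (∀ a → x a ≡ 0#) → Σ (V d) λ y → ⟨ x , y ⟩ ≢ 0#
    partner x x≢0 = go (any? λ a → ¬? (⟨ x , basis a ⟩ ≟ 0#))
      where
      go : Dec (Σ (Fin d) λ a → ⟨ x , basis a ⟩ ≢ 0#) → Σ (V d) λ y → ⟨ x , y ⟩ ≢ 0#
      go (yes (a , n)) = basis a , n
      go (no none) = ⊥-elim (x≢0 (nondegenerate x λ y → trans (expand y x) (sum-0 d λ a →
        trans (*-congʳ (decidable-stable (_ ≟ _) λ n → none (a , n))) (zeroˡ _))))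

    -- Counting a kernel gives x ≠ 0 orthogonal to the family; non-degeneracy gives y with ⟨x , y⟩ ≠
    -- 0, which is projected to y′ orthogonal to the family. If x and y′ are both isotropic, their
    -- sum has norm 2⟨x , y′⟩ ≠ 0.
    extend : ∀ {n} → n < d → OrthogonalFamily n → OrthogonalFamily (suc n)
    extend {n} n<d w = finish (⟨ x , x ⟩ ≟ 0#) (⟨ y′ , y′ ⟩ ≟ 0#)
      where
      open OrthogonalFamily w
      module FVd = Finite (FV d)
      M : Fin n → Fin d → F
      M i a = ⟨ v i , basis a ⟩
      zero? : V d → Bool
      zero? x = does (zeroV? x)
      instance
        q≢0 : ℕ.NonZero q
        q≢0 = ℕ.>-nonZero (∈-length (complete 0#))
      1<q : 1 < q
      1<q = length-inject _≡_ (0# ∷ 1# ∷ []) elements (complete 0# ∷ complete 1# ∷ []) (((λ { y refl e′ → 0≢1 (sym e′) }) ∷ []) ∷ ([] ∷ []))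
      one-zero : FVd.# zero? ≤ 1
      one-zero = length-inject (λ x y → ∀ a → x a ≡ y a) _ (0V ∷ []) (All.map (λ {x} t → here (true-does (zeroV? x) t)) (filterᵇ-all zero? FVd.enum))
        (AllPairs.map (λ ne y e e′ → ne λ a → trans (e a) (sym (e′ a))) (filterᵇ-AllPairs zero? FVd.unique))
      many : FVd.# zero? < FVd.# (kernel M)
      many = ℕP.≤-<-trans one-zero (ℕP.<-≤-trans 1<q (ℕP.*-cancelˡ-≤ (q ℕ.^ n) {{ℕP.m^n≢0 q n}} (begin
        q ℕ.^ n ℕ.* q ≡⟨ ℕP.*-comm _ q ⟩
        q ℕ.^ suc n ≤⟨ ℕP.^-monoʳ-≤ q n<d ⟩
        q ℕ.^ d ≤⟨ kernel-size M (λ _ → true) (λ _ _ → refl) (λ _ → refl) ⟩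
        Finite.# (FV n) (λ _ → true) ℕ.* FVd.# (kernel M) ≤⟨ ℕP.*-monoˡ-≤ _ (ℕP.≤-trans (#≤size (FV n) _) (ℕP.≤-reflexive (size-functions finite n))) ⟩
        q ℕ.^ n ℕ.* FVd.# (kernel M) ∎)))
        where open ℕP.≤-Reasoning
      found = #-escape (FV d) zero? (kernel M) many
      x = proj₁ found
      x≢0 : ¬ (∀ a → x a ≡ 0#)
      x≢0 z = contradictory (does-true (zeroV? x) z) (proj₂ (proj₂ found))
      v⊥x : ∀ i → ⟨ v i , x ⟩ ≡ 0#
      v⊥x i = trans (expand x (v i)) (kernel-true M x (proj₁ (proj₂ found)) i)
      y = proj₁ (partner x x≢0)
      x·y = proj₂ (partner x x≢0)
      c : V n
      c i = - (⟨ y , v i ⟩ * inv ⟨ v i , v i ⟩)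
      y′ : V d
      y′ = y ⊕ comb c v
      v⊥y′ : ∀ j → ⟨ v j , y′ ⟩ ≡ 0#
      v⊥y′ j = trans (form-⊕ʳ _ _ _) (trans (cong₂ _+_ (form-sym _ _) (trans (form-combʳ c v (v j))
          (sum-single n j {λ l → c l * ⟨ v j , v l ⟩} λ i ne → trans (*-congˡ (orth j i (ne ∘ sym))) (zeroʳ _))))
        (trans (solve 3 (λ p i w → p :+ (:- (p :* i)) :* w := p :- p :* (w :* i)) refl _ _ _) (trans (cong (λ t → ⟨ y , v j ⟩ - ⟨ y , v j ⟩ * t) (*-inv (anis j)))
          (solve 1 (λ p → p :- p :* con (pos 1) := con (pos 0)) refl _))))
      x·y′ : ⟨ x , y′ ⟩ ≢ 0#
      x·y′ z = x·y (trans (sym (trans (form-⊕ʳ _ _ _) (trans (+-congˡ (trans (form-combʳ c v x) (sum-0 n λ l → trans (*-congˡ (trans (form-sym _ _) (v⊥x l))) (zeroʳ _)))) (+-identityʳ _)))) z)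
      add : ∀ z → (∀ i → ⟨ v i , z ⟩ ≡ 0#) → ⟨ z , z ⟩ ≢ 0# → OrthogonalFamily (suc n)
      add z ⊥ nz = record { v = cons z v
        ; orth = λ { Fin.zero Fin.zero ne → ⊥-elim (ne refl) ; Fin.zero (Fin.suc j) _ → trans (form-sym _ _) (⊥ j) ; (Fin.suc i) Fin.zero _ → ⊥ i ; (Fin.suc i) (Fin.suc j) ne → orth i j λ { refl → ne refl } }
        ; anis = λ { Fin.zero → nz ; (Fin.suc i) → anis i } }
      finish : Dec (⟨ x , x ⟩ ≡ 0#) → Dec (⟨ y′ , y′ ⟩ ≡ 0#) → OrthogonalFamily (suc n)
      finish (no nx) _ = add x v⊥x nx
      finish _ (no ny) = add y′ v⊥y′ ny
      finish (yes zx) (yes zy) = add (x ⊕ y′) (λ i → trans (form-⊕ʳ _ _ _) (trans (cong₂ _+_ (v⊥x i) (v⊥y′ i)) (+-identityˡ 0#)))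
        λ z → no-zero-divisors 2≢0 x·y′ (trans (solve 1 (λ p → (con (pos 1) :+ con (pos 1)) :* p := (con (pos 0) :+ p) :+ (p :+ con (pos 0))) refl _)
          (trans (cong₂ _+_ (cong₂ _+_ (sym zx) refl) (cong₂ _+_ (form-sym _ _) (sym zy)))
            (trans (sym (trans (form-⊕ˡ _ _ _) (cong₂ _+_ (form-⊕ʳ _ _ _) (form-⊕ʳ _ _ _)))) z)))

    orthogonal-family : ∀ n → n ≤ d → OrthogonalFamily n
    orthogonal-family zero _ = record { v = λ () ; orth = λ () ; anis = λ () }
    orthogonal-family (suc n) n<d = extend n<d (orthogonal-family n (ℕP.<⇒≤ n<d))

    frame : ∀ h → suc (twice h) ≤ d → Frame 𝔽 form h
    frame h le = proj₁ (frame-from h (orthogonal-family (suc (twice h)) le))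

-- Determinants of matrices with dependent rows.

module Determinant (𝔽 : FiniteField) where
  open FiniteField 𝔽
  open FieldLemmas 𝔽
  open ≡-Reasoning
  open Solver using (solve; _:=_; con; _:+_; _:*_; :-_; _:-_)

  sign : ∀ {n} → Fin n → F
  sign Fin.zero    = 1#
  sign (Fin.suc j) = - sign j

  alt : ∀ n → (Fin n → F) → F
  alt n g = sum n (λ j → sign j * g j)

  determinant : ∀ n → (Fin n → Fin n → F) → F
  determinant zero    A = 1#
  determinant (suc n) A = alt (suc n) (λ j → A Fin.zero j * determinant n (λ a b → A (Fin.suc a) (punchIn j b)))

  alt-cong : ∀ n {g h : Fin n → F} → (∀ j → g j ≡ h j) → alt n g ≡ alt n h
  alt-cong n e = sum-cong n λ j → *-congˡ (e j)

  alt-0 : ∀ n {g : Fin n → F} → (∀ j → g j ≡ 0#) → alt n g ≡ 0#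
  alt-0 n e = sum-0 n λ j → trans (*-congˡ (e j)) (zeroʳ _)

  alt-lin : ∀ n c (g h : Fin n → F) → alt n (λ j → g j + c * h j) ≡ alt n g + c * alt n h
  alt-lin n c g h = trans (sum-cong n λ j → solve 4 (λ s g c h → s :* (g :+ c :* h) := s :* g :+ c :* (s :* h)) refl _ _ c _) (sum-lin n c _ _)

  alt-lin₂ : ∀ n a c (g h : Fin n → F) → alt n (λ j → a * g j + c * h j) ≡ a * alt n g + c * alt n h
  alt-lin₂ n a c g h = trans (alt-lin n c (λ j → a * g j) h) (+-congʳ (trans (sum-cong n λ j → solve 3 (λ s a x → s :* (a :* x) := a :* (s :* x)) refl (sign j) a (g j)) (sum-* n a _)))

  alt-suc : ∀ n (g : Fin (suc n) → F) → alt (suc n) g ≡ g Fin.zero - alt n (g ∘ Fin.suc)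
  alt-suc n g = cong₂ _+_ (*-identityˡ _) (trans (sum-cong n λ j → solve 2 (λ s g → (:- s) :* g := (:- con (pos 1)) :* (s :* g)) refl (sign j) (g (Fin.suc j)))
    (trans (sum-* n _ _) (solve 1 (λ x → (:- con (pos 1)) :* x := :- x) refl _)))

  determinant-cong : ∀ n {A B : Fin n → Fin n → F} → (∀ i j → A i j ≡ B i j) → determinant n A ≡ determinant n B
  determinant-cong zero e = refl
  determinant-cong (suc n) {A} {B} e = alt-cong (suc n) {λ j → A Fin.zero j * determinant n (λ a b → A (Fin.suc a) (punchIn j b))}
    λ j → cong₂ _*_ (e Fin.zero j) (determinant-cong n λ a b → e (Fin.suc a) (punchIn j b))

  -- Invariance of a function of (j , k) under exchanging the order in which the columns j and punchIn j k are deleted.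
  Exchange : ∀ m → (Fin (suc m) → Fin m → F) → Set
  Exchange zero    H = ⊤
  Exchange (suc m) H = (∀ k → H Fin.zero k ≡ H (Fin.suc k) Fin.zero) × Exchange m (λ j k → H (Fin.suc j) (Fin.suc k))

  -- The two orders of deleting the same pair of columns occur with opposite signs.
  alt-alt-0 : ∀ m H → Exchange m H → alt (suc m) (λ j → alt m (H j)) ≡ 0#
  alt-alt-0 zero H _ = alt-0 1 λ _ → refl
  alt-alt-0 (suc m) H (e , ex) = begin
    alt (suc (suc m)) (λ j → alt (suc m) (H j)) ≡⟨ alt-suc (suc m) (λ j → alt (suc m) (H j)) ⟩
    alt (suc m) (H Fin.zero) - alt (suc m) (λ j → alt (suc m) (H (Fin.suc j)))
      ≡⟨ cong (λ x → alt (suc m) (H Fin.zero) - x) (trans (alt-cong (suc m) λ j → trans (alt-suc m (H (Fin.suc j)))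
           (solve 2 (λ a b → a :- b := a :+ (:- con (pos 1)) :* b) refl _ _)) (alt-lin (suc m) (- 1#) (λ j → H (Fin.suc j) Fin.zero) (λ j → alt m (λ k → H (Fin.suc j) (Fin.suc k))))) ⟩
    alt (suc m) (H Fin.zero) - (alt (suc m) (λ j → H (Fin.suc j) Fin.zero) + (- 1#) * alt (suc m) (λ j → alt m (λ k → H (Fin.suc j) (Fin.suc k))))
      ≡⟨ cong₂ (λ x y → alt (suc m) (H Fin.zero) - (x + (- 1#) * y)) (alt-cong (suc m) λ k → sym (e k)) (alt-alt-0 m _ ex) ⟩
    alt (suc m) (H Fin.zero) - (alt (suc m) (H Fin.zero) + (- 1#) * 0#) ≡⟨ solve 1 (λ a → a :- (a :+ (:- con (pos 1)) :* con (pos 0)) := con (pos 0)) refl _ ⟩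
    0# ∎

  exchange-product : ∀ m (ρ : Fin (suc m) → F) (Ψ : Fin (suc m) → Fin m → F) → Exchange m Ψ → Exchange m (λ j k → ρ j * (ρ (punchIn j k) * Ψ j k))
  exchange-product zero ρ Ψ _ = tt
  exchange-product (suc m) ρ Ψ (e , ex) =
    (λ k → trans (cong (λ x → ρ Fin.zero * (ρ (Fin.suc k) * x)) (e k)) (solve 3 (λ a b c → a :* (b :* c) := b :* (a :* c)) refl _ _ _))
    , exchange-product m (ρ ∘ Fin.suc) _ ex

  exchange-punch : ∀ m (Φ : (Fin m → Fin (suc (suc m))) → F) → (∀ {φ ψ} → (∀ x → φ x ≡ ψ x) → Φ φ ≡ Φ ψ) →
    (Ψ : Fin (suc (suc m)) → Fin (suc m) → F) → (∀ j k → Ψ j k ≡ Φ (λ x → punchIn j (punchIn k x))) → Exchange (suc m) Ψ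
  exchange-punch m Φ resp Ψ e = (λ k → trans (e Fin.zero k) (sym (e (Fin.suc k) Fin.zero))) , later m Φ resp e
    where
    later : ∀ m {Ψ : Fin (suc (suc m)) → Fin (suc m) → F} (Φ : (Fin m → Fin (suc (suc m))) → F) → (∀ {φ ψ} → (∀ x → φ x ≡ ψ x) → Φ φ ≡ Φ ψ) →
            (∀ j k → Ψ j k ≡ Φ (λ x → punchIn j (punchIn k x))) → Exchange m (λ j k → Ψ (Fin.suc j) (Fin.suc k))
    later zero Φ resp e = tt
    later (suc m) {Ψ} Φ resp e = exchange-punch m (λ φ → Φ (lift φ)) (λ eq → resp λ { Fin.zero → refl ; (Fin.suc x) → cong Fin.suc (eq x) })
      _ (λ j k → trans (e (Fin.suc j) (Fin.suc k)) (resp λ { Fin.zero → refl ; (Fin.suc x) → refl }))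
      where
      lift : (Fin m → Fin (suc (suc m))) → Fin (suc m) → Fin (suc (suc (suc m)))
      lift φ Fin.zero    = Fin.zero
      lift φ (Fin.suc x) = Fin.suc (φ x)

  -- Expansion along both rows is a double alternating sum whose terms depend on the pair of deleted
  -- columns, not on their order. Equality of the first two rows is enough for `singular⇒0`, so
  -- permutations of rows are avoided.
  equal-rows : ∀ n (r : V (suc (suc n))) (R : Fin n → V (suc (suc n))) → determinant (suc (suc n)) (cons r (cons r R)) ≡ 0#
  equal-rows n r R = trans (alt-cong (suc (suc n)) {h = λ j → alt (suc n) (H j)} λ j → trans (sym (sum-* (suc n) (r j) (λ k → sign k * (r (punchIn j k) * Ψ j k))))
        (sum-cong (suc n) λ k → solve 3 (λ r s x → r :* (s :* x) := s :* (r :* x)) refl (r j) (sign k) (r (punchIn j k) * Ψ j k)))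
      (alt-alt-0 (suc n) H (exchange-product (suc n) r Ψ (exchange-punch n (λ φ → determinant n (λ a b → R a (φ b))) (λ e → determinant-cong n λ a b → cong (R a) (e b)) Ψ (λ j k → refl))))
    where
    Ψ H : Fin (suc (suc n)) → Fin (suc n) → F
    Ψ j k = determinant n (λ a b → R a (punchIn j (punchIn k b)))
    H j k = r j * (r (punchIn j k) * Ψ j k)

  row₀-lin : ∀ n c (r r′ : V (suc n)) (R : Fin n → V (suc n)) →
             determinant (suc n) (cons (r ⊕ c · r′) R) ≡ determinant (suc n) (cons r R) + c * determinant (suc n) (cons r′ R)
  row₀-lin n c r r′ R = trans (alt-cong (suc n) {g = λ j → (r j + c * r′ j) * minor j} λ j → solve 4 (λ a b c d → (a :+ c :* b) :* d := a :* d :+ c :* (b :* d)) refl (r j) (r′ j) c (minor j))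
      (alt-lin (suc n) c (λ j → r j * minor j) (λ j → r′ j * minor j))
    where
    minor : Fin (suc n) → F
    minor j = determinant n (λ a b → R a (punchIn j b))

  row₁-lin : ∀ n a c (r₀ r r′ : V (suc (suc n))) (R : Fin n → V (suc (suc n))) →
             determinant (suc (suc n)) (cons r₀ (cons (a · r ⊕ c · r′) R)) ≡
             a * determinant (suc (suc n)) (cons r₀ (cons r R)) + c * determinant (suc (suc n)) (cons r₀ (cons r′ R))
  row₁-lin n a c r₀ r r′ R = trans (alt-cong (suc (suc n)) {g = λ j → r₀ j * minor j (a · r ⊕ c · r′)} λ j → trans (*-congˡ (inner j))
      (solve 5 (λ t a x c y → t :* (a :* x :+ c :* y) := a :* (t :* x) :+ c :* (t :* y)) refl (r₀ j) a (minor j r) c (minor j r′)))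
    (alt-lin₂ (suc (suc n)) a c (λ j → r₀ j * minor j r) (λ j → r₀ j * minor j r′))
    where
    minor : Fin (suc (suc n)) → V (suc (suc n)) → F
    minor j r = determinant (suc n) (λ i b → cons r R i (punchIn j b))
    subminor : Fin (suc (suc n)) → Fin (suc n) → F
    subminor j k = determinant n (λ i b → R i (punchIn j (punchIn k b)))
    inner : ∀ j → minor j (a · r ⊕ c · r′) ≡ a * minor j r + c * minor j r′
    inner j = trans (alt-cong (suc n) {g = λ k → (a * r (punchIn j k) + c * r′ (punchIn j k)) * subminor j k}
        λ k → solve 5 (λ a x c y d → (a :* x :+ c :* y) :* d := a :* (x :* d) :+ c :* (y :* d)) refl a (r (punchIn j k)) c (r′ (punchIn j k)) (subminor j k))
      (alt-lin₂ (suc n) a c (λ k → r (punchIn j k) * subminor j k) (λ k → r′ (punchIn j k) * subminor j k))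

  -- Row operations on the first two rows produce a relation without the first row, and then
  -- induction applies to the minors along that row.
  singular⇒0 : ∀ n (A : Fin n → V n) (x : V n) k → x k ≢ 0# → (∀ j → sum n (λ i → x i * A i j) ≡ 0#) → determinant n A ≡ 0#
  singular⇒0 (suc n) A x k xk dep = first (x Fin.zero ≟ 0#) k xk
    where
    -- A relation that does not involve the first row makes all minors along that row vanish.
    minors : ∀ n → (∀ (A : Fin n → V n) (x : V n) k → x k ≢ 0# → (∀ j → sum n (λ i → x i * A i j) ≡ 0#) → determinant n A ≡ 0#) →
             (B : Fin (suc n) → V (suc n)) (y : V (suc n)) → y Fin.zero ≡ 0# → ∀ k → y (Fin.suc k) ≢ 0# →
             (∀ j → sum (suc n) (λ i → y i * B i j) ≡ 0#) → determinant (suc n) B ≡ 0#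
    minors n ih B y y0 k yk dep = alt-0 (suc n) {λ j → B Fin.zero j * determinant n (λ a b → B (Fin.suc a) (punchIn j b))} λ j → trans (*-congˡ (ih _ (y ∘ Fin.suc) k yk λ b →
      trans (sym (trans (+-congʳ (trans (*-congʳ y0) (zeroˡ _))) (+-identityˡ _))) (dep (punchIn j b)))) (zeroʳ _)

    both : ∀ n → (∀ (A : Fin (suc n) → V (suc n)) (x : V (suc n)) k → x k ≢ 0# → (∀ j → sum (suc n) (λ i → x i * A i j) ≡ 0#) → determinant (suc n) A ≡ 0#) →
           (r₀ r₁ : V (suc (suc n))) (R : Fin n → V (suc (suc n))) (x₀ x₁ : F) (y : V n) → x₁ ≢ 0# →
           (∀ j → x₀ * r₀ j + (x₁ * r₁ j + sum n (λ i → y i * R i j)) ≡ 0#) → determinant (suc (suc n)) (cons r₀ (cons r₁ R)) ≡ 0#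
    both n ih r₀ r₁ R x₀ x₁ y x₁≢0 dep = *-cancelˡ x₁≢0 (begin
      x₁ * determinant (suc (suc n)) (cons r₀ (cons r₁ R))
        ≡⟨ solve 2 (λ a x → a := x :* con (pos 0) :+ a) refl _ x₀ ⟩
      x₀ * 0# + x₁ * determinant (suc (suc n)) (cons r₀ (cons r₁ R)) ≡⟨ +-congʳ (*-congˡ (sym (equal-rows n r₀ R))) ⟩
      x₀ * determinant (suc (suc n)) (cons r₀ (cons r₀ R)) + x₁ * determinant (suc (suc n)) (cons r₀ (cons r₁ R)) ≡⟨ row₁-lin n x₀ x₁ r₀ r₀ r₁ R ⟨
      determinant (suc (suc n)) (cons r₀ (cons (x₀ · r₀ ⊕ x₁ · r₁) R))
        ≡⟨ minors (suc n) ih (cons r₀ (cons (x₀ · r₀ ⊕ x₁ · r₁) R)) (cons 0# (cons 1# y)) refl Fin.zero (0≢1 ∘ sym) (λ j → trans (solve 5 (λ a x₀ x₁ b s → con (pos 0) :* a :+ (con (pos 1) :* (x₀ :* a :+ x₁ :* b) :+ s) := x₀ :* a :+ (x₁ :* b :+ s)) refl (r₀ j) x₀ x₁ (r₁ j) _) (dep j)) ⟩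
      0# ≡⟨ zeroʳ x₁ ⟨
      x₁ * 0# ∎)

    split : ∀ n (A : Fin (suc (suc n)) → V (suc (suc n))) i j → A i j ≡ cons (A Fin.zero) (cons (A (Fin.suc Fin.zero)) (λ i → A (Fin.suc (Fin.suc i)))) i j
    split n A Fin.zero j = refl
    split n A (Fin.suc Fin.zero) j = refl
    split n A (Fin.suc (Fin.suc i)) j = refl

    first : Dec (x Fin.zero ≡ 0#) → ∀ k → x k ≢ 0# → determinant (suc n) A ≡ 0#
    first (yes z) Fin.zero xk = ⊥-elim (xk z)
    first (yes z) (Fin.suc k) xk = minors n (singular⇒0 n) A x z k xk dep
    first (no x0) _ _ = by n A x dep x0 (singular⇒0 n)
      where
      by : ∀ n (A : Fin (suc n) → V (suc n)) (x : V (suc n)) → (∀ j → sum (suc n) (λ i → x i * A i j) ≡ 0#) → x Fin.zero ≢ 0# →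
           (∀ (A : Fin n → V n) (x : V n) k → x k ≢ 0# → (∀ j → sum n (λ i → x i * A i j) ≡ 0#) → determinant n A ≡ 0#) → determinant (suc n) A ≡ 0#
      by zero A x dep x0 _ = alt-0 1 {λ j → A Fin.zero j * determinant 0 (λ a b → A (Fin.suc a) (punchIn j b))} λ { Fin.zero → trans (*-congʳ (*-cancelˡ x0 (trans (sym (+-identityʳ _)) (trans (dep Fin.zero) (sym (zeroʳ _)))))) (zeroˡ _) }
      by (suc n) A x dep x0 ih = trans (determinant-cong (suc (suc n)) (split n A)) (second (x (Fin.suc Fin.zero) ≟ 0#))
        where
        r₀ = A Fin.zero
        r₁ = A (Fin.suc Fin.zero)
        R = λ i → A (Fin.suc (Fin.suc i))
        y = λ i → x (Fin.suc (Fin.suc i))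
        second : Dec (x (Fin.suc Fin.zero) ≡ 0#) → determinant (suc (suc n)) (cons r₀ (cons r₁ R)) ≡ 0#
        second (no x1)  = both n ih r₀ r₁ R (x Fin.zero) (x (Fin.suc Fin.zero)) y x1 dep
        -- The second row does not occur in the relation. Adding it to the first one makes it occur,
        -- with the non-zero coefficient - x₀.
        second (yes x1) = begin
          determinant (suc (suc n)) (cons r₀ (cons r₁ R)) ≡⟨ solve 1 (λ a → a := a :+ con (pos 1) :* con (pos 0)) refl _ ⟩
          determinant (suc (suc n)) (cons r₀ (cons r₁ R)) + 1# * 0# ≡⟨ +-congˡ (*-congˡ (sym (equal-rows n r₁ R))) ⟩
          determinant (suc (suc n)) (cons r₀ (cons r₁ R)) + 1# * determinant (suc (suc n)) (cons r₁ (cons r₁ R)) ≡⟨ row₀-lin (suc n) 1# r₀ r₁ (cons r₁ R) ⟨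
          determinant (suc (suc n)) (cons (r₀ ⊕ 1# · r₁) (cons r₁ R))
            ≡⟨ both n ih (r₀ ⊕ 1# · r₁) r₁ R (x Fin.zero) (- x Fin.zero) y (neg-≢0 x0) (λ j → trans
                 (solve 4 (λ x a b s → x :* (a :+ con (pos 1) :* b) :+ ((:- x) :* b :+ s) := x :* a :+ (con (pos 0) :* b :+ s)) refl (x Fin.zero) (r₀ j) (r₁ j) _)
                 (trans (+-congˡ (+-congʳ (*-congʳ (sym x1)))) (dep j))) ⟩
          0# ∎

-- The form of a symmetric matrix; affine identities.

module MatrixForm (𝔽 : FiniteField) (d : ℕ) (A : Fin d → Fin d → FiniteField.F 𝔽) (A-sym : ∀ a b → A a b ≡ A b a) where
  open FiniteField 𝔽
  open FieldLemmas 𝔽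
  open Determinant 𝔽
  open Solver using (solve; _:=_; con; _:+_; _:*_; :-_; _:-_)

  pair : V d → V d → F
  pair x y = sum d (λ b → sum d (λ a → x a * A a b) * y b)

  matrixForm : Form 𝔽 d
  matrixForm = record
    { ⟨_,_⟩ = pair
    ; form-cong = λ e e′ → sum-cong d λ b → cong₂ _*_ (sum-cong d λ a → *-congʳ (e a)) (e′ b)
    ; form-sym = λ x y → trans (sum-cong d λ b → trans (*-comm _ _) (sym (sum-* d (y b) _)))
        (trans (sum-swap d d _) (sum-cong d λ a → trans (sum-cong d λ b → trans
          (cong (λ z → y b * (x a * z)) (A-sym a b)) (solve 3 (λ y x a → y :* (x :* a) := x :* (y :* a)) refl (y b) (x a) (A b a)))
            (trans (sum-* d (x a) _) (*-comm _ _))))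
    ; form-⊕ˡ = λ x y z → trans (sum-cong d λ b → trans (*-congʳ (trans (sum-cong d λ a → distribʳ _ _ _) (sum-+ d _ _))) (distribʳ _ _ _)) (sum-+ d _ _)
    ; form-·ˡ = λ c x z → trans (sum-cong d λ b → trans (*-congʳ (trans (sum-cong d λ a → *-assoc c _ _) (sum-* d c _))) (*-assoc c _ _)) (sum-* d c _)
    }

  nondegenerate : determinant d A ≢ 0# → ∀ x → (∀ y → pair x y ≡ 0#) → ∀ a → x a ≡ 0#
  nondegenerate A-det x h a = decidable-stable (x a ≟ 0#) λ n → A-det (singular⇒0 d A x a n λ j →
    trans (sym (sum-δ d j (λ b → sum d (λ a → x a * A a b)))) (h (λ b → δ b j)))

module Affine (𝔽 : FiniteField) where
  open FiniteField 𝔽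
  open FieldLemmas 𝔽
  open Solver using (solve; _:=_; con; _:+_; _:*_; :-_; _:-_)

  functional-interpolates : ∀ K (c g g′ g″ : V K) u t → (∀ i → g″ i ≡ g i + t * (g′ i - g i)) →
    sum K (λ i → c i * g″ i) + u ≡ (sum K (λ i → c i * g i) + u) + t * ((sum K (λ i → c i * g′ i) + u) - (sum K (λ i → c i * g i) + u))
  functional-interpolates K c g g′ g″ u t e = trans (+-congʳ (trans (sum-cong K λ i → trans (*-congˡ (e i))
      (solve 4 (λ c x t y → c :* (x :+ t :* (y :- x)) := c :* x :+ t :* (c :* y :+ (:- con (pos 1)) :* (c :* x))) refl (c i) (g i) t (g′ i)))
      (trans (sum-lin K t _ _) (+-congˡ (*-congˡ (sum-lin K (- 1#) _ _))))))
    (solve 4 (λ x t y u → x :+ t :* (y :+ (:- con (pos 1)) :* x) :+ u := (x :+ u) :+ t :* ((y :+ u) :- (x :+ u))) refl (sum K (λ i → c i * g i)) t (sum K (λ i → c i * g′ i)) u)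

  constant-interpolates : ∀ u t → u ≡ u + t * (u - u)
  constant-interpolates = solve 2 (λ u t → u := u :+ t :* (u :- u)) refl

  interpolate-0 : ∀ t → 0# + t * (0# - 0#) ≡ 0#
  interpolate-0 = solve 1 (λ t → con (pos 0) :+ t :* (con (pos 0) :- con (pos 0)) := con (pos 0)) refl

  add-sub : ∀ u v → (u + v) - v ≡ u
  add-sub = solve 2 (λ u v → (u :+ v) :- v := u) refl

  sub-add : ∀ u v → (u - v) + v ≡ u
  sub-add = solve 2 (λ u v → (u :- v) :+ v := u) refl

  clear-denominator : ∀ K (a n N : V K) w D → (∀ i → D * n i ≡ N i) → D * (sum K (λ i → a i * n i) + w) ≡ sum K (λ i → a i * N i) + w * D
  clear-denominator K a n N w D e = trans (distribˡ D _ _) (cong₂ _+_ (trans (sym (sum-* K D _))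
    (sum-cong K λ i → trans (solve 3 (λ D a n → D :* (a :* n) := a :* (D :* n)) refl D (a i) (n i)) (*-congˡ (e i)))) (*-comm D w))

open import Defs hiding (Pt; Mat)

-- The prime field.

module PrimeField (p : ℕ) {{_ : NonZero p}} (p-prime : Prime p) (2<p : 2 < p) where

  residue : ℕ → Fin p
  residue n = n mod p

  toℕ-residue : ∀ n → toℕ (residue n) ≡ n % p
  toℕ-residue n = toℕ-fromℕ< (m%n<n n p)

  residue-toℕ : ∀ a → residue (toℕ a) ≡ a
  residue-toℕ a = toℕ-injective (trans (toℕ-residue (toℕ a)) (m<n⇒m%n≡m (toℕ<n a)))

  residue-cong : ∀ {m n} → m % p ≡ n % p → residue m ≡ residue n
  residue-cong {m} {n} e = toℕ-injective (trans (toℕ-residue m) (trans e (sym (toℕ-residue n))))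

  residue-+ : ∀ m n → residue (toℕ (residue m) ℕ.+ toℕ (residue n)) ≡ residue (m ℕ.+ n)
  residue-+ m n = residue-cong (trans (cong (_% p) (cong₂ ℕ._+_ (toℕ-residue m) (toℕ-residue n))) (sym (%-distribˡ-+ m n p)))

  residue-* : ∀ m n → residue (toℕ (residue m) ℕ.* toℕ (residue n)) ≡ residue (m ℕ.* n)
  residue-* m n = residue-cong (trans (cong (_% p) (cong₂ ℕ._*_ (toℕ-residue m) (toℕ-residue n))) (sym (%-distribˡ-* m n p)))

  residue-+ˡ : ∀ m b → residue (toℕ (residue m) ℕ.+ toℕ b) ≡ residue (m ℕ.+ toℕ b)
  residue-+ˡ m b = trans (cong (λ c → residue (toℕ (residue m) ℕ.+ toℕ c)) (sym (residue-toℕ b))) (residue-+ m (toℕ b))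

  residue-*ˡ : ∀ m b → residue (toℕ (residue m) ℕ.* toℕ b) ≡ residue (m ℕ.* toℕ b)
  residue-*ˡ m b = trans (cong (λ c → residue (toℕ (residue m) ℕ.* toℕ c)) (sym (residue-toℕ b))) (residue-* m (toℕ b))

  private
    infixl 6 _⊹_
    infixl 7 _⊛_
    _⊹_ _⊛_ : Fin p → Fin p → Fin p
    _⊹_ = _+F_ p
    _⊛_ = _*F_ p

    ⊹-comm : ∀ a b → a ⊹ b ≡ b ⊹ a
    ⊹-comm a b = cong residue (ℕP.+-comm (toℕ a) (toℕ b))

    ⊛-comm : ∀ a b → a ⊛ b ≡ b ⊛ a
    ⊛-comm a b = cong residue (ℕP.*-comm (toℕ a) (toℕ b))

    ⊹-assoc : ∀ a b c → (a ⊹ b) ⊹ c ≡ a ⊹ (b ⊹ c)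
    ⊹-assoc a b c = trans (residue-+ˡ (toℕ a ℕ.+ toℕ b) c) (trans (cong residue (trans (ℕP.+-assoc (toℕ a) _ _) (ℕP.+-comm (toℕ a) _)))
      (trans (sym (residue-+ˡ (toℕ b ℕ.+ toℕ c) a)) (⊹-comm (b ⊹ c) a)))

    ⊛-assoc : ∀ a b c → (a ⊛ b) ⊛ c ≡ a ⊛ (b ⊛ c)
    ⊛-assoc a b c = trans (residue-*ˡ (toℕ a ℕ.* toℕ b) c) (trans (cong residue (trans (ℕP.*-assoc (toℕ a) _ _) (ℕP.*-comm (toℕ a) _)))
      (trans (sym (residue-*ˡ (toℕ b ℕ.* toℕ c) a)) (⊛-comm (b ⊛ c) a)))

    ⊹-identityˡ : ∀ a → 0F p ⊹ a ≡ a
    ⊹-identityˡ a = trans (residue-+ˡ 0 a) (residue-toℕ a)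

    ⊛-identityˡ : ∀ a → 1F p ⊛ a ≡ a
    ⊛-identityˡ a = trans (residue-*ˡ 1 a) (trans (cong residue (ℕP.*-identityˡ (toℕ a))) (residue-toℕ a))

    ⊹-inverseˡ : ∀ a → negF p a ⊹ a ≡ 0F p
    ⊹-inverseˡ a = trans (residue-+ˡ (p ℕ.∸ toℕ a) a) (residue-cong (trans (cong (_% p) (ℕP.m∸n+n≡m (ℕP.<⇒≤ (toℕ<n a)))) (trans (n%n≡0 p) (sym (m<n⇒m%n≡m (ℕP.<-trans (s≤s z≤n) 2<p))))))

    ⊛-distribʳ : ∀ c a b → (a ⊹ b) ⊛ c ≡ (a ⊛ c) ⊹ (b ⊛ c)
    ⊛-distribʳ c a b = trans (residue-*ˡ (toℕ a ℕ.+ toℕ b) c) (trans (cong residue (ℕP.*-distribʳ-+ (toℕ c) (toℕ a) (toℕ b))) (sym (residue-+ (toℕ a ℕ.* toℕ c) (toℕ b ℕ.* toℕ c))))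

  isCommutativeRing : IsCommutativeRing _≡_ (_+F_ p) (_*F_ p) (negF p) (0F p) (1F p)
  isCommutativeRing = record
    { isRing = record
      { +-isAbelianGroup = record
        { isGroup = record
          { isMonoid = record
            { isSemigroup = record { isMagma = record { isEquivalence = ≡-isEquivalence ; ∙-cong = cong₂ _⊹_ } ; assoc = ⊹-assoc }
            ; identity = ⊹-identityˡ , λ a → trans (⊹-comm a _) (⊹-identityˡ a) }
          ; inverse = ⊹-inverseˡ , λ a → trans (⊹-comm a _) (⊹-inverseˡ a)
          ; ⁻¹-cong = cong (negF p) }
        ; comm = ⊹-comm }
      ; *-cong = cong₂ _⊛_
      ; *-assoc = ⊛-assoc
      ; *-identity = ⊛-identityˡ , λ a → trans (⊛-comm a _) (⊛-identityˡ a)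
      ; distrib = (λ a b c → trans (⊛-comm a _) (trans (⊛-distribʳ a b c) (cong₂ _⊹_ (⊛-comm b a) (⊛-comm c a)))) , ⊛-distribʳ }
    ; *-comm = ⊛-comm }

  private module S = IntegerSolver isCommutativeRing

  residue-0 : ∀ n → residue (n ℕ.* p) ≡ 0F p
  residue-0 n = residue-cong (trans (m*n%n≡0 n p) (sym (m<n⇒m%n≡m (ℕP.<-trans (s≤s z≤n) 2<p))))

  toℕ-≢0 : ∀ {a} → a ≢ 0F p → toℕ a ≢ 0
  toℕ-≢0 {a} n e = n (trans (sym (residue-toℕ a)) (cong residue e))

  inverse : ∀ a → a ≢ 0F p → Σ (Fin p) λ b → a ⊛ b ≡ 1F p
  inverse a a≢0 = by (coprime-Bézout (prime⇒coprime p-prime {{ℕ.≢-nonZero (toℕ-≢0 a≢0)}} (toℕ<n a)))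
    where
    times : ∀ y → a ⊛ residue y ≡ residue (y ℕ.* toℕ a)
    times y = trans (⊛-comm a _) (residue-*ˡ y a)
    by : Bézout.Identity 1 p (toℕ a) → Σ (Fin p) λ b → a ⊛ b ≡ 1F p
    -- Here 1 + y a is the multiple x p, so that - y inverts a.
    by (Bézout.+- x y e) = negF p (residue y) , trans (S.solve 2 (λ a b → a S.:* (S.:- b) S.:= S.con (pos 1) S.:- (S.con (pos 1) S.:+ a S.:* b)) refl a (residue y))
      (trans (cong (λ z → 1F p ⊹ negF p z) (trans (cong (1F p ⊹_) (times y)) (trans (residue-+ 1 (y ℕ.* toℕ a)) (trans (cong residue e) (residue-0 x)))))
        (S.solve 0 (S.con (pos 1) S.:- S.con (pos 0) S.:= S.con (pos 1)) refl))
    by (Bézout.-+ x y e) = residue y , trans (times y) (trans (cong residue (sym e)) (trans (sym (residue-+ 1 (x ℕ.* p)))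
      (trans (cong (1F p ⊹_) (residue-0 x)) (trans (⊹-comm (1F p) _) (⊹-identityˡ _)))))

  inverse-of : ∀ a → Dec (a ≡ 0F p) → Fin p
  inverse-of a (yes _) = 0F p
  inverse-of a (no n)  = proj₁ (inverse a n)

  inverse-of-correct : ∀ {a} (c : Dec (a ≡ 0F p)) → a ≢ 0F p → a ⊛ inverse-of a c ≡ 1F p
  inverse-of-correct (yes e) n = ⊥-elim (n e)
  inverse-of-correct (no m)  n = proj₂ (inverse _ m)

  small : ∀ {m n} → m < p → n < p → m ≢ n → residue m ≢ residue n
  small {m} {n} m<p n<p ne e = ne (trans (sym (m<n⇒m%n≡m m<p)) (trans (sym (toℕ-residue m)) (trans (cong toℕ e) (trans (toℕ-residue n) (m<n⇒m%n≡m n<p)))))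

  field-Fp : FiniteField
  field-Fp = record
    { F = Fin p ; _+_ = _+F_ p ; _*_ = _*F_ p ; -_ = negF p ; 0# = 0F p ; 1# = 1F p
    ; isCommutativeRing = isCommutativeRing
    ; inv = λ a → inverse-of a (a ≟Fin 0F p)
    ; *-inv = λ {a} n → inverse-of-correct (a ≟Fin 0F p) n
    ; 0≢1 = small (ℕP.<-trans (s≤s z≤n) 2<p) (ℕP.<-trans (s≤s (s≤s z≤n)) 2<p) λ ()
    ; 2≢0 = λ e → small 2<p (ℕP.<-trans (s≤s z≤n) 2<p) (λ ()) (trans (sym (residue-+ 1 1)) e)
    ; _≟_ = _≟Fin_
    ; elements = allFin p
    ; complete = ∈-allFin
    ; unique = allFin⁺ p
    }

-- Polynomial functions on the rationals.

module ℚSolver = IntegerSolver ℚP.+-*-isCommutativeRing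

module RationalFunctions where
  open import Data.Rational using (_+_; _*_; -_; _-_)
  open ℚSolver using (solve; _:=_; con; _:+_; _:*_; :-_; _:-_)

  ι : ℤ → ℚ
  ι = fromℤQ

  private
    toℚᵘ-ι : ∀ z → toℚᵘ (ι z) ≃ᵘ mkℚᵘ z 0
    toℚᵘ-ι z = ℚP.toℚᵘ-fromℚᵘ (mkℚᵘ z 0)

  ι-+ : ∀ a b → ι (a ℤ.+ b) ≡ ι a + ι b
  ι-+ a b = ℚP.toℚᵘ-injective (ℚᵘP.≃-trans (toℚᵘ-ι (a ℤ.+ b)) (ℚᵘP.≃-sym (ℚᵘP.≃-trans (ℚP.toℚᵘ-homo-+ (ι a) (ι b))
    (ℚᵘP.≃-trans (ℚᵘP.+-cong (toℚᵘ-ι a) (toℚᵘ-ι b)) (*≡* (cong (ℤ._* pos 1) (cong₂ ℤ._+_ (ℤP.*-identityʳ a) (ℤP.*-identityʳ b))))))))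

  ι-* : ∀ a b → ι (a ℤ.* b) ≡ ι a * ι b
  ι-* a b = ℚP.toℚᵘ-injective (ℚᵘP.≃-trans (toℚᵘ-ι (a ℤ.* b)) (ℚᵘP.≃-sym (ℚᵘP.≃-trans (ℚP.toℚᵘ-homo-* (ι a) (ι b))
    (ℚᵘP.≃-trans (ℚᵘP.*-cong (toℚᵘ-ι a) (toℚᵘ-ι b)) (*≡* refl)))))

  ι-injective : ∀ {a b} → ι a ≡ ι b → a ≡ b
  ι-injective {a} {b} e with ℚᵘP.≃-trans (ℚᵘP.≃-sym (toℚᵘ-ι a)) (ℚᵘP.≃-trans (ℚP.toℚᵘ-cong e) (toℚᵘ-ι b))
  ... | *≡* eq = trans (sym (ℤP.*-identityʳ a)) (trans eq (ℤP.*-identityʳ b))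

  ι-denominator : ∀ x → ι (↧ x) * x ≡ ι (↥ x)
  ι-denominator x@(mkℚ n d _) = ℚP.toℚᵘ-injective (ℚᵘP.≃-trans (ℚP.toℚᵘ-homo-* (ι (↧ x)) x) (ℚᵘP.≃-trans
    (ℚᵘP.*-cong (toℚᵘ-ι (↧ x)) (ℚᵘP.≃-refl {toℚᵘ x})) (ℚᵘP.≃-trans (*≡* lemma) (ℚᵘP.≃-sym (toℚᵘ-ι n)))))
    where
    lemma : (pos (suc d) ℤ.* n) ℤ.* pos 1 ≡ n ℤ.* pos (suc (d ℕ.+ 0))
    lemma = trans (ℤP.*-identityʳ _) (trans (ℤP.*-comm (pos (suc d)) n) (cong (λ k → n ℤ.* pos (suc k)) (sym (ℕP.+-identityʳ d))))

  -- Polynomial functions of degree ≤ n, described by iterated divided differences.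
  IsPoly : ℕ → (ℚ → ℚ) → Set
  IsPoly zero    f = ∀ t → f t ≡ f 0ℚ
  IsPoly (suc n) f = ∀ t₀ → Σ (ℚ → ℚ) λ g → IsPoly n g × (∀ t → f t ≡ f t₀ + (t - t₀) * g t)

  poly-cong : ∀ n {f g} → (∀ t → f t ≡ g t) → IsPoly n f → IsPoly n g
  poly-cong zero e p t = trans (sym (e t)) (trans (p t) (e 0ℚ))
  poly-cong (suc n) e p t₀ with p t₀
  ... | h , hp , eq = h , hp , λ t → trans (sym (e t)) (trans (eq t) (cong (_+ (t - t₀) * h t) (e t₀)))

  poly-const : ∀ n c → IsPoly n (λ _ → c)
  poly-const zero c t = refl
  poly-const (suc n) c t₀ = (λ _ → 0ℚ) , poly-const n 0ℚ , λ t → solve 2 (λ c d → c := c :+ d :* con (pos 0)) refl c (t - t₀)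

  poly-id : IsPoly 1 (λ t → t)
  poly-id t₀ = (λ _ → 1ℚ) , poly-const 0 1ℚ , λ t → solve 2 (λ t u → t := u :+ (t :- u) :* con (pos 1)) refl t t₀

  poly-+ : ∀ n {f g} → IsPoly n f → IsPoly n g → IsPoly n (λ t → f t + g t)
  poly-+ zero p q t = cong₂ _+_ (p t) (q t)
  poly-+ (suc n) {f} {g} p q t₀ with p t₀ | q t₀
  ... | h , hp , eq | k , kp , eq′ = (λ t → h t + k t) , poly-+ n hp kp , λ t → trans (cong₂ _+_ (eq t) (eq′ t))
    (solve 5 (λ a b d h k → (a :+ d :* h) :+ (b :+ d :* k) := (a :+ b) :+ d :* (h :+ k)) refl (f t₀) (g t₀) (t - t₀) (h t) (k t))

  poly-scale : ∀ n c {f} → IsPoly n f → IsPoly n (λ t → c * f t)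
  poly-scale zero c p t = cong (c *_) (p t)
  poly-scale (suc n) c {f} p t₀ with p t₀
  ... | h , hp , eq = (λ t → c * h t) , poly-scale n c hp , λ t → trans (cong (c *_) (eq t))
    (solve 4 (λ c a d h → c :* (a :+ d :* h) := c :* a :+ d :* (c :* h)) refl c (f t₀) (t - t₀) (h t))

  poly-suc : ∀ n {f} → IsPoly n f → IsPoly (suc n) f
  poly-suc zero {f} p t₀ = (λ _ → 0ℚ) , (λ _ → refl) , λ t → trans (trans (p t) (sym (p t₀))) (solve 2 (λ c d → c := c :+ d :* con (pos 0)) refl (f t₀) (t - t₀))
  poly-suc (suc n) p t₀ with p t₀
  ... | h , hp , eq = h , poly-suc n hp , eq

  poly-≤ : ∀ {m n f} → m ≤ n → IsPoly m f → IsPoly n f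
  poly-≤ {m} {n} {f} le p = go (ℕP.≤⇒≤′ le)
    where
    go : ∀ {n} → m ℕ.≤′ n → IsPoly n f
    go (ℕ.≤′-reflexive refl) = p
    go (ℕ.≤′-step le) = poly-suc _ (go le)

  -- The product rule for divided differences: f g - f(t₀) g(t₀) = (t - t₀)(h g + f(t₀) k).
  poly-* : ∀ m n {f g} → IsPoly m f → IsPoly n g → IsPoly (m ℕ.+ n) (λ t → f t * g t)
  poly-* zero n {f} {g} p q = poly-cong n (λ t → cong (_* g t) (sym (p t))) (poly-scale n (f 0ℚ) q)
  poly-* (suc m) zero {f} {g} p q = subst (λ k → IsPoly k (λ t → f t * g t)) (sym (ℕP.+-identityʳ (suc m)))
    (poly-cong (suc m) (λ t → trans (ℚP.*-comm (g 0ℚ) (f t)) (cong (f t *_) (sym (q t)))) (poly-scale (suc m) (g 0ℚ) p))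
  poly-* (suc m) (suc n) {f} {g} p q t₀ with p t₀ | q t₀
  ... | h , hp , eq | k , kp , eq′ = (λ t → h t * g t + f t₀ * k t) ,
      poly-+ (m ℕ.+ suc n) (poly-* m (suc n) hp q) (poly-≤ (ℕP.≤-trans (ℕP.n≤1+n n) (ℕP.m≤n+m (suc n) m)) (poly-scale n (f t₀) kp)) ,
      λ t → trans (cong (_* g t) (eq t)) (trans (ring (f t₀) (t - t₀) (h t) (g t)) (trans (cong (λ z → f t₀ * z + (t - t₀) * h t * g t) (eq′ t)) (ring′ (f t₀) (g t₀) (t - t₀) (k t) (h t) (g t))))
    where
    ring : ∀ a d h g → (a + d * h) * g ≡ a * g + d * h * g
    ring = solve 4 (λ a d h g → (a :+ d :* h) :* g := a :* g :+ d :* h :* g) refl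
    ring′ : ∀ a b d k h g → a * (b + d * k) + d * h * g ≡ a * b + d * (h * g + a * k)
    ring′ = solve 6 (λ a b d k h g → a :* (b :+ d :* k) :+ d :* h :* g := a :* b :+ d :* (h :* g :+ a :* k)) refl

  Poly : Set → Set
  Poly I = List (ℚ × List I)

  monomial : {I : Set} → (I → ℚ) → List I → ℚ
  monomial X m = foldr (λ v acc → X v * acc) 1ℚ m

  eval : {I : Set} → Poly I → (I → ℚ) → ℚ
  eval P X = foldr (λ t acc → (proj₁ t * monomial X (proj₂ t)) + acc) 0ℚ P

  Degree≤ : {I : Set} → ℕ → Poly I → Set
  Degree≤ s P = All (λ t → length (proj₂ t) ≤ s) P

  monomial-cong : {I : Set} {X Y : I → ℚ} → (∀ v → X v ≡ Y v) → ∀ m → monomial X m ≡ monomial Y m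
  monomial-cong e [] = refl
  monomial-cong e (v ∷ m) = cong₂ _*_ (e v) (monomial-cong e m)

  eval-cong : {I : Set} (P : Poly I) {X Y : I → ℚ} → (∀ v → X v ≡ Y v) → eval P X ≡ eval P Y
  eval-cong [] e = refl
  eval-cong ((c , m) ∷ P) e = cong₂ _+_ (cong (c *_) (monomial-cong e m)) (eval-cong P e)

  power : ℚ → ℕ → ℚ
  power x zero    = 1ℚ
  power x (suc n) = x * power x n

  power-+ : ∀ x m n → power x (m ℕ.+ n) ≡ power x m * power x n
  power-+ x zero n = sym (ℚP.*-identityˡ _)
  power-+ x (suc m) n = trans (cong (x *_) (power-+ x m n)) (sym (ℚP.*-assoc x _ _))

  -- Δˢ P(N / Δ), written without denominators.
  homogenised : {I : Set} → ℕ → Poly I → ℚ → (I → ℚ) → ℚ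
  homogenised s P D N = foldr (λ t acc → (proj₁ t * (power D (s ℕ.∸ length (proj₂ t)) * monomial N (proj₂ t))) + acc) 0ℚ P

  monomial-scale : {I : Set} (D : ℚ) {X N : I → ℚ} → (∀ v → N v ≡ D * X v) → ∀ m → monomial N m ≡ power D (length m) * monomial X m
  monomial-scale D e [] = refl
  monomial-scale D {X} e (v ∷ m) = trans (cong₂ _*_ (e v) (monomial-scale D e m))
    (solve 4 (λ d x p y → d :* x :* (p :* y) := d :* p :* (x :* y)) refl D (X v) (power D (length m)) (monomial X m))

  homogenised-eval : {I : Set} (s : ℕ) (P : Poly I) → Degree≤ s P → (D : ℚ) {X N : I → ℚ} → (∀ v → N v ≡ D * X v) →
                     homogenised s P D N ≡ power D s * eval P X
  homogenised-eval s [] [] D e = sym (ℚP.*-zeroʳ (power D s))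
  homogenised-eval s ((c , m) ∷ P) (le ∷ deg) D {X} {N} e = begin
    c * (power D (s ℕ.∸ length m) * monomial N m) + homogenised s P D N
      ≡⟨ cong₂ (λ x y → c * (power D (s ℕ.∸ length m) * x) + y) (monomial-scale D e m) (homogenised-eval s P deg D e) ⟩
    c * (power D (s ℕ.∸ length m) * (power D (length m) * monomial X m)) + power D s * eval P X
      ≡⟨ cong (_+ power D s * eval P X) (solve 4 (λ c p q x → c :* (p :* (q :* x)) := (p :* q) :* (c :* x)) refl c (power D (s ℕ.∸ length m)) (power D (length m)) (monomial X m)) ⟩
    power D (s ℕ.∸ length m) * power D (length m) * (c * monomial X m) + power D s * eval P X
      ≡⟨ cong (λ z → z * (c * monomial X m) + power D s * eval P X) (trans (sym (power-+ D (s ℕ.∸ length m) (length m))) (cong (power D) (ℕP.m∸n+n≡m le))) ⟩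
    power D s * (c * monomial X m) + power D s * eval P X ≡⟨ ℚP.*-distribˡ-+ (power D s) _ _ ⟨
    power D s * (c * monomial X m + eval P X) ∎
    where open ≡-Reasoning

  poly-power : ∀ {D f} n → IsPoly D f → IsPoly (n ℕ.* D) (λ t → power (f t) n)
  poly-power zero p = poly-const 0 1ℚ
  poly-power {D} (suc n) p = poly-* D (n ℕ.* D) p (poly-power n p)

  poly-monomial : ∀ {I : Set} {D} {N : I → ℚ → ℚ} → (∀ v → IsPoly D (N v)) → ∀ m → IsPoly (length m ℕ.* D) (λ t → monomial (λ v → N v t) m)
  poly-monomial p [] = poly-const 0 1ℚ
  poly-monomial {D = D} p (v ∷ m) = poly-* D (length m ℕ.* D) (p v) (poly-monomial p m)

  poly-homogenised : ∀ {I : Set} {D} s (P : Poly I) → Degree≤ s P → {f : ℚ → ℚ} {N : I → ℚ → ℚ} → IsPoly D f → (∀ v → IsPoly D (N v)) →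
                     IsPoly (s ℕ.* D) (λ t → homogenised s P (f t) (λ v → N v t))
  poly-homogenised {D = D} s [] [] pf pN = poly-const (s ℕ.* D) 0ℚ
  poly-homogenised {D = D} s ((c , m) ∷ P) (le ∷ deg) {f} {N} pf pN = poly-+ (s ℕ.* D) (poly-scale (s ℕ.* D) c (subst (λ k → IsPoly k (λ t → power (f t) (s ℕ.∸ length m) * monomial (λ v → N v t) m))
    (trans (sym (ℕP.*-distribʳ-+ D (s ℕ.∸ length m) (length m))) (cong (ℕ._* D) (ℕP.m∸n+n≡m le)))
    (poly-* ((s ℕ.∸ length m) ℕ.* D) (length m ℕ.* D) (poly-power (s ℕ.∸ length m) pf) (poly-monomial pN m)))) (poly-homogenised s P deg pf pN)

  poly-eval : ∀ {I : Set} {D} s (P : Poly I) → Degree≤ s P → {N : I → ℚ → ℚ} → (∀ v → IsPoly D (N v)) → IsPoly (s ℕ.* D) (λ t → eval P (λ v → N v t))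
  poly-eval {D = D} s [] [] pN = poly-const (s ℕ.* D) 0ℚ
  poly-eval {D = D} s ((c , m) ∷ P) (le ∷ deg) pN = poly-+ (s ℕ.* D) (poly-scale (s ℕ.* D) c (poly-≤ (ℕP.*-monoˡ-≤ D le) (poly-monomial pN m))) (poly-eval s P deg pN)

  rename : {I J : Set} → (I → J) → Poly I → Poly J
  rename φ = map (λ t → proj₁ t , map φ (proj₂ t))

  monomial-rename : {I J : Set} (φ : I → J) (X : J → ℚ) (m : List I) → monomial X (map φ m) ≡ monomial (X ∘ φ) m
  monomial-rename φ X [] = refl
  monomial-rename φ X (v ∷ m) = cong (X (φ v) *_) (monomial-rename φ X m)

  eval-rename : {I J : Set} (φ : I → J) (X : J → ℚ) (P : Poly I) → eval (rename φ P) X ≡ eval P (X ∘ φ)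
  eval-rename φ X [] = refl
  eval-rename φ X ((c , m) ∷ P) = cong₂ _+_ (cong (c *_) (monomial-rename φ X m)) (eval-rename φ X P)

  degree-rename : {I J : Set} (φ : I → J) {s : ℕ} (P : Poly I) → Degree≤ s P → Degree≤ s (rename φ P)
  degree-rename φ [] [] = []
  degree-rename φ ((c , m) ∷ P) (le ∷ deg) = subst (_≤ _) (sym (length-map φ m)) le ∷ degree-rename φ P deg

  fromℕQ-mono : ∀ {m n} → m ≤ n → fromℕQ m ≤ℚ fromℕQ n
  fromℕQ-mono {m} {n} le = ℚP.toℚᵘ-cancel-≤ (ℚᵘP.≤-trans (ℚᵘP.≤-reflexive (ℚP.toℚᵘ-fromℚᵘ (mkℚᵘ (pos m) 0)))
    (ℚᵘP.≤-trans (*≤* (subst₂ ℤ._≤_ (sym (ℤP.*-identityʳ (pos m))) (sym (ℤP.*-identityʳ (pos n))) (+≤+ le)))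
      (ℚᵘP.≤-reflexive (ℚᵘP.≃-sym (ℚP.toℚᵘ-fromℚᵘ (mkℚᵘ (pos n) 0))))))

  fromℕQ-cancel : ∀ {m n} → fromℕQ m ≤ℚ fromℕQ n → m ≤ n
  fromℕQ-cancel {m} {n} le with ℚᵘP.≤-trans (ℚᵘP.≤-reflexive (ℚᵘP.≃-sym (ℚP.toℚᵘ-fromℚᵘ (mkℚᵘ (pos m) 0))))
      (ℚᵘP.≤-trans (ℚP.toℚᵘ-mono-≤ le) (ℚᵘP.≤-reflexive (ℚP.toℚᵘ-fromℚᵘ (mkℚᵘ (pos n) 0))))
  ... | *≤* e with subst₂ ℤ._≤_ (ℤP.*-identityʳ (pos m)) (ℤP.*-identityʳ (pos n)) e
  ...   | +≤+ le′ = le′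

  fromℕQ-* : ∀ m n → fromℕQ (m ℕ.* n) ≡ fromℕQ m * fromℕQ n
  fromℕQ-* m n = trans (cong ι (ℤP.pos-* m n)) (ι-* (pos m) (pos n))

  fromℕQ-nonNeg : ∀ {n} → ℚ.NonNegative (fromℕQ n)
  fromℕQ-nonNeg {n} = ℚ.nonNegative (fromℕQ-mono {0} {n} z≤n)

  module _ {δ : ℚ} (0<δ : 0ℚ <ℚ δ) where
    private
      instance
        δ-pos : ℚ.Positive δ
        δ-pos = ℚ.positive 0<δ
        δ-nonNeg : ℚ.NonNegative δ
        δ-nonNeg = ℚP.pos⇒nonNeg δ

    trivial-density : 1ℚ ≤ℚ δ → ∀ {a b} → a ≤ b → fromℕQ a ≤ℚ δ * fromℕQ b
    trivial-density 1≤δ {a} {b} le = ℚP.≤-trans (fromℕQ-mono le) (subst (_≤ℚ δ * fromℕQ b) (ℚP.*-identityˡ (fromℕQ b)) (ℚP.*-monoʳ-≤-nonNeg (fromℕQ b) {{fromℕQ-nonNeg {b}}} 1≤δ))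

    module _ (δ≤1 : δ ≤ℚ 1ℚ) where
      power≤1 : ∀ n → δ ^Q n ≤ℚ 1ℚ
      power≤1 zero = ℚP.≤-refl
      power≤1 (suc n) = ℚP.≤-trans (subst (δ * (δ ^Q n) ≤ℚ_) (ℚP.*-identityʳ δ) (ℚP.*-monoˡ-≤-nonNeg δ (power≤1 n))) δ≤1

      power≤δ : ∀ n → δ ^Q suc n ≤ℚ δ
      power≤δ n = subst (δ * (δ ^Q n) ≤ℚ_) (ℚP.*-identityʳ δ) (ℚP.*-monoˡ-≤-nonNeg δ (power≤1 n))

      large-p : ∀ {C p} → fromℕQ C ≤ℚ fromℕQ p * (δ ^Q C) → C ≤ p
      large-p {C} {p} le = fromℕQ-cancel (ℚP.≤-trans le (subst (fromℕQ p * (δ ^Q C) ≤ℚ_) (ℚP.*-identityʳ (fromℕQ p))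
        (ℚP.*-monoˡ-≤-nonNeg (fromℕQ p) {{fromℕQ-nonNeg {p}}} (power≤1 C))))

      -- With c = `suc C` and P the prime: a P ≤ b c ≤ b P δ^c ≤ b P δ. One factor δ is kept, the
      -- others are at most 1.
      density : ∀ {C p} → fromℕQ (suc C) ≤ℚ fromℕQ (suc p) * (δ ^Q suc C) → ∀ {a b} → a ℕ.* suc p ≤ b ℕ.* suc C → fromℕQ a ≤ℚ δ * fromℕQ b
      density {C} {p} le {a} {b} ab = ℚP.*-cancelʳ-≤-pos (fromℕQ (suc p)) {{ℚ.positive (ℚP.<-≤-trans (ℚP.positive⁻¹ 1ℚ) (fromℕQ-mono {1} {suc p} (s≤s z≤n)))}} (begin
        fromℕQ a * P ≡⟨ fromℕQ-* a (suc p) ⟨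
        fromℕQ (a ℕ.* suc p) ≤⟨ fromℕQ-mono ab ⟩
        fromℕQ (b ℕ.* suc C) ≡⟨ fromℕQ-* b (suc C) ⟩
        fromℕQ b * fromℕQ (suc C) ≤⟨ ℚP.*-monoˡ-≤-nonNeg (fromℕQ b) {{fromℕQ-nonNeg {b}}} (ℚP.≤-trans le (ℚP.*-monoˡ-≤-nonNeg P {{fromℕQ-nonNeg {suc p}}} (power≤δ C))) ⟩
        fromℕQ b * (P * δ) ≡⟨ solve 3 (λ b p d → b :* (p :* d) := d :* b :* p) refl (fromℕQ b) P δ ⟩
        δ * fromℕQ b * P ∎)
        where
        open ℚP.≤-Reasoning
        P = fromℕQ (suc p)

open RationalFunctions

-- The rationals that are integral at p, and their residues.

module Localisation (p : ℕ) {{_ : NonZero p}} (p-prime : Prime p) (2<p : 2 < p) where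
  open import Data.Rational using (_+_; _*_; -_; _-_)
  open ℚSolver using (solve; _:=_; con; _:+_; _:*_; :-_; _:-_)
  open PrimeField p p-prime 2<p
  module 𝔽 = FiniteField field-Fp
  open FieldLemmas field-Fp using (-≡0)
  F = Fin p

  Unit : ℤ → Set
  Unit D = ¬ (pos p ℤD.∣ D)

  unit-* : ∀ {a b} → Unit a → Unit b → Unit (a ℤ.* b)
  unit-* {a} {b} ua ub d = [ ua ∘ ℤD.∣ᵤ⇒∣ , ub ∘ ℤD.∣ᵤ⇒∣ ]′
    (euclidsLemma ℤ.∣ a ∣ ℤ.∣ b ∣ p-prime (subst (p ℕD.∣_) (ℤP.abs-* a b) (ℤD.∣⇒∣ᵤ d)))

  unit-small : ∀ n → n ≢ 0 → n < p → Unit (pos n)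
  unit-small n n≢0 n<p d = ℕP.<⇒≱ n<p (ℕD.∣⇒≤ {{ℕ.≢-nonZero n≢0}} (ℤD.∣⇒∣ᵤ d))

  unit-1 : Unit (pos 1)
  unit-1 = unit-small 1 (λ ()) (ℕP.<-trans (s≤s (s≤s z≤n)) 2<p)

  unit-≢0 : ∀ {D} → Unit D → D ≢ pos 0
  unit-≢0 u refl = u (ℤD.divides (pos 0) refl)

  -- Membership in ℤ₍ₚ₎. Fractions need not be reduced, which makes closure under the operations
  -- immediate; `denominator-unit` returns to the reduced form and with it to decidability.
  record InR (x : ℚ) : Set where
    constructor fraction
    field
      {denominator} : ℤ
      {numerator}   : ℤ
      unit          : Unit denominator
      equation      : ι denominator * x ≡ ι numerator

  R-ι : ∀ z → InR (ι z)
  R-ι z = fraction {numerator = z} unit-1 (solve 1 (λ x → con (pos 1) :* x := x) refl (ι z))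

  R-+ : ∀ {x y} → InR x → InR y → InR (x + y)
  R-+ {x} {y} (fraction {D} {z} uD e) (fraction {E} {w} uE e′) = fraction {numerator = E ℤ.* z ℤ.+ D ℤ.* w} (unit-* uD uE) (begin
    ι (D ℤ.* E) * (x + y) ≡⟨ cong (_* (x + y)) (ι-* D E) ⟩
    ι D * ι E * (x + y) ≡⟨ solve 4 (λ d e x y → d :* e :* (x :+ y) := e :* (d :* x) :+ d :* (e :* y)) refl (ι D) (ι E) x y ⟩
    ι E * (ι D * x) + ι D * (ι E * y) ≡⟨ cong₂ (λ a b → ι E * a + ι D * b) e e′ ⟩
    ι E * ι z + ι D * ι w ≡⟨ trans (cong₂ _+_ (sym (ι-* E z)) (sym (ι-* D w))) (sym (ι-+ (E ℤ.* z) (D ℤ.* w))) ⟩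
    ι (E ℤ.* z ℤ.+ D ℤ.* w) ∎)
    where open ≡-Reasoning

  R-* : ∀ {x y} → InR x → InR y → InR (x * y)
  R-* {x} {y} (fraction {D} {z} uD e) (fraction {E} {w} uE e′) = fraction {numerator = z ℤ.* w} (unit-* uD uE)
    (trans (cong (_* (x * y)) (ι-* D E)) (trans (solve 4 (λ d e x y → d :* e :* (x :* y) := (d :* x) :* (e :* y)) refl (ι D) (ι E) x y)
      (trans (cong₂ _*_ e e′) (sym (ι-* z w)))))

  R-- : ∀ {x y} → InR x → InR y → InR (x - y)
  R-- {x} {y} rx ry = subst InR (solve 2 (λ x y → x :+ (:- con (pos 1)) :* y := x :- y) refl x y) (R-+ rx (R-* (R-ι -[1+ 0 ]) ry))

  R-cancel : ∀ {D w x q} → Unit D → Unit w → ι D * x ≡ ι w → InR (x * q) → InR q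
  R-cancel {D} {w} {x} {q} uD uw e (fraction {E} {z} uE e′) = fraction {numerator = D ℤ.* z} (unit-* uw uE) (begin
    ι (w ℤ.* E) * q ≡⟨ cong (_* q) (trans (ι-* w E) (cong (_* ι E) (sym e))) ⟩
    ι D * x * ι E * q ≡⟨ solve 4 (λ d x e q → d :* x :* e :* q := d :* (e :* (x :* q))) refl (ι D) x (ι E) q ⟩
    ι D * (ι E * (x * q)) ≡⟨ trans (cong (ι D *_) e′) (sym (ι-* D z)) ⟩
    ι (D ℤ.* z) ∎)
    where open ≡-Reasoning

  clear-fraction : ∀ D z x → ι D * x ≡ ι z → D ℤ.* ↥ x ≡ z ℤ.* ↧ x
  clear-fraction D z x e = ι-injective (trans (ι-* D (↥ x)) (trans (cong (ι D *_) (sym (ι-denominator x))) (trans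
    (solve 3 (λ a b c → a :* (b :* c) := (a :* c) :* b) refl (ι D) (ι (↧ x)) x) (trans (cong (_* ι (↧ x)) e) (sym (ι-* z (↧ x)))))))

  -- From D n = z d: a prime dividing the reduced denominator d but not D would divide n too,
  -- against coprimality.
  denominator-unit : ∀ {x} → InR x → Unit (↧ x)
  denominator-unit {x@(mkℚ n d c)} (fraction {D} {z} uD e) p∣d =
      ℕP.<⇒≢ (ℕP.<-trans (s≤s (s≤s z≤n)) 2<p) (sym (Coprimality.recompute c (p∣n , ℤD.∣⇒∣ᵤ p∣d)))
    where
    p∣n : p ℕD.∣ ℤ.∣ n ∣
    p∣n = [ ⊥-elim ∘ uD ∘ ℤD.∣ᵤ⇒∣ , (λ d → d) ]′ (euclidsLemma ℤ.∣ D ∣ ℤ.∣ n ∣ p-prime (subst (p ℕD.∣_) (ℤP.abs-* D n)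
      (ℤD.∣⇒∣ᵤ (subst (pos p ℤD.∣_) (sym (clear-fraction D z x e)) (ℤD.∣n⇒∣m*n z p∣d)))))

  InR? : ∀ x → Dec (InR x)
  InR? x with pos p ℤD.∣? ↧ x
  ... | no u    = yes (fraction {numerator = ↥ x} u (ι-denominator x))
  ... | yes p∣d = no λ r → denominator-unit r p∣d

  lift : F → ℚ
  lift a = ι (pos (toℕ a))

  𝕡 : ℚ
  𝕡 = ι (pos p)

  -- ρ x a: the rational x is p-integral with residue a.
  record ρ (x : ℚ) (a : F) : Set where
    constructor reduction
    field
      {quotient} : ℚ
      integral   : InR quotient
      equation   : x ≡ lift a + 𝕡 * quotient

  ρ-ℕ : ∀ n → ρ (ι (pos n)) (residue n)
  ρ-ℕ n = reduction (R-ι (pos (n ℕ./ p))) (trans (cong (ι ∘ pos) (trans (m≡m%n+[m/n]*n n p) (cong₂ ℕ._+_ (sym (toℕ-residue n)) (ℕP.*-comm (n ℕ./ p) p))))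
    (trans (ι-+ (pos (toℕ (residue n))) (pos (p ℕ.* (n ℕ./ p)))) (cong (lift (residue n) +_) (trans (cong ι (ℤP.pos-* p (n ℕ./ p))) (ι-* (pos p) (pos (n ℕ./ p)))))))

  ρ-lift : ∀ a → ρ (lift a) a
  ρ-lift a = reduction (R-ι (pos 0)) (solve 2 (λ a p → a := a :+ p :* con (pos 0)) refl (lift a) 𝕡)

  ρ-shift : ∀ {x a y} → ρ x a → InR y → ρ (x + 𝕡 * y) a
  ρ-shift {x} {a} {y} (reduction {z} rz e) ry = reduction (R-+ rz ry) (trans (cong (_+ 𝕡 * y) e) (solve 4 (λ a p z y → a :+ p :* z :+ p :* y := a :+ p :* (z :+ y)) refl (lift a) 𝕡 z y))

  ρ-R : ∀ {x a} → ρ x a → InR x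
  ρ-R {a = a} (reduction {y} ry refl) = R-+ (R-ι (pos (toℕ a))) (R-* (R-ι (pos p)) ry)

  ρ-+ : ∀ {x y a b} → ρ x a → ρ y b → ρ (x + y) (a 𝔽.+ b)
  ρ-+ {a = a} {b} (reduction {x} rx refl) (reduction {y} ry refl) = subst (λ t → ρ t (a 𝔽.+ b))
    (trans (cong (_+ 𝕡 * (x + y)) (ι-+ (pos (toℕ a)) (pos (toℕ b)))) (solve 5 (λ a b p x y → a :+ b :+ p :* (x :+ y) := a :+ p :* x :+ (b :+ p :* y)) refl (lift a) (lift b) 𝕡 x y))
    (ρ-shift (ρ-ℕ (toℕ a ℕ.+ toℕ b)) (R-+ rx ry))

  ρ-* : ∀ {x y a b} → ρ x a → ρ y b → ρ (x * y) (a 𝔽.* b)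
  ρ-* {a = a} {b} (reduction {x} rx refl) (reduction {y} ry refl) = subst (λ t → ρ t (a 𝔽.* b))
    (trans (cong (_+ 𝕡 * (lift a * y + x * lift b + 𝕡 * (x * y))) (trans (cong ι (ℤP.pos-* (toℕ a) (toℕ b))) (ι-* (pos (toℕ a)) (pos (toℕ b)))))
      (solve 5 (λ a b p x y → a :* b :+ p :* (a :* y :+ x :* b :+ p :* (x :* y)) := (a :+ p :* x) :* (b :+ p :* y)) refl (lift a) (lift b) 𝕡 x y))
    (ρ-shift (ρ-ℕ (toℕ a ℕ.* toℕ b)) (R-+ (R-+ (R-* (R-ι (pos (toℕ a))) ry) (R-* rx (R-ι (pos (toℕ b))))) (R-* (R-ι (pos p)) (R-* rx ry))))

  ρ-unit : ∀ {x a} → ρ x a → a ≢ 𝔽.0# → Σ ℤ λ D → Unit D × Σ ℤ λ w → Unit w × ι D * x ≡ ι w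
  ρ-unit {x} {a} (reduction {y} (fraction {D} {z} uD e) refl) a≢0 = D , uD , D ℤ.* pos (toℕ a) ℤ.+ pos p ℤ.* z ,
    (λ d → unit-* uD (unit-small (toℕ a) (toℕ-≢0 a≢0) (toℕ<n a)) (ℤD.∣m+n∣n⇒∣m {m = D ℤ.* pos (toℕ a)} d (ℤD.∣m⇒∣m*n z ℤD.∣-refl))) ,
    trans (solve 4 (λ d a p y → d :* (a :+ p :* y) := d :* a :+ p :* (d :* y)) refl (ι D) (lift a) 𝕡 y)
      (trans (cong (λ t → ι D * lift a + 𝕡 * t) e) (trans (cong₂ _+_ (sym (ι-* D (pos (toℕ a)))) (sym (ι-* (pos p) z))) (sym (ι-+ (D ℤ.* pos (toℕ a)) (pos p ℤ.* z)))))

  ρ-neg : ∀ {x a} → ρ x a → ρ (- x) (𝔽.- a)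
  ρ-neg {x} {a} r = subst (ρ (- x)) (𝔽.Solver.solve 1 (λ t → (𝔽.Solver.:- 𝔽.Solver.con (pos 1)) 𝔽.Solver.:* t 𝔽.Solver.:= 𝔽.Solver.:- t) refl a)
    (subst (λ y → ρ y ((𝔽.- 𝔽.1#) 𝔽.* a)) (solve 1 (λ x → (:- con (pos 1)) :* x := :- x) refl x) (ρ-* ρ-minus-one r))
    where
    minus-one : ∀ p → 0 < p → pos (p ℕ.∸ 1) ℤ.+ pos p ℤ.* -[1+ 0 ] ≡ -[1+ 0 ]
    minus-one (suc k) _ = trans (cong (λ z → pos k ℤ.+ z) (trans (ℤP.*-comm (pos (suc k)) -[1+ 0 ]) (ℤP.-1*i≡-i (pos (suc k)))))
      (trans (ℤP.⊖-≤ (ℕP.n≤1+n k)) (cong (λ m → ℤ.- pos m) (ℕP.m+n∸n≡m 1 k)))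
    ρ-minus-one : ρ (- 1ℚ) (𝔽.- 𝔽.1#)
    ρ-minus-one = subst (ρ (- 1ℚ)) (cong (λ k → residue (p ℕ.∸ k)) (sym (trans (toℕ-residue 1) (m<n⇒m%n≡m (ℕP.<-trans (s≤s (s≤s z≤n)) 2<p)))))
      (subst (λ t → ρ t (residue (p ℕ.∸ 1)))
        (trans (sym (trans (ι-+ (pos (p ℕ.∸ 1)) (pos p ℤ.* -[1+ 0 ])) (cong (ι (pos (p ℕ.∸ 1)) +_) (ι-* (pos p) -[1+ 0 ])))) (cong ι (minus-one p (ℕP.<-trans (s≤s z≤n) 2<p))))
        (ρ-shift (ρ-ℕ (p ℕ.∸ 1)) (R-ι -[1+ 0 ])))

  ρ-- : ∀ {x y a b} → ρ x a → ρ y b → ρ (x - y) (a 𝔽.- b)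
  ρ-- r r′ = ρ-+ r (ρ-neg r′)

  ρ-cancel : ∀ {x a q} → ρ x a → a ≢ 𝔽.0# → InR (x * q) → InR q
  ρ-cancel r n i with ρ-unit r n
  ... | D , uD , w , uw , e = R-cancel uD uw e i

  ρ-inverse : ∀ {x a} → ρ x a → a ≢ 𝔽.0# → Σ ℚ λ x⁻¹ → x * x⁻¹ ≡ 1ℚ × InR x⁻¹
  ρ-inverse {x} r n = x⁻¹ , x*x⁻¹ , ρ-cancel r n (subst InR (sym x*x⁻¹) (R-ι (pos 1)))
    where
    u = ρ-unit r n
    x≢0 : x ≢ 0ℚ
    x≢0 refl = unit-≢0 (proj₁ (proj₂ (proj₂ (proj₂ u)))) (ι-injective (trans (sym (proj₂ (proj₂ (proj₂ (proj₂ u)))))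
      (solve 1 (λ d → d :* con (pos 0) := con (pos 0)) refl (ι (proj₁ u)))))
    x⁻¹ : ℚ
    x⁻¹ = ℚ.1/_ x {{ℚ.≢-nonZero x≢0}}
    x*x⁻¹ : x * x⁻¹ ≡ 1ℚ
    x*x⁻¹ = ℚP.*-inverseʳ x {{ℚ.≢-nonZero x≢0}}

  𝕡⁻¹-data : Σ ℚ λ y → 𝕡 * y ≡ 1ℚ
  𝕡⁻¹-data = ℚ.1/_ 𝕡 {{nz}} , ℚP.*-inverseʳ 𝕡 {{nz}}
    where
    nz : ℚ.NonZero 𝕡
    nz = ℚ.≢-nonZero λ e → ℕP.<⇒≢ (ℕP.<-trans (s≤s z≤n) 2<p) (sym (ℤP.+-injective (ι-injective {pos p} {pos 0} e)))

  𝕡⁻¹ : ℚ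
  𝕡⁻¹ = proj₁ 𝕡⁻¹-data

  -- With its converse `integral-ρ-0` this makes vanishing modulo p an instance of integrality,
  -- namely after division by p. Zeros over the prime field and integrality of rational polynomials
  -- are then one and the same question.
  ρ-0-integral : ∀ {x} → ρ x 𝔽.0# → InR (𝕡⁻¹ * x)
  ρ-0-integral (reduction {y} ry refl) = subst InR (begin
    y ≡⟨ solve 1 (λ y → y := con (pos 1) :* y) refl y ⟩
    1ℚ * y ≡⟨ cong (_* y) (proj₂ 𝕡⁻¹-data) ⟨
    𝕡 * 𝕡⁻¹ * y ≡⟨ solve 3 (λ p q y → p :* q :* y := q :* (con (pos 0) :+ p :* y)) refl 𝕡 𝕡⁻¹ y ⟩
    𝕡⁻¹ * (0ℚ + 𝕡 * y) ≡⟨ cong (λ z → 𝕡⁻¹ * (z + 𝕡 * y)) (cong (ι ∘ pos) (sym toℕ-0)) ⟩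
    𝕡⁻¹ * (lift 𝔽.0# + 𝕡 * y) ∎) ry
    where
    open ≡-Reasoning
    toℕ-0 : toℕ 𝔽.0# ≡ 0
    toℕ-0 = trans (toℕ-residue 0) (m<n⇒m%n≡m (ℕP.<-trans (s≤s z≤n) 2<p))

  integral-ρ-0 : ∀ {x a} → ρ x a → InR (𝕡⁻¹ * x) → a ≡ 𝔽.0#
  integral-ρ-0 {x} {a} r i with a 𝔽.≟ 𝔽.0#
  ... | yes e = e
  ... | no n = ⊥-elim (not-integral (ρ-cancel r n (subst InR (ℚP.*-comm 𝕡⁻¹ x) i)))
    where
    not-integral : ¬ InR 𝕡⁻¹
    not-integral (fraction {D} {z} uD e) = uD (ℤD.divides z (ι-injective (begin
      ι D ≡⟨ solve 1 (λ d → d := d :* con (pos 1)) refl (ι D) ⟩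
      ι D * 1ℚ ≡⟨ cong (ι D *_) (proj₂ 𝕡⁻¹-data) ⟨
      ι D * (𝕡 * 𝕡⁻¹) ≡⟨ solve 3 (λ d p q → d :* (p :* q) := d :* q :* p) refl (ι D) 𝕡 𝕡⁻¹ ⟩
      ι D * 𝕡⁻¹ * 𝕡 ≡⟨ cong (_* 𝕡) e ⟩
      ι z * 𝕡 ≡⟨ ι-* z (pos p) ⟨
      ι (z ℤ.* pos p) ∎)))
      where open ≡-Reasoning

  ρ-≡ : ∀ {x a b} → ρ x a → ρ x b → a ≡ b
  ρ-≡ {x} r r′ = -≡0 (integral-ρ-0 (ρ-- r r′) (subst InR (solve 2 (λ q x → con (pos 0) := q :* (x :- x)) refl 𝕡⁻¹ x) (R-ι (pos 0))))

  -- Induction through divided differences: distinct residues differ by units, so the divided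
  -- difference at the first node is integral at all the others.
  integrality : ∀ n {f} → IsPoly n f → ∀ ts → Unique ts → n < length ts → All (λ t → InR (f (lift t))) ts → ∀ x → InR x → InR (f x)
  integrality zero {f} pf (t ∷ ts) _ _ (r ∷ _) x _ = subst InR (trans (pf (lift t)) (sym (pf x))) r
  integrality (suc n) {f} pf (t ∷ ts) (d ∷ u) (s≤s lt) (r ∷ rs) x rx = by (pf (lift t))
    where
    by : (Σ (ℚ → ℚ) λ g → IsPoly n g × (∀ u → f u ≡ f (lift t) + (u - lift t) * g u)) → InR (f x)
    by (g , pg , eq) = subst InR (sym (eq x)) (R-+ r (R-* (R-- rx (R-ι (pos (toℕ t)))) (integrality n pg ts u lt (All.zipWith (λ { (ne , r′) → quotient ne r′ }) (d , rs)) x rx)))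
      where
      quotient : ∀ {u} → t ≢ u → InR (f (lift u)) → InR (g (lift u))
      quotient {u} ne r′ = ρ-cancel (ρ-- {lift u} {lift t} {u} {t} (ρ-lift u) (ρ-lift t)) (λ z → ne (sym (-≡0 z)))
        (subst InR (trans (cong (_- f (lift t)) (eq (lift u))) (solve 3 (λ a d g → a :+ d :* g :- a := d :* g) refl (f (lift t)) (lift u - lift t) (g (lift u)))) (R-- r′ r))

-- Curves as reductions of rational polynomial functions.

module PolynomialCurves (p : ℕ) {{_ : NonZero p}} (p-prime : Prime p) (2<p : 2 < p) where
  open import Data.Rational using (_+_; _*_; -_; _-_)
  open ℚSolver using (solve; _:=_; con; _:+_; _:*_; :-_; _:-_)
  open PrimeField p p-prime 2<p
  open Localisation p p-prime 2<p
  open FieldLemmas field-Fp using (*-cancelˡ)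

  -- No condition is imposed on coefficients: only the values at the standard lifts of the residues
  -- are tied to `g`.
  record Curve (D : ℕ) (g : F → F) : Set where
    field
      lifted   : ℚ → ℚ
      poly     : IsPoly D lifted
      reduces  : ∀ t → ρ (lifted (lift t)) (g t)
  open Curve

  few-integral : ∀ {D f} → IsPoly D f → ∀ x → InR x → ¬ InR (f x) → Few field-Fp D (λ t → InR (f (lift t)))
  few-integral {D} {f} pf x rx n ts u rs = ℕP.≮⇒≥ λ lt → n (integrality D pf ts u lt rs x rx)

  curves : CurveTheory field-Fp
  curves = record
    { Curve = Curve
    ; curve-cong = λ e c → record { lifted = lifted c ; poly = poly c ; reduces = λ t → subst (ρ _) (e t) (reduces c t) }
    ; curve-const = λ a → record { lifted = λ _ → lift a ; poly = poly-const 0 (lift a) ; reduces = λ _ → ρ-lift a }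
    ; curve-id = record { lifted = λ t → t ; poly = poly-id ; reduces = ρ-lift }
    ; curve-+ = λ {D} c d → record { lifted = λ t → lifted c t + lifted d t ; poly = poly-+ D (poly c) (poly d) ; reduces = λ t → ρ-+ (reduces c t) (reduces d t) }
    ; curve-* = λ {D} {E} c d → record { lifted = λ t → lifted c t * lifted d t ; poly = poly-* D E (poly c) (poly d) ; reduces = λ t → ρ-* (reduces c t) (reduces d t) }
    ; curve-≤ = λ le c → record { lifted = lifted c ; poly = poly-≤ le (poly c) ; reduces = reduces c }
    -- The zeros of the curve are the residues at which its lift divided by p is integral.
    ; curve-few = λ {D} c t₀ n ts u zs → few-integral (poly-scale D 𝕡⁻¹ (poly c)) (lift t₀) (R-ι (pos (toℕ t₀))) (λ i → n (integral-ρ-0 (reduces c t₀) i))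
        ts u (All.map (λ {t} z → ρ-0-integral (subst (ρ (lifted c (lift t))) z (reduces c t))) zs)
    }

  R-power : ∀ {x} n → InR x → InR (power x n)
  R-power zero r = R-ι (pos 1)
  R-power (suc n) r = R-* r (R-power n r)

  power-cancel : ∀ {x a y} n → ρ x a → a ≢ 𝔽.0# → InR (power x n * y) → InR y
  power-cancel {y = y} zero r nz i = subst InR (ℚP.*-identityˡ y) i
  power-cancel {x} {y = y} (suc n) r nz i = power-cancel n r nz (ρ-cancel r nz (subst InR (ℚP.*-assoc x (power x n) y) i))

  module _ {I : Set} (s : ℕ) (P : Poly I) (deg : Degree≤ s P) where
    -- P is not p-integral at some lift of the point n.
    Bad : (I → F) → Set
    Bad n = Σ (I → ℚ) λ X → (∀ v → ρ (X v) (n v)) × ¬ InR (eval P X)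

    -- y - x · `lift c` reduces to zero, hence is p times an integral number; dividing by the unit x
    -- shows that y / x differs from `lift c` by a multiple of p.
    quotient-lift : ∀ {x y a b c} → ρ x a → a ≢ 𝔽.0# → ρ y b → a 𝔽.* c ≡ b → Σ ℚ λ z → y ≡ x * z × ρ z c
    quotient-lift {x} {y} {a} {b} {c} rx nz ry e = z , sym x*z , lifts
      where
      inverse-x = ρ-inverse rx nz
      x⁻¹ = proj₁ inverse-x
      z = x⁻¹ * y
      x*z : x * z ≡ y
      x*z = trans (sym (ℚP.*-assoc x x⁻¹ y)) (trans (cong (_* y) (proj₁ (proj₂ inverse-x))) (ℚP.*-identityˡ y))
      difference : ρ (y - x * lift c) 𝔽.0#
      difference = subst (ρ (y - x * lift c)) (trans (cong (λ w → b 𝔽.- w) e) (𝔽.-‿inverseʳ b)) (ρ-- ry (ρ-* rx (ρ-lift c)))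
      lifts : ρ z c
      lifts = subst (λ w → ρ w c) (begin
        lift c + 𝕡 * (x⁻¹ * (𝕡⁻¹ * (y - x * lift c)))
          ≡⟨ solve 6 (λ l p i q y x → l :+ p :* (i :* (q :* (y :- x :* l))) := l :+ (p :* q) :* (i :* y :- (x :* i) :* l)) refl (lift c) 𝕡 x⁻¹ 𝕡⁻¹ y x ⟩
        lift c + (𝕡 * 𝕡⁻¹) * (x⁻¹ * y - (x * x⁻¹) * lift c)
          ≡⟨ cong₂ (λ s t → lift c + s * (x⁻¹ * y - t * lift c)) (proj₂ 𝕡⁻¹-data) (proj₁ (proj₂ inverse-x)) ⟩
        lift c + 1ℚ * (x⁻¹ * y - 1ℚ * lift c) ≡⟨ solve 2 (λ l w → l :+ con (pos 1) :* (w :- con (pos 1) :* l) := w) refl (lift c) (x⁻¹ * y) ⟩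
        x⁻¹ * y ∎) (ρ-shift (ρ-lift c) (R-* (proj₂ (proj₂ inverse-x)) (ρ-0-integral difference)))
        where open ≡-Reasoning

    -- The curve is translated by a multiple of p so that it passes through the given lift of n₀ exactly.
    bad-along : ∀ {D} (N : I → F → F) (Dn : F → F) → (∀ v → Curve D (N v)) → Curve D Dn → ∀ t₀ n₀ → Dn t₀ ≢ 𝔽.0# →
      (∀ v → Dn t₀ 𝔽.* n₀ v ≡ N v t₀) → Bad n₀ →
      Σ (F → Set) λ Q → (∀ t → Dec (Q t)) × Few field-Fp (s ℕ.* D) Q ×
        (∀ t n → Dn t ≢ 𝔽.0# → (∀ v → Dn t 𝔽.* n v ≡ N v t) → ¬ Q t → Bad n)
    bad-along {D} N Dn cN cD t₀ n₀ nz₀ e₀ (X₀ , r₀ , bad₀) =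
        (λ t → InR (f (lift t))) , (λ t → InR? (f (lift t))) , few-integral f-poly (lift t₀) (R-ι (pos (toℕ t₀))) f-bad , transfer
      where
      D̃ = lifted cD
      Z₀ : ∀ v → Σ ℚ λ z → lifted (cN v) (lift t₀) ≡ D̃ (lift t₀) * z × ρ z (n₀ v)
      Z₀ v = quotient-lift (reduces cD t₀) nz₀ (reduces (cN v) t₀) (e₀ v)
      correction : I → ℚ
      correction v = X₀ v - proj₁ (Z₀ v)
      correction-0 : ∀ v → ρ (correction v) 𝔽.0#
      correction-0 v = subst (ρ (correction v)) (𝔽.-‿inverseʳ (n₀ v)) (ρ-- (r₀ v) (proj₂ (proj₂ (Z₀ v))))
      Ñ : I → ℚ → ℚ
      Ñ v t = lifted (cN v) t + correction v * D̃ t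
      f : ℚ → ℚ
      -- The value of P on the translated curve, times the s-th power of the denominator. That power
      -- is a unit wherever the denominator does not reduce to zero, so there f and P fail to be
      -- integral together.
      f t = homogenised s P (D̃ t) (λ v → Ñ v t)
      f-poly : IsPoly (s ℕ.* D) f
      f-poly = poly-homogenised s P deg (poly cD) (λ v → poly-+ D (poly (cN v)) (poly-scale D (correction v) (poly cD)))
      f-bad : ¬ InR (f (lift t₀))
      f-bad i = bad₀ (power-cancel s (reduces cD t₀) nz₀ (subst InR (homogenised-eval s P deg (D̃ (lift t₀)) (λ v →
        trans (cong (_+ correction v * D̃ (lift t₀)) (proj₁ (proj₂ (Z₀ v)))) (solve 3 (λ d z x → d :* z :+ (x :- z) :* d := d :* x) refl (D̃ (lift t₀)) (proj₁ (Z₀ v)) (X₀ v)))) i))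
      Ñ-reduces : ∀ t v → ρ (Ñ v (lift t)) (N v t)
      Ñ-reduces t v = subst (ρ _) (𝔽.Solver.solve 2 (λ n d → n 𝔽.Solver.:+ 𝔽.Solver.con (pos 0) 𝔽.Solver.:* d 𝔽.Solver.:= n) refl (N v t) (Dn t))
        (ρ-+ (reduces (cN v) t) (ρ-* (correction-0 v) (reduces cD t)))
      transfer : ∀ t n → Dn t ≢ 𝔽.0# → (∀ v → Dn t 𝔽.* n v ≡ N v t) → ¬ InR (f (lift t)) → Bad n
      transfer t n nz e nq = (λ v → proj₁ (X v)) , (λ v → proj₂ (proj₂ (X v))) , λ i → nq (subst InR (sym (homogenised-eval s P deg (D̃ (lift t)) (λ v → proj₁ (proj₂ (X v)))))
          (R-* (R-power s (ρ-R (reduces cD t))) i))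
        where
        X : ∀ v → Σ ℚ λ z → Ñ v (lift t) ≡ D̃ (lift t) * z × ρ z (n v)
        X v = quotient-lift (reduces cD t) nz (Ñ-reduces t v) (e v)

-- Integrality tested on residues, and integers among p-integral numbers.

lookup-concat : ∀ {A : Set} {m n} (xss : Vec (Vec A n) m) i j → lookup (Vec.concat xss) (combine i j) ≡ lookup (lookup xss i) j
lookup-concat (xs Vec.∷ xss) Fin.zero j = VecP.lookup-++ˡ xs (Vec.concat xss) j
lookup-concat {n = n} (xs Vec.∷ xss) (Fin.suc i) j = trans (VecP.lookup-++ʳ xs (Vec.concat xss) (combine i j)) (lookup-concat xss i j)

vec-ext : ∀ {A : Set} {n} {xs ys : Vec A n} → (∀ i → lookup xs i ≡ lookup ys i) → xs ≡ ys
vec-ext {xs = xs} {ys} e = trans (sym (VecP.tabulate∘lookup xs)) (trans (VecP.tabulate-cong e) (VecP.tabulate∘lookup ys))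

lookup-shiftP : ∀ {k} q (x m : Vec ℤ k) i → lookup (shiftP q x m) i ≡ lookup x i ℤ.+ pos q ℤ.* lookup m i
lookup-shiftP q x m i = trans (VecP.lookup-zipWith ℤ._+_ i x _) (cong (λ z → lookup x i ℤ.+ z) (VecP.lookup-map i _ m))

module Integrality (p : ℕ) {{_ : NonZero p}} (p-prime : Prime p) (2<p : 2 < p) where
  open import Data.Rational using (_+_; _*_; -_; _-_)
  open ℚSolver using (solve; _:=_; con; _:+_; _:*_; :-_; _:-_)
  open PrimeField p p-prime 2<p
  open Localisation p p-prime 2<p

  module _ (s : ℕ) (s<p : s < p) where
    -- One variable at a time, with s < p residues to spare in each. `Φ` is only assumed polynomial
    -- on lines, a property that survives freezing a variable.
    residues-suffice : ∀ k (Φ : (Fin k → ℚ) → ℚ) → (∀ {Y Z} → (∀ i → Y i ≡ Z i) → Φ Y ≡ Φ Z) →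
      (∀ (L : Fin k → ℚ → ℚ) → (∀ i → IsPoly 1 (L i)) → IsPoly s (λ t → Φ (λ i → L i t))) →
      (∀ (m : Fin k → F) → InR (Φ (lift ∘ m))) → ∀ Y → (∀ i → InR (Y i)) → InR (Φ Y)
    residues-suffice zero Φ resp line h Y _ = subst InR (resp λ ()) (h λ ())
    residues-suffice (suc k) Φ resp line h Y rY = subst InR (resp λ { Fin.zero → refl ; (Fin.suc i) → refl })
        (residues-suffice k (λ Z → Φ (cons (Y Fin.zero) Z)) (λ e → resp λ { Fin.zero → refl ; (Fin.suc i) → e i })
          (λ L pL → poly-cong s (λ t → resp λ { Fin.zero → refl ; (Fin.suc i) → refl }) (line (cons (λ _ → Y Fin.zero) L) λ { Fin.zero → poly-const 1 (Y Fin.zero) ; (Fin.suc i) → pL i }))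
          first (Y ∘ Fin.suc) (rY ∘ Fin.suc))
      where
      first : ∀ m → InR (Φ (cons (Y Fin.zero) (lift ∘ m)))
      first m = integrality s {λ t → Φ (cons t (lift ∘ m))}
        (poly-cong s (λ t → resp λ { Fin.zero → refl ; (Fin.suc i) → refl }) (line (cons (λ t → t) (λ i _ → lift (m i))) λ { Fin.zero → poly-id ; (Fin.suc i) → poly-const 1 (lift (m i)) }))
        (allFin p) (allFin⁺ p) (ℕP.<-≤-trans s<p (ℕP.≤-reflexive (sym (length-tabulate {n = p} (λ i → i)))))
        (All.universal (λ a → subst InR (resp λ { Fin.zero → refl ; (Fin.suc i) → refl }) (h (cons a m))) _) (Y Fin.zero) (rY Fin.zero)

    -- Every lift of n is the standard one plus p Y with Y integral at p, and Y may be restricted to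
    -- residues. So integrality on all lifts is a finite question, and it is already settled by the
    -- integer shifts that occur in `Vp`.
    lifts-suffice : ∀ {k} (P : Poly (Fin k)) → Degree≤ s P → (n : Fin k → F) →
      (∀ (m : Fin k → F) → InR (eval P (λ v → lift (n v) + 𝕡 * lift (m v)))) → ∀ X → (∀ v → ρ (X v) (n v)) → InR (eval P X)
    lifts-suffice {k} P deg n h X r = subst InR (eval-cong P λ v → sym (ρ.equation (r v)))
      (residues-suffice k (λ Y → eval P (λ v → lift (n v) + 𝕡 * Y v)) (λ e → eval-cong P λ v → cong (λ z → lift (n v) + 𝕡 * z) (e v))
        (λ L pL → subst (λ D → IsPoly D (λ t → eval P (λ v → lift (n v) + 𝕡 * L v t))) (ℕP.*-identityʳ s)
          (poly-eval s P deg λ v → poly-+ 1 (poly-const 1 (lift (n v))) (poly-scale 1 𝕡 (pL v))))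
        h (λ v → ρ.quotient (r v)) (λ v → ρ.integral (r v)))

  integer-once : ∀ {x} → InR x → ∀ z → 𝕡 * x ≡ ι z → IsIntQ x
  integer-once {x@(mkℚ n d c)} r z e = ↥ x , trans (sym (ℚP.*-identityˡ x)) (trans (cong (_* x) (cong ι (sym (cong pos d+1≡1)))) (ι-denominator x))
    where
    d∣p : suc d ℕD.∣ p
    d∣p = coprime-divisor (Coprimality.sym (Coprimality.recompute c)) (subst (suc d ℕD.∣_) (trans (ℤP.abs-* (pos p) n) (ℕP.*-comm p ℤ.∣ n ∣))
      (ℤD.∣⇒∣ᵤ (ℤD.divides {pos (suc d)} z (clear-fraction (pos p) z x e))))
    d+1≡1 : suc d ≡ 1
    d+1≡1 = by (prime⇒irreducible p-prime d∣p)
      where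
      by : suc d ≡ 1 ⊎ suc d ≡ p → suc d ≡ 1
      by (inj₁ e) = e
      by (inj₂ e) = ⊥-elim (denominator-unit r (ℤD.∣-reflexive (cong pos (sym e))))

  -- For a number whose denominator is a power of p, integrality at p is integrality; one factor p
  -- is removed at a time, the reduced denominator being both a divisor of p and prime to p.
  integer-powers : ∀ e {x} → InR x → IsIntQ (fromℕQ (p ℕ.^ e) * x) → IsIntQ x
  integer-powers zero {x} r (z , eq) = z , trans (sym (ℚP.*-identityˡ x)) eq
  integer-powers (suc e) {x} r (z , eq) = integer-powers e r (integer-once (R-* (R-ι (pos (p ℕ.^ e))) r) z
    (trans (sym (ℚP.*-assoc 𝕡 (fromℕQ (p ℕ.^ e)) x)) (trans (cong (_* x) (sym (trans (cong ι (ℤP.pos-* p (p ℕ.^ e))) (ι-* (pos p) (pos (p ℕ.^ e)))))) eq)))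

  integer⇒InR : ∀ {x} → IsIntQ x → InR x
  integer⇒InR (z , refl) = R-ι z

-- Lower bounds on p.

threshold : ℕ → ℕ → ℕ
threshold K s = 2 ℕ.* suc (badDegree K s) ℕ.+ (degΔ K 1 ℕ.+ (degΔ K (numeratorDegree K) ℕ.+ (s ℕ.+ (K ℕ.+ 3))))

module _ where
  private
    rearrange₁ : ∀ x a b s K → 2 ℕ.* suc x ℕ.+ (a ℕ.+ (b ℕ.+ (s ℕ.+ (K ℕ.+ 3)))) ≡ suc (2 ℕ.* suc x) ℕ.+ (a ℕ.+ (b ℕ.+ (s ℕ.+ (K ℕ.+ 2))))
    rearrange₁ = solve-∀
    rearrange₂ : ∀ x a b s K → 2 ℕ.* suc x ℕ.+ (a ℕ.+ (b ℕ.+ (s ℕ.+ (K ℕ.+ 3)))) ≡ suc (x ℕ.+ a) ℕ.+ (x ℕ.+ 1 ℕ.+ (b ℕ.+ (s ℕ.+ (K ℕ.+ 3))))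
    rearrange₂ = solve-∀
    rearrange₃ : ∀ x a b s K → 2 ℕ.* suc x ℕ.+ (a ℕ.+ (b ℕ.+ (s ℕ.+ (K ℕ.+ 3)))) ≡ suc (x ℕ.+ b) ℕ.+ (x ℕ.+ 1 ℕ.+ (a ℕ.+ (s ℕ.+ (K ℕ.+ 3))))
    rearrange₃ = solve-∀
    rearrange₄ : ∀ x a b s K → 2 ℕ.* suc x ℕ.+ (a ℕ.+ (b ℕ.+ (s ℕ.+ (K ℕ.+ 3)))) ≡ suc (s ℕ.* 1 ℕ.+ a) ℕ.+ (2 ℕ.* suc x ℕ.+ (b ℕ.+ (K ℕ.+ 2)))
    rearrange₄ = solve-∀
    rearrange₅ : ∀ x a b s K → 2 ℕ.* suc x ℕ.+ (a ℕ.+ (b ℕ.+ (s ℕ.+ (K ℕ.+ 3)))) ≡ suc (suc K) ℕ.+ (2 ℕ.* suc x ℕ.+ (a ℕ.+ (b ℕ.+ (s ℕ.+ 1))))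
    rearrange₅ = solve-∀
    rearrange₆ : ∀ x a b s K → 2 ℕ.* suc x ℕ.+ (a ℕ.+ (b ℕ.+ (s ℕ.+ (K ℕ.+ 3)))) ≡ suc s ℕ.+ (2 ℕ.* suc x ℕ.+ (a ℕ.+ (b ℕ.+ (K ℕ.+ 2))))
    rearrange₆ = solve-∀
    rearrange₇ : ∀ x a b s K → 2 ℕ.* suc x ℕ.+ (a ℕ.+ (b ℕ.+ (s ℕ.+ (K ℕ.+ 3)))) ≡ 3 ℕ.+ (2 ℕ.* suc x ℕ.+ (a ℕ.+ (b ℕ.+ (s ℕ.+ K))))
    rearrange₇ = solve-∀

    below : ∀ {n m p r} → n ≡ m ℕ.+ r → n ≤ p → m ≤ p
    below refl le = ℕP.≤-trans (ℕP.m≤m+n _ _) le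

  module Thresholds {K s p : ℕ} (le : threshold K s ≤ p) where
    private
      x = badDegree K s
      a = degΔ K 1
      b = degΔ K (numeratorDegree K)
    chart : suc (2 ℕ.* suc x) ≤ p
    chart = below (rearrange₁ x a b s K) le
    link : x ℕ.+ a < p
    link = below (rearrange₂ x a b s K) le
    cross : x ℕ.+ b < p
    cross = below (rearrange₃ x a b s K) le
    line : s ℕ.* 1 ℕ.+ a < p
    line = below (rearrange₄ x a b s K) le
    K+2≤p : suc (suc K) ≤ p
    K+2≤p = below (rearrange₅ x a b s K) le
    s<p : s < p
    s<p = below (rearrange₆ x a b s K) le
    2<p : 2 < p
    2<p = below (rearrange₇ x a b s K) le

-- Nice sets as instances of the abstract problem.

module Setting (p : ℕ) {{_ : NonZero p}} (p-prime : Prime p) (2<p : 2 < p) (d K : ℕ)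
  (M : QuadForm p d) (A-sym : Symmetric p M) (A-det : NonDegenerate p M) where

  open PrimeField p p-prime 2<p public
  open FiniteField field-Fp using (F; 0#; 1#; inv; *-inv; -_; _-_; _≟_; +-identityˡ; +-identityʳ; *-identityˡ; *-comm; *-assoc; zeroˡ; zeroʳ; distribˡ; distribʳ; -‿inverseʳ; module Solver) renaming (_+_ to _+ᶠ_; _*_ to _*ᶠ_)
  open FieldLemmas field-Fp
  open Affine field-Fp
  open Determinant field-Fp
  open PolynomialCurves p p-prime 2<p public
  open Solver using (solve; _:=_; con; _:+_; _:*_; :-_; _:-_)

  ΣF≡sum : ∀ n f → ΣF p n f ≡ sum n f
  ΣF≡sum zero    f = refl
  ΣF≡sum (suc n) f = cong (_+F_ p (f Fin.zero)) (ΣF≡sum n (f ∘ Fin.suc))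

  ΣF-cong : ∀ n {f g} → (∀ i → f i ≡ g i) → ΣF p n f ≡ ΣF p n g
  ΣF-cong n e = trans (ΣF≡sum n _) (trans (sum-cong n e) (sym (ΣF≡sum n _)))

  A : Fin d → Fin d → F
  A = QuadForm.A M

  open MatrixForm field-Fp d A A-sym using (pair; matrixForm)

  bil≡pair : ∀ x y → bil p A x y ≡ pair x y
  bil≡pair x y = trans (ΣF≡sum d (λ b → _*F_ p (vecMat p x A b) (y b))) (sum-cong d λ b → cong (λ z → _*F_ p z (y b)) (ΣF≡sum d (λ a → _*F_ p (x a) (A a b))))

  form : Form field-Fp d
  form = matrixForm

  private
    parity : ℕ → F
    parity n = if (n ℕ.% 2) ℕ.≡ᵇ 0 then 1F p else negF p (1F p)

    parity-suc : ∀ n → parity (suc n) ≡ - parity n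
    parity-suc zero = refl
    parity-suc (suc zero) = solve 0 (con (pos 1) := :- (:- con (pos 1))) refl
    parity-suc (suc (suc n)) = parity-suc n

    parity-sign : ∀ {n} (j : Fin n) → parity (toℕ j) ≡ sign j
    parity-sign Fin.zero    = refl
    parity-sign (Fin.suc j) = trans (parity-suc (toℕ j)) (cong -_ (parity-sign j))

  det≡determinant : ∀ n B → Defs.det p n B ≡ determinant n B
  det≡determinant zero B = refl
  det≡determinant (suc n) B = trans (ΣF≡sum (suc n) (λ j → parity (toℕ j) *ᶠ (B Fin.zero j *ᶠ Defs.det p n (λ a b → B (Fin.suc a) (punchIn j b)))))
    (sum-cong (suc n) {g = λ j → sign j *ᶠ (B Fin.zero j *ᶠ determinant n (λ a b → B (Fin.suc a) (punchIn j b)))}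
      λ j → cong₂ _*ᶠ_ (parity-sign j) (cong (λ z → B Fin.zero j *ᶠ z) (det≡determinant n (λ a b → B (Fin.suc a) (punchIn j b)))))

  nondegenerate : ∀ x → (∀ y → pair x y ≡ 0#) → ∀ a → x a ≡ 0#
  nondegenerate = MatrixForm.nondegenerate field-Fp d A A-sym λ e → A-det (trans (det≡determinant d A) e)

  open Form form
  open Ambient field-Fp curves d K form public

  evalIQF-cong : ∀ F {n m : Pt} → n ≋ m → evalIQF p M F n ≡ evalIQF p M F m
  evalIQF-cong F {n} {m} e = cong (λ z → _+F_ p z (IQF.u F)) (cong₂ (_+F_ p)
    (ΣF-cong K λ i → ΣF-cong K λ j → cong (λ z → if _≤F_ p i j then _*F_ p (IQF.b F i j) z else 0F p) (trans (bil≡pair (n i) (n j)) (trans (form-cong (e i) (e j)) (sym (bil≡pair (m i) (m j))))))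
    (ΣF-cong K λ i → ΣF-cong d λ a → cong (_*F_ p (IQF.vs F i a)) (e i a)))

  allB-true : ∀ r (f : Fin r → Bool) → allB p r f ≡ true → ∀ k → f k ≡ true
  allB-true (suc r) f t Fin.zero    = proj₁ (∧-true {f Fin.zero} t)
  allB-true (suc r) f t (Fin.suc k) = allB-true r (f ∘ Fin.suc) (proj₂ (∧-true {f Fin.zero} t)) k

  true-allB : ∀ r (f : Fin r → Bool) → (∀ k → f k ≡ true) → allB p r f ≡ true
  true-allB zero    f t = refl
  true-allB (suc r) f t = ∧-intro (t Fin.zero) (true-allB r (f ∘ Fin.suc) (t ∘ Fin.suc))

  module NiceSet (Ω : SubsetPt p d K) (nice : NiceMSet p M Ω) where
    private
      r = proj₁ nice
      fam = proj₁ (proj₂ nice)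
      zero-set = proj₁ (proj₂ (proj₂ nice))
      a = proj₁ (proj₂ (proj₂ (proj₂ nice)))
      bijective = proj₁ (proj₂ (proj₂ (proj₂ (proj₂ nice))))
      w = proj₁ (proj₂ (proj₂ (proj₂ (proj₂ (proj₂ nice)))))
      nice-fn = proj₂ (proj₂ (proj₂ (proj₂ (proj₂ (proj₂ nice)))))

    Ω-true : ∀ n → Ω n ≡ true → ∀ k → evalIQF p M (fam k) n ≡ 0#
    Ω-true n t k = true-does (evalIQF p M (fam k) n ≟ 0#) (allB-true r _ (trans (sym (zero-set n)) t) k)

    true-Ω : ∀ n → (∀ k → evalIQF p M (fam k) n ≡ 0#) → Ω n ≡ true
    true-Ω n z = trans (zero-set n) (true-allB r _ λ k → does-true (evalIQF p M (fam k) n ≟ 0#) (z k))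

    Ω-respects : Finite.Respects FPt Ω
    Ω-respects {n} {m} e t = true-Ω m λ k → trans (sym (evalIQF-cong (fam k) e)) (Ω-true n t k)

    ψ : Pt → Pt
    ψ n = addPt p (applyL p a n) w

    ψ-cong : ∀ {n m} → n ≋ m → ψ n ≋ ψ m
    ψ-cong {n} {m} e i x = cong (λ z → _+F_ p z (w i x)) (ΣF-cong K λ k → cong (_*F_ p (a k i)) (e k x))

    ψ-injective : ∀ {n m} → ψ n ≋ ψ m → n ≋ m
    ψ-injective {n} {m} e = proj₁ bijective n m λ j x → trans (sym (add-sub (applyL p a n j x) (w j x))) (trans (cong (λ z → z - w j x) (e j x)) (add-sub (applyL p a m j x) (w j x)))

    ψ⁻¹ : Pt → Pt
    ψ⁻¹ y = proj₁ (proj₂ bijective (λ j x → y j x - w j x))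

    ψ-ψ⁻¹ : ∀ y → ψ (ψ⁻¹ y) ≋ y
    ψ-ψ⁻¹ y j x = trans (cong (λ z → z +ᶠ w j x) (proj₂ (proj₂ bijective (λ j x → y j x - w j x)) j x)) (sub-add (y j x) (w j x))

    -- A nice function sees a point only through its Gram matrix, and in an affine way. The
    -- condition i ≤ k is moved into the coefficient to make the affine functional explicit.
    functional : ∀ {f} → NiceFn p M f → Mat → F
    functional (inj₁ (u , _)) g = u
    functional (inj₂ (k , b , u , _)) g = sum K (λ i → (if _≤F_ p i k then b i else 0#) *ᶠ g k i) +ᶠ u

    functional-eval : ∀ {f} (nf : NiceFn p M f) n → f n ≡ functional nf (gram n)
    functional-eval (inj₁ (u , e)) n = e n
    functional-eval (inj₂ (k , b , u , e)) n = trans (e n) (cong (λ z → z +ᶠ u) (trans (ΣF≡sum K _) (sum-cong K λ i →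
        trans (cong (λ z → if _≤F_ p i k then b i *ᶠ z else 0#) (bil≡pair (n k) (n i))) (guarded (_≤F_ p i k) (b i) (gram n k i)))))
      where
      guarded : ∀ c b x → (if c then b *ᶠ x else 0#) ≡ (if c then b else 0#) *ᶠ x
      guarded true  b x = refl
      guarded false b x = sym (zeroˡ x)

    functional-affine : ∀ {f} (nf : NiceFn p M f) {g g′ g″ : Mat} t → (∀ i j → g″ i j ≡ g i j +ᶠ t *ᶠ (g′ i j - g i j)) →
                        functional nf g″ ≡ functional nf g +ᶠ t *ᶠ (functional nf g′ - functional nf g)
    functional-affine (inj₁ (u , _)) t e = constant-interpolates u t
    functional-affine (inj₂ (k , b , u , _)) {g} {g′} {g″} t e = functional-interpolates K (λ i → if _≤F_ p i k then b i else 0#) (g k) (g′ k) (g″ k) u t (e k)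

    vanish? : ∀ g → Dec (∀ k → functional (nice-fn k) g ≡ 0#)
    vanish? g = all? λ k → functional (nice-fn k) g ≟ 0#

    W : Mat → Bool
    W g = does (vanish? g)

    W-is-affine : ∀ {g g′ g″ : Mat} t → (∀ i j → g″ i j ≡ g i j +ᶠ t *ᶠ (g′ i j - g i j)) → W g ≡ true → W g′ ≡ true → W g″ ≡ true
    W-is-affine {g} {g′} {g″} t e v v′ = does-true (vanish? g″) λ k → trans (functional-affine (nice-fn k) t e)
      (trans (cong₂ (λ x y → x +ᶠ t *ᶠ (y - x)) (true-does (vanish? g) v k) (true-does (vanish? g′) v′ k)) (interpolate-0 t))

    ψ∈Ω : ∀ n → W (gram n) ≡ true → Ω (ψ n) ≡ true
    ψ∈Ω n t = true-Ω (ψ n) λ k → trans (functional-eval (nice-fn k) n) (true-does (vanish? (gram n)) t k)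

    ψ∈Ω⁻¹ : ∀ n → Ω (ψ n) ≡ true → W (gram n) ≡ true
    ψ∈Ω⁻¹ n t = does-true (vanish? (gram n)) λ k → trans (sym (functional-eval (nice-fn k) n)) (Ω-true (ψ n) t k)

    module Bound (K′ h : ℕ) (K≡ : K ≡ suc K′) (k₀ : Fin K) (1+h≡2K : suc h ≡ K ℕ.+ K) (dim : suc (twice h) ≤ d)
      (s : ℕ) (large : threshold K s ≤ p) (P : Poly (Fin K × Fin d)) (deg : Degree≤ s P)
      (G : Pt → Bool) (G-respects : Finite.Respects FPt G) (G⊆Ω : ∀ n → G n ≡ true → Ω n ≡ true) (G-good : ∀ n → G n ≡ true → ¬ Bad s P deg (uncurry n)) where

      problem : Problem s
      problem = record
        { W = W ; W-affine = W-is-affine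
        ; Bad = λ n → Bad s P deg (uncurry (ψ n))
        ; bad-curve = λ {D} N Dn cN cD t₀ n₀ nz e bad →
            -- The affine map `ψ` is homogenised with `Dn`: the image of the curve N / Dn has the
            -- same denominator, and its numerators have the same degree bound.
            let r = bad-along s P deg {D} (λ { (j , x) t → sum K (λ i → a i j *ᶠ N i x t) +ᶠ w j x *ᶠ Dn t }) Dn
                      (λ { (j , x) → curve-+ (curve-sum K λ i → curve-scale (a i j) (cN i x)) (curve-scale (w j x) cD) }) cD t₀ (uncurry (ψ n₀)) nz
                      (λ { (j , x) → substituted (λ i x → N i x t₀) (Dn t₀) n₀ e j x }) bad
            in proj₁ r , proj₁ (proj₂ r) , proj₁ (proj₂ (proj₂ r)) , λ t n nz e nq → proj₂ (proj₂ (proj₂ r)) t (uncurry (ψ n)) nz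
                      (λ { (j , x) → substituted (λ i x → N i x t) (Dn t) n e j x }) nq
        ; G = G ∘ ψ ; G-resp = λ e → G-respects (ψ-cong e) ; G-good = λ n → G-good (ψ n)
        ; G⊆Ω = λ n g → ψ∈Ω⁻¹ n (G⊆Ω (ψ n) g) }
        where
        open CurveTheory curves
        open CurveLemmas field-Fp curves using (curve-sum; curve-scale)
        substituted : (N : Pt) (D : F) (n : Pt) → (∀ i x → D *ᶠ n i x ≡ N i x) → ∀ j x → D *ᶠ ψ n j x ≡ sum K (λ i → a i j *ᶠ N i x) +ᶠ w j x *ᶠ D
        substituted N D n e j x = trans (cong (λ z → D *ᶠ (z +ᶠ w j x)) (ΣF≡sum K (λ i → a i j *ᶠ n i x)))
          (clear-denominator K (λ i → a i j) (λ i → n i x) (λ i → N i x) (w j x) D (λ i → e i x))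

      module T = Thresholds {K} {s} {p} large

      p≤1+units : p ≤ suc units
      p≤1+units = ℕP.≤-trans (ℕP.≤-reflexive (sym (length-tabulate {n = p} (λ i → i)))) q≤1+units

      q≡p : FiniteField.q field-Fp ≡ p
      q≡p = length-tabulate {n = p} (λ i → i)

      C-large : Counting.Large field-Fp curves d K K′ h K≡ k₀ 1+h≡2K form s problem
      C-large = record
        { large-chart = ℕP.≤-pred (ℕP.≤-trans T.chart p≤1+units)
        ; large-link  = ℕP.≤-trans T.link (ℕP.≤-reflexive (sym q≡p))
        ; large-cross = ℕP.≤-trans T.cross (ℕP.≤-reflexive (sym q≡p))
        ; large-line  = ℕP.≤-trans T.line (ℕP.≤-reflexive (sym q≡p))
        ; large-K     = ℕP.≤-pred (ℕP.≤-trans T.K+2≤p p≤1+units) }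

      private
        module FPt = Finite FPt

        Mat-nonZero : NonZero (Finite.size FMat)
        Mat-nonZero = subst NonZero (sym (trans (size-functions (FV K) K) (cong (ℕ._^ K) (trans (size-functions (FiniteField.finite field-Fp) K) (cong (ℕ._^ K) q≡p)))))
          (ℕP.m^n≢0 (p ℕ.^ K) K {{ℕP.m^n≢0 p K}})

      -- The abstract bound transported along the bijection `ψ`. The factor 2 pays for replacing
      -- `units` by p.
      bound : ∀ x₀ → Ω x₀ ≡ true → Bad s P deg (uncurry x₀) → count p G ℕ.* p ≤ count p Ω ℕ.* (2 ℕ.* chartConstant K h s)
      bound x₀ x₀∈Ω (X , lifts , bad) = begin
        count p G ℕ.* p ≤⟨ ℕP.*-monoˡ-≤ p pull ⟩
        FPt.# (G ∘ ψ) ℕ.* p ≤⟨ ℕP.*-monoʳ-≤ (FPt.# (G ∘ ψ)) p≤2units ⟩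
        FPt.# (G ∘ ψ) ℕ.* (2 ℕ.* units) ≡⟨ exchange (FPt.# (G ∘ ψ)) units ⟩
        2 ℕ.* (FPt.# (G ∘ ψ) ℕ.* units) ≤⟨ ℕP.*-monoʳ-≤ 2 (Counting.Final.main-bound field-Fp curves d K K′ h K≡ k₀ 1+h≡2K form s problem C-large (Orthogonal.frame field-Fp d form nondegenerate h dim) {{Mat-nonZero}} (ψ⁻¹ x₀)
            (ψ∈Ω⁻¹ (ψ⁻¹ x₀) (Ω-respects (λ i x → sym (ψ-ψ⁻¹ x₀ i x)) x₀∈Ω))
            (X , (λ { (i , x) → subst (Localisation.ρ p p-prime 2<p (X (i , x))) (sym (ψ-ψ⁻¹ x₀ i x)) (lifts (i , x)) }) , bad)) ⟩
        2 ℕ.* (FPt.# (W ∘ gram) ℕ.* chartConstant K h s) ≤⟨ ℕP.*-monoʳ-≤ 2 (ℕP.*-monoˡ-≤ (chartConstant K h s) push) ⟩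
        2 ℕ.* (count p Ω ℕ.* chartConstant K h s) ≡⟨ exchange (count p Ω) (chartConstant K h s) ⟨
        count p Ω ℕ.* (2 ℕ.* chartConstant K h s) ∎
        where
        open ℕP.≤-Reasoning
        exchange : ∀ a b → a ℕ.* (2 ℕ.* b) ≡ 2 ℕ.* (a ℕ.* b)
        exchange a b = trans (sym (ℕP.*-assoc a 2 b)) (trans (cong (ℕ._* b) (ℕP.*-comm a 2)) (ℕP.*-assoc 2 a b))
        p≤2units : p ≤ 2 ℕ.* units
        p≤2units = ℕP.≤-trans p≤1+units (ℕP.≤-trans (ℕP.+-monoˡ-≤ units (ℕP.≤-trans (s≤s z≤n) (Counting.Large.large-K C-large)))
          (ℕP.≤-reflexive (cong (units ℕ.+_) (sym (ℕP.+-identityʳ units)))))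
        pull : count p G ≤ FPt.# (G ∘ ψ)
        pull = #-inject FPt FPt G (G ∘ ψ) ψ⁻¹ (λ e → G-respects (ψ-cong e)) (λ y g → G-respects (λ i x → sym (ψ-ψ⁻¹ y i x)) g)
          (λ y y′ _ _ e i x → trans (sym (ψ-ψ⁻¹ y i x)) (trans (ψ-cong e i x) (ψ-ψ⁻¹ y′ i x)))
        push : FPt.# (W ∘ gram) ≤ count p Ω
        push = #-inject FPt FPt (W ∘ gram) Ω ψ Ω-respects ψ∈Ω (λ _ _ _ _ → ψ-injective)

-- The three irreducibility assertions.

private
  ∧-false : ∀ {a b} → a ≡ true → a ∧ not b ≡ false → b ≡ true
  ∧-false {b = true} refl _ = refl

module Irreducibility (p : ℕ) {{_ : NonZero p}} (p-prime : Prime p) (2<p : 2 < p) (d K : ℕ)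
  (M : QuadForm p d) (A-sym : Symmetric p M) (A-det : NonDegenerate p M) (Ω : SubsetPt p d K) (nice : NiceMSet p M Ω)
  (K′ h : ℕ) (K≡ : K ≡ suc K′) (k₀ : Fin K) (1+h≡2K : suc h ≡ K ℕ.+ K) (dim : suc (twice h) ≤ d)
  (s : ℕ) (large : threshold K s ≤ p) (δ : ℚ)
  (dense : ∀ a b → a ℕ.* p ≤ b ℕ.* (2 ℕ.* chartConstant K h s) → fromℕQ a ≤ℚ δ *ℚ fromℕQ b) where
  open import Data.Rational using (_+_; _*_)

  open Setting p p-prime 2<p d K M A-sym A-det
  open NiceSet Ω nice
  open Localisation p p-prime 2<p
  open Integrality p p-prime 2<p

  private
    module FPt = Finite FPt
    s<p = Thresholds.s<p {K} {s} {p} large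

  values-cong : ∀ (P : PolyF p d K) {n m : Pt} → n ≋ m → evalPF p P n ≡ evalPF p P m
  values-cong [] e = refl
  values-cong ((c , w) ∷ P) {n} {m} e = cong₂ (_+F_ p) (cong (_*F_ p c) (monomials w)) (values-cong P e)
    where
    at : Pt → List (Fin K × Fin d) → Fin p
    at n = foldr (λ v acc → _*F_ p (n (proj₁ v) (proj₂ v)) acc) (1F p)
    monomials : ∀ w → at n w ≡ at m w
    monomials [] = refl
    monomials ((i , a) ∷ w) = cong₂ (_*F_ p) (e i a) (monomials w)

  liftOf : PolyF p d K → Poly (Fin K × Fin d)
  liftOf = map λ t → lift (proj₁ t) , proj₂ t

  -- p-integral at the lifts of the zeros of P only
  overp : PolyF p d K → Poly (Fin K × Fin d)
  overp = map λ t → 𝕡⁻¹ * lift (proj₁ t) , proj₂ t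

  degree-overp : ∀ P → DegLeF p s P → Degree≤ s (overp P)
  degree-overp [] [] = []
  degree-overp (_ ∷ P) (le ∷ deg) = le ∷ degree-overp P deg

  eval-overp : ∀ P X → eval (overp P) X ≡ 𝕡⁻¹ * eval (liftOf P) X
  eval-overp [] X = sym (ℚP.*-zeroʳ 𝕡⁻¹)
  eval-overp ((c , m) ∷ P) X = trans (cong₂ _+_ (ℚP.*-assoc 𝕡⁻¹ (lift c) (monomial X m)) (eval-overp P X)) (sym (ℚP.*-distribˡ-+ 𝕡⁻¹ _ _))

  ρ-eval : ∀ P {X n} → (∀ v → ρ (X v) (uncurry n v)) → ρ (eval (liftOf P) X) (evalPF p P n)
  ρ-eval [] r = ρ-ℕ 0
  ρ-eval ((c , m) ∷ P) {X} {n} r = ρ-+ (ρ-* (ρ-lift c) (monomials m)) (ρ-eval P r)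
    where
    monomials : ∀ m → ρ (monomial X m) (foldr (λ v acc → _*F_ p (n (proj₁ v) (proj₂ v)) acc) (1F p) m)
    monomials [] = ρ-ℕ 1
    monomials (v ∷ m) = ρ-* (r v) (monomials m)

  module _ (P : PolyF p d K) (deg : DegLeF p s P) where
    nonzero⇒bad : ∀ n → evalPF p P n ≢ 0F p → Bad s (overp P) (degree-overp P deg) (uncurry n)
    nonzero⇒bad n nz = X , (λ v → ρ-lift (uncurry n v)) ,
        λ i → nz (integral-ρ-0 (ρ-eval P {X} {n} (λ v → ρ-lift (uncurry n v))) (subst InR (eval-overp P X) i))
      where
      X : Fin K × Fin d → ℚ
      X v = lift (uncurry n v)

    zero⇒good : ∀ n → evalPF p P n ≡ 0F p → ¬ Bad s (overp P) (degree-overp P deg) (uncurry n)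
    zero⇒good n z (X , r , bad) = bad (subst InR (sym (eval-overp P X)) (ρ-0-integral (subst (ρ _) z (ρ-eval P r))))

    zero? : Pt → Bool
    zero? n = _≡ᵇF_ p (evalPF p P n) (0F p)

    zero-true : ∀ n → zero? n ≡ true → evalPF p P n ≡ 0F p
    zero-true n = true-does (FiniteField._≟_ field-Fp (evalPF p P n) (0F p))

    true-zero : ∀ n → evalPF p P n ≡ 0F p → zero? n ≡ true
    true-zero n = does-true (FiniteField._≟_ field-Fp (evalPF p P n) (0F p))

    -- For the rational polynomial P / p the points of Ω outside the zero set are bad and those
    -- inside are good, so a single non-zero value triggers the bound.
    zero-or-few : (fromℕQ (count p (λ n → Ω n ∧ zero? n)) ≤ℚ δ * fromℕQ (count p Ω)) ⊎ (∀ n → Ω n ≡ true → evalPF p P n ≡ 0F p)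
    zero-or-few = by (search FPt (λ n → Ω n ∧ not (zero? n)) respects)
      where
      respects : FPt.Respects (λ n → Ω n ∧ not (zero? n))
      respects {n} {m} e t = ∧-intro (Ω-respects e (proj₁ (∧-true {Ω n} t)))
        (trans (cong (λ z → not (_≡ᵇF_ p z (0F p))) (sym (values-cong P e))) (proj₂ (∧-true {Ω n} t)))
      by : (Σ Pt λ n → Ω n ∧ not (zero? n) ≡ true) ⊎ (∀ n → Ω n ∧ not (zero? n) ≡ false) →
        (fromℕQ (count p (λ n → Ω n ∧ zero? n)) ≤ℚ δ * fromℕQ (count p Ω)) ⊎ (∀ n → Ω n ≡ true → evalPF p P n ≡ 0F p)
      by (inj₂ none) = inj₂ λ n n∈Ω → zero-true n (∧-false {Ω n} {zero? n} n∈Ω (none n))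
      by (inj₁ (x₀ , t)) = inj₁ (dense (count p (λ n → Ω n ∧ zero? n)) (count p Ω) (Bound.bound K′ h K≡ k₀ 1+h≡2K dim s large (overp P) (degree-overp P deg) (λ n → Ω n ∧ zero? n)
          (λ {n} {m} e t → ∧-intro (Ω-respects e (proj₁ (∧-true {Ω n} t))) (true-zero m (trans (sym (values-cong P e)) (zero-true n (proj₂ (∧-true {Ω n} t))))))
          (λ n t → proj₁ (∧-true {Ω n} t)) (λ n t → zero⇒good n (zero-true n (proj₂ (∧-true {Ω n} t))))
          x₀ (proj₁ (∧-true {Ω x₀} t)) (nonzero⇒bad x₀ λ z → contradictory {zero? x₀} (true-zero x₀ z) (not-true {zero? x₀} (proj₂ (∧-true {Ω x₀} t))))))

  irreducibleF : IrreducibleF p δ s Ω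
  irreducibleF P deg = zero-or-few P deg

  k : ℕ
  k = K ℕ.* d

  flat : Pt → Fin k → Fin p
  flat n v = uncurry n (remQuot d v)

  lookup-τ : ∀ n v → lookup (τPt p n) v ≡ pos (toℕ (flat n v))
  lookup-τ n v = trans (cong (lookup (τPt p n)) (sym (combine-remQuot {K} d v))) (trans (lookup-concat rows (proj₁ ia) (proj₂ ia))
      (trans (cong (λ xs → lookup xs (proj₂ ia)) (VecP.lookup∘tabulate row (proj₁ ia))) (VecP.lookup∘tabulate (λ a → pos (toℕ (n (proj₁ ia) a))) (proj₂ ia))))
    where
    ia = remQuot {K} d v
    row : Fin K → Vec ℤ d
    row i = Vec.tabulate (λ a → pos (toℕ (n i a)))
    rows = Vec.tabulate row

  flat-combine : ∀ n i a → flat n (combine i a) ≡ n i a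
  flat-combine n i a = cong (uncurry n) (remQuot-combine i a)

  τ-injective : ∀ {n m} → τPt p n ≡ τPt p m → n ≋ m
  τ-injective {n} {m} e i a = toℕ-injective (ℤP.+-injective (trans (sym (coordinate n)) (trans (cong (λ x → lookup x (combine i a)) e) (coordinate m))))
    where
    coordinate : ∀ n → lookup (τPt p n) (combine i a) ≡ pos (toℕ (n i a))
    coordinate n = trans (lookup-τ n (combine i a)) (cong (pos ∘ toℕ) (flat-combine n i a))

  τ-cong : ∀ {n m} → n ≋ m → τPt p n ≡ τPt p m
  τ-cong {n} {m} e = vec-ext λ v → trans (lookup-τ n v) (trans (cong (pos ∘ toℕ) (e (proj₁ (remQuot {K} d v)) (proj₂ (remQuot {K} d v)))) (sym (lookup-τ m v)))

  ρ-shifted : ∀ a (b : ℤ) → ρ (ι (pos (toℕ a) ℤ.+ pos p ℤ.* b)) a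
  ρ-shifted a b = subst (λ x → ρ x a) (trans (cong (lift a +_) (sym (ι-* (pos p) b))) (sym (ι-+ (pos (toℕ a)) (pos p ℤ.* b)))) (ρ-shift (ρ-lift a) (R-ι b))

  Ω′ : Vec ℤ k → Set
  Ω′ = OmegaPrime p (τSet p {d} {K} Ω)

  τ∈Ω′ : ∀ n → Ω n ≡ true → Ω′ (τPt p n)
  τ∈Ω′ n n∈Ω = (λ v → subst (λ z → (pos 0 ℤ.≤ z) × (z ℤ.< pos p)) (sym (lookup-τ n v)) (+≤+ z≤n , +<+ (toℕ<n (flat n v)))) ,
      τPt p n , (n , n∈Ω , refl) , Vec.replicate k (pos 0) ,
      vec-ext λ v → sym (trans (lookup-shiftP p (τPt p n) _ v) (trans (cong (λ z → lookup (τPt p n) v ℤ.+ pos p ℤ.* z) (VecP.lookup-replicate v (pos 0)))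
        (trans (cong (λ z → lookup (τPt p n) v ℤ.+ z) (ℤP.*-zeroʳ (pos p))) (ℤP.+-identityʳ _))))

  Ω′-lift : ∀ x → Ω′ x → Σ Pt λ n → Ω n ≡ true × (∀ v → ρ (ι (lookup x v)) (flat n v))
  Ω′-lift x (_ , y , (n , n∈Ω , refl) , m , refl) = n , n∈Ω , λ v →
    subst (λ z → ρ (ι z) (flat n v)) (sym (trans (lookup-shiftP p (τPt p n) m v) (cong (λ z → z ℤ.+ pos p ℤ.* lookup m v) (lookup-τ n v)))) (ρ-shifted (flat n v) (lookup m v))

  -- An integer in [0 , p) is determined by its residue, so passing to representatives modulo p adds
  -- no point to τ(Ω).
  Ω′-τ : ∀ x → Ω′ x → Σ Pt λ n → Ω n ≡ true × x ≡ τPt p n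
  Ω′-τ x x∈ = n , proj₁ (proj₂ l) , vec-ext λ v → trans (reduced v) (sym (lookup-τ n v))
    where
    l = Ω′-lift x x∈
    n = proj₁ l
    reduced : ∀ v → lookup x v ≡ pos (toℕ (flat n v))
    reduced v = by (lookup x v) (proj₁ x∈ v) (proj₂ (proj₂ l) v)
      where
      by : ∀ z → (pos 0 ℤ.≤ z) × (z ℤ.< pos p) → ρ (ι z) (flat n v) → z ≡ pos (toℕ (flat n v))
      by (pos j) (_ , +<+ j<p) r = cong pos (trans (sym (trans (toℕ-residue j) (m<n⇒m%n≡m j<p))) (cong toℕ (ρ-≡ (ρ-ℕ j) r)))
      by -[1+ j ] (() , _) _

  module _ (q e : ℕ) (q≡ : q ≡ p ℕ.^ e) (P : PolyQ k) (deg : DegLeQ s P) (values : ValuesIn1/ q P) where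
    P′ : Poly (Fin K × Fin d)
    P′ = rename (remQuot d) P

    deg′ : Degree≤ s P′
    deg′ = degree-rename (remQuot d) P deg

    shifted : Pt → (Fin k → Fin p) → ℚ
    shifted n m = eval P (λ v → lift (flat n v) + 𝕡 * lift (m v))

    integral-on-lifts : ∀ n → (∀ m → InR (shifted n m)) → ∀ X → (∀ v → ρ (X v) (flat n v)) → InR (eval P X)
    integral-on-lifts n = lifts-suffice s s<p P deg (flat n)

    Vp-on-lifts : ∀ n → (∀ m → InR (shifted n m)) → ∀ x → (∀ v → ρ (ι (lookup x v)) (flat n v)) → Vp p P x
    Vp-on-lifts n h x r m = integer-powers e (integral-on-lifts n h (λ v → ι (lookup (shiftP p x m) v)) λ v →
        subst (λ z → ρ z (flat n v)) (sym (trans (cong ι (lookup-shiftP p x m v)) (trans (ι-+ (lookup x v) (pos p ℤ.* lookup m v)) (cong (ι (lookup x v) +_) (ι-* (pos p) (lookup m v))))))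
          (ρ-shift (r v) (R-ι (lookup m v))))
      (subst (λ q → IsIntQ (fromℕQ q * evalQ P (shiftP p x m))) q≡ (values (shiftP p x m)))

    Vp⇒integral : ∀ n → Vp p P (τPt p n) → ∀ m → InR (shifted n m)
    Vp⇒integral n vp m = subst InR (eval-cong P λ v → trans (cong ι (trans (lookup-shiftP p (τPt p n) _ v)
        (cong₂ (λ a b → a ℤ.+ pos p ℤ.* b) (lookup-τ n v) (VecP.lookup∘tabulate (pos ∘ toℕ ∘ m) v))))
          (trans (ι-+ (pos (toℕ (flat n v))) (pos p ℤ.* pos (toℕ (m v)))) (cong (lift (flat n v) +_) (ι-* (pos p) (pos (toℕ (m v)))))))
      (integer⇒InR (vp (tabulate (pos ∘ toℕ ∘ m))))

    Search : Finite (Pt × (Fin k → Fin p))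
    Search = product FPt (functions (FiniteField.finite field-Fp) k)

    fails : Pt × (Fin k → Fin p) → Bool
    fails (n , m) = Ω n ∧ not (does (InR? (shifted n m)))

    fails-resp : Finite.Respects Search fails
    fails-resp {n , m} {n′ , m′} (e , e′) t = ∧-intro (Ω-respects e (proj₁ (∧-true {Ω n} t)))
      (trans (cong (λ z → not (does (InR? z))) (sym (eval-cong P λ v → cong₂ (λ a b → lift a + 𝕡 * lift b) (e (proj₁ (remQuot {K} d v)) (proj₂ (remQuot {K} d v))) (e′ v)))) (proj₂ (∧-true {Ω n} t)))

    _∈?_ : (x : Vec ℤ k) (xs : List (Vec ℤ k)) → Dec (x ∈ xs)
    _∈?_ = DecMembership._∈?_ (VecP.≡-dec ℤP._≟_)

    -- `Vp` quantifies over infinitely many shifts, but by `lifts-suffice` any failure is visible on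
    -- shifts by residues. A finite search over points and such shifts therefore decides between the
    -- alternatives.
    few-or-all : (∀ N M → HasCard (λ x → Vp p P x × Ω′ x) N → HasCard Ω′ M → fromℕQ N ≤ℚ δ * fromℕQ M) ⊎ (∀ x → Ω′ x → Vp p P x)
    few-or-all = by (search Search fails fails-resp)
      where
      by : (Σ (Pt × (Fin k → Fin p)) λ nm → fails nm ≡ true) ⊎ (∀ nm → fails nm ≡ false) →
        (∀ N M → HasCard (λ x → Vp p P x × Ω′ x) N → HasCard Ω′ M → fromℕQ N ≤ℚ δ * fromℕQ M) ⊎ (∀ x → Ω′ x → Vp p P x)
      by (inj₂ none) = inj₂ λ x x∈ → let n , n∈Ω , r = Ω′-lift x x∈ in
        Vp-on-lifts n (λ m → true-does (InR? (shifted n m)) (∧-false {Ω n} {does (InR? (shifted n m))} n∈Ω (none (n , m)))) x r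
      by (inj₁ ((x₀ , m₀) , t)) = inj₁ few
        where
        x₀∈Ω = proj₁ (∧-true {Ω x₀} t)
        x₀-bad : Bad s P′ deg′ (uncurry x₀)
        x₀-bad = X₀ , (λ { (i , a) → ρ-shift (ρ-lift (x₀ i a)) (R-ι (pos (toℕ (m₀ (combine i a))))) }) ,
            λ i → contradictory {does (InR? (shifted x₀ m₀))} (does-true (InR? (shifted x₀ m₀)) (subst InR same i)) (not-true {does (InR? (shifted x₀ m₀))} (proj₂ (∧-true {Ω x₀} t)))
          where
          X₀ : Fin K × Fin d → ℚ
          X₀ (i , a) = lift (x₀ i a) + 𝕡 * lift (m₀ (combine i a))
          same : eval P′ X₀ ≡ shifted x₀ m₀
          same = trans (eval-rename (remQuot d) X₀ P) (eval-cong P λ v → cong (λ u → lift (flat x₀ v) + 𝕡 * lift (m₀ u)) (combine-remQuot {K} d v))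
        few : ∀ N M → HasCard (λ x → Vp p P x × Ω′ x) N → HasCard Ω′ M → fromℕQ N ≤ℚ δ * fromℕQ M
        few _ _ (L , uL , memL , refl) (L′ , uL′ , memL′ , refl) = dense (length L) (length L′) (ℕP.≤-trans (ℕP.*-monoˡ-≤ p L≤G) (ℕP.≤-trans
            (Bound.bound K′ h K≡ k₀ 1+h≡2K dim s large P′ deg′ G G-resp (λ n g → proj₁ (∧-true {Ω n} g)) G-good x₀ x₀∈Ω x₀-bad) (ℕP.*-monoˡ-≤ (2 ℕ.* chartConstant K h s) Ω≤L′)))
          where
          G : Pt → Bool
          -- The list `L` that witnesses the cardinality serves as the Boolean test for membership
          -- in `Vp`.
          G n = Ω n ∧ does (τPt p n ∈? L)
          G-resp : FPt.Respects G
          G-resp {n} {m} e g = ∧-intro (Ω-respects e (proj₁ (∧-true {Ω n} g))) (subst (λ x → does (x ∈? L) ≡ true) (τ-cong e) (proj₂ (∧-true {Ω n} g)))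
          G-good : ∀ n → G n ≡ true → ¬ Bad s P′ deg′ (uncurry n)
          G-good n g (X , r , bad) = bad (subst InR (sym (eval-rename (remQuot d) X P)) (integral-on-lifts n
            (Vp⇒integral n (proj₁ (Equivalence.to (memL (τPt p n)) (true-does (τPt p n ∈? L) (proj₂ (∧-true {Ω n} g)))))) (X ∘ remQuot d) (λ v → r (remQuot d v))))
          L≤G : length L ≤ count p G
          L≤G = length-inject (λ x n → x ≡ τPt p n) L (filterᵇ G (allPts p d K)) (All.tabulate λ {x} x∈L →
              let n , n∈Ω , x≡ = Ω′-τ x (proj₂ (Equivalence.to (memL x) x∈L)) in
              filterᵇ-any G (Any.map (λ e → trans x≡ (τ-cong e) , G-resp e (∧-intro n∈Ω (does-true (τPt p n ∈? L) (subst (_∈ L) x≡ x∈L)))) (FPt.complete n)))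
            (AllPairs.map (λ ne n e e′ → ne (trans e (sym e′))) uL)
          Ω≤L′ : count p Ω ≤ length L′
          Ω≤L′ = length-inject (λ n x → τPt p n ≡ x) (filterᵇ Ω (allPts p d K)) L′
            (All.map (λ {n} n∈Ω → Equivalence.from (memL′ (τPt p n)) (τ∈Ω′ n n∈Ω)) (filterᵇ-all Ω (allPts p d K)))
            (AllPairs.map (λ ne x e e′ → ne (τ-injective (trans e (sym e′)))) (filterᵇ-AllPairs Ω FPt.unique))

  irreducibleZ : ∀ q e → q ≡ p ℕ.^ e → IrrZ q δ p s (τSet p {d} {K} Ω)
  irreducibleZ q e q≡ P deg values = few-or-all q e q≡ P deg values

-- The choice of the constant, and the conclusion.

sumUpTo : (ℕ → ℕ) → ℕ → ℕ
sumUpTo f zero    = f zero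
sumUpTo f (suc n) = f (suc n) ℕ.+ sumUpTo f n

≤-sumUpTo : ∀ f {k n} → k ≤ n → f k ≤ sumUpTo f n
≤-sumUpTo f {n = zero} z≤n = ℕP.≤-refl
≤-sumUpTo f {k} {suc n} le = by (ℕP.m≤n⇒m<n∨m≡n le)
  where
  by : k < suc n ⊎ k ≡ suc n → f k ≤ sumUpTo f (suc n)
  by (inj₁ (s≤s lt)) = ℕP.≤-trans (≤-sumUpTo f lt) (ℕP.m≤n+m _ (f (suc n)))
  by (inj₂ refl) = ℕP.m≤m+n _ _

bound-for : ℕ → ℕ → ℕ
bound-for s K = threshold K s ℕ.+ 2 ℕ.* chartConstant K (K ℕ.+ K ℕ.∸ 1) s

twice≡ : ∀ h → twice h ≡ h ℕ.+ h
twice≡ zero    = refl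
twice≡ (suc h) = cong suc (trans (cong suc (twice≡ h)) (sym (ℕP.+-suc h h)))

private
  four-K : ∀ K′ → 4 ℕ.* suc K′ ≡ 2 ℕ.+ ((K′ ℕ.+ suc K′) ℕ.+ (K′ ℕ.+ suc K′))
  four-K = solve-∀

  four-K′ : ∀ K′ → 4 ℕ.* suc K′ ≡ suc (suc K′ ℕ.+ (K′ ℕ.+ K′ ℕ.+ K′ ℕ.+ 2))
  four-K′ = solve-∀

open import Data.Nat using (_+_; _*_)

theorem9p14 : (d s : ℕ) → Σ ℕ λ C →
    (K p : ℕ) {{_ : NonZero p}} → Prime p → 1 ≤ d → 1 ≤ K →
    (δ : ℚ) → 0ℚ <ℚ δ →
    (M : QuadForm p d) → Symmetric p M → NonDegenerate p M →
    (Ω : SubsetPt p d K) → NiceMSet p M Ω → ConsistentMSet p M Ω →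
    (Σ ℕ λ r → IsTotalCodim p M Ω r × (2 * r + 1 ≤ d)) →
    4 * K ≤ d + 1 →
    fromℕQ C ≤ℚ fromℕQ p *ℚ (δ ^Q C) →
    IrreducibleF p δ s Ω
    × WeaklyIrreducible δ p s (τSet p {d} {K} Ω)
    × StronglyIrreducible δ p s (τSet p {d} {K} Ω)
-- A successor, so that the power of δ in the hypothesis contains at least one factor δ.
theorem9p14 d s = suc C , proof
  where
  -- The constant may depend on d and s but not on K. Since 4K ≤ d + 1 forces K ≤ d, a sum over
  -- these values dominates all the bounds.
  C = sumUpTo (bound-for s) d
  proof : _
  proof (suc K′) (suc p′) p-prime _ _ δ 0<δ M A-sym A-det Ω nice _ _ 4K≤ C≤ = by (ℚP.≤-total δ 1ℚ)
    where
    p = suc p′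
    K = suc K′
    by : δ ≤ℚ 1ℚ ⊎ 1ℚ ≤ℚ δ → IrreducibleF p δ s Ω × WeaklyIrreducible δ p s (τSet p {d} {K} Ω) × StronglyIrreducible δ p s (τSet p {d} {K} Ω)
    -- For δ ≥ 1 the density bound is mere inclusion; in the other case all powers of δ are at most
    -- 1.
    by (inj₂ 1≤δ) = (λ P deg → inj₁ (trivial-density 0<δ 1≤δ {b = count p Ω} (filterᵇ-mono (λ n → Ω n ∧ _≡ᵇF_ p (evalPF p P n) (0F p)) Ω (allPts p d K) (All.universal (λ n t → proj₁ (∧-true {Ω n} t)) (allPts p d K))))) , trivially p , trivially (p ℕ.^ s)
      where
      trivially : ∀ q → IrrZ q δ p s (τSet p {d} {K} Ω)
      trivially q P deg values = inj₁ λ { _ _ (L , uL , memL , refl) (L′ , uL′ , memL′ , refl) → trivial-density 0<δ 1≤δ {length L} {length L′}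
        (length-inject _≡_ L L′ (All.tabulate λ {x} x∈L → Equivalence.from (memL′ x) (proj₂ (Equivalence.to (memL x) x∈L))) (AllPairs.map (λ ne y e e′ → ne (trans e (sym e′))) uL)) }
    -- The weak and the strong assertion differ only in the power of p that clears the denominators,
    -- with exponent 1 and s.
    by (inj₁ δ≤1) = I.irreducibleF , I.irreducibleZ p 1 (sym (ℕP.*-identityʳ p)) , I.irreducibleZ (p ℕ.^ s) s refl
      where
      h = K′ ℕ.+ suc K′
      C≤p : suc C ≤ p
      C≤p = large-p 0<δ δ≤1 {suc C} {p} C≤
      K≤d : K ≤ d
      K≤d = ℕP.≤-trans (ℕP.m≤m+n K _) (ℕP.≤-pred (ℕP.≤-trans (ℕP.≤-reflexive (sym (four-K′ K′))) (ℕP.≤-trans 4K≤ (ℕP.≤-reflexive (ℕP.+-comm d 1)))))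
      dim : suc (twice h) ≤ d
      dim = ℕP.≤-pred (ℕP.≤-trans (ℕP.≤-reflexive (trans (cong (2 ℕ.+_) (twice≡ h)) (sym (four-K K′)))) (ℕP.≤-trans 4K≤ (ℕP.≤-reflexive (ℕP.+-comm d 1))))
      bound≤C : bound-for s K ≤ C
      bound≤C = ≤-sumUpTo (bound-for s) K≤d
      large : threshold K s ≤ p
      large = ℕP.≤-trans (ℕP.m≤m+n _ _) (ℕP.≤-trans bound≤C (ℕP.≤-trans (ℕP.n≤1+n C) C≤p))
      dense : ∀ a b → a ℕ.* p ≤ b ℕ.* (2 ℕ.* chartConstant K h s) → fromℕQ a ≤ℚ δ *ℚ fromℕQ b
      dense a b le = density 0<δ δ≤1 {C} {p′} C≤ {a} {b} (ℕP.≤-trans le (ℕP.*-monoʳ-≤ b (ℕP.≤-trans (ℕP.m≤n+m _ (threshold K s)) (ℕP.≤-trans bound≤C (ℕP.n≤1+n C)))))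
      module I = Irreducibility p p-prime (Thresholds.2<p {K} {s} {p} large) d K M A-sym A-det Ω nice K′ h refl Fin.zero refl dim s large δ dense
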